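{- Let $p$ be a sufficiently large prime and let $F(X)\in\mathbb{F}_p[X]$ be a square-free polynomial of degree $d_F\geq 1$. Then for every integer $m$ with $2\leq m\ll(\log p)^{1/4}$ we have $$\sum_{a=0}^{m-1}\left(\Phi_p(F;m,a)-\frac{1}{m}\right)^2\ll_{d_F}\frac{m^2}{\log p},$$ where the implied constant depends only on $d_F$ (and on the implied constant in the bound on $m$).
   Context: $\chi_p=\left(\frac{\cdot}{p}\right)$ denotes the Legendre symbol modulo $p$ (with $\chi_p(0)=0$). For a positive integer $k\leq p$, $S_p(F,k)=\sum_{n\leq k}\chi_p(F(n))$, the sum over positive integers $n\leq k$ (with $F(n)$ evaluated in $\mathbb{F}_p$). For an integer $m\ge 2$ and residue $a$, $\Phi_p(F;m,a)=\frac{1}{p}\left|\{1\leq k\leq p: S_p(F,k)\equiv a \bmod m\}\right|$. -}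

module Defs where

open import Data.Nat as ℕ using (ℕ; zero; suc; _≡ᵇ_)
open import Data.Nat.DivMod using (_%_)
open import Data.Bool using (Bool; true; false; if_then_else_)
open import Data.List using (List; []; _∷_; map; foldr; upTo)
open import Data.Bool.ListAction using (any)
open import Data.Integer as ℤ using (ℤ; +_; -[1+_])
open import Data.Integer.DivMod using (_%ℕ_)
open import Data.Rational as ℚ using (ℚ; 0ℚ)
open import Relation.Binary.PropositionalEquality using (_≡_; _≢_)

-- Polynomials with natural-number coefficients, lowest degree first,
-- regarded as elements of F_p[X] by reducing coefficients mod p.
Poly : Set
Poly = List ℕ

-- reduction mod n (n = 0 gives identity; only used with n = p prime)
modN : ℕ → ℕ → ℕ
modN a zero = a
modN a (suc n) = a % suc n

coeff : Poly → ℕ → ℕ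
coeff [] _ = 0
coeff (a ∷ as) zero = a
coeff (a ∷ as) (suc k) = coeff as k

addP : Poly → Poly → Poly
addP [] B = B
addP A [] = A
addP (a ∷ A) (b ∷ B) = (a ℕ.+ b) ∷ addP A B

mulP : Poly → Poly → Poly
mulP [] B = []
mulP (a ∷ A) B = addP (map (a ℕ.*_) B) (0 ∷ mulP A B)

PolyEq : ℕ → Poly → Poly → Set
PolyEq p A B = ∀ k → modN (coeff A k) p ≡ modN (coeff B k) p

HasDegree : ℕ → Poly → ℕ → Set
HasDegree p F d = (modN (coeff F d) p ≢ 0) × (∀ k → d ℕ.< k → modN (coeff F k) p ≡ 0)
  where open import Data.Product using (_×_)

IsConstant : ℕ → Poly → Set
IsConstant p G = ∀ k → 1 ℕ.≤ k → modN (coeff G k) p ≡ 0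

SquareFree : ℕ → Poly → Set
SquareFree p F = ∀ G H → PolyEq p (mulP (mulP G G) H) F → IsConstant p G

-- evaluation (Horner), as a natural number; reduce mod p afterwards
eval : Poly → ℕ → ℕ
eval F n = foldr (λ c acc → c ℕ.+ n ℕ.* acc) 0 F

isSquareMod : ℕ → ℕ → Bool
isSquareMod p a = any (λ x → modN (x ℕ.* x) p ≡ᵇ modN a p) (upTo p)

legendre : ℕ → ℕ → ℤ
legendre p a =
  if modN a p ≡ᵇ 0 then + 0
  else (if isSquareMod p a then + 1 else -[1+ 0 ])

S : ℕ → Poly → ℕ → ℤ
S p F zero = + 0
S p F (suc k) = S p F k ℤ.+ legendre p (eval F (suc k))

zmod : ℤ → ℕ → ℕ
zmod i zero = 0
zmod i (suc n) = i %ℕ suc n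

countHits : ℕ → Poly → ℕ → ℕ → ℕ → ℕ
countHits p F m a zero = 0
countHits p F m a (suc k) =
  (if zmod (S p F (suc k)) m ≡ᵇ a then 1 else 0) ℕ.+ countHits p F m a k

-- the rational number a / n (0 if n = 0; only used with n ≥ 1)
frac : ℕ → ℕ → ℚ
frac a zero = 0ℚ
frac a (suc n) = (+ a) ℚ./ suc n

Phi : ℕ → Poly → ℕ → ℕ → ℚ
Phi p F m a = frac (countHits p F m a p) p

sqDev : ℕ → Poly → ℕ → ℚ
sqDev p F m = go m
  where
  go : ℕ → ℚ
  go zero = 0ℚ
  go (suc a) = go a ℚ.+ (Phi p F m a ℚ.- frac 1 m) ℚ.* (Phi p F m a ℚ.- frac 1 m)

{-# OPTIONS --safe #-}
-- Let s(k) = S_p(F, k) and let u be the quadratic solution of the Poisson equation for the simple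
-- walk on ℤ/m with source at a.  As the increments e(k) = χ_p(F(k)) are ±1 outside at most d zeros,
-- m · #{k ≤ p : s(k) ≡ a} − p is, up to boundary terms, a sum Σ_k e(k+1) V_a(s(k)) with |V_a| ≤ 2m.
-- Averaging this over windows of length L ≍ log p and applying Cauchy–Schwarz, the sum over a of
-- V_a(x) V_a(y) depends only on y − x, so only correlations of e inside a window survive.  Expanding
-- them in products of e costs a factor 2^L, which is beaten by a power saving for the character sums
-- Σ_x χ_p(∏_i F(x + i)).
-- The saving comes from Stepanov's method: for f = ∏_i F(X + i), g = f^((p−1)/2) and M a small power
-- of p, the pigeonhole principle yields an auxiliary polynomial f^M Σ_j (r_j + s_j g) X^(pj) that
-- vanishes to order M wherever g takes a given value ±1.  It is nonzero because r² f = c s² forces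
-- r = s = 0: some irreducible factor of F has no translate by 1, …, L dividing F (else F would have
-- more than d factors), so a translate of it divides f exactly once.
module Submission where

open import Level using (0ℓ)
open import Algebra.Bundles using (CommutativeRing)
import Algebra.Properties.Ring as RingProperties
import Algebra.Properties.Group as GroupProperties
import Algebra.Properties.AbelianGroup as AbelianGroupProperties
import Algebra.Properties.Semiring.Mult.TCOptimised as Multiples
import Algebra.Solver.Ring as RingSolver
import Algebra.Solver.Ring.AlmostCommutativeRing as ACR
open import Data.Maybe.Base using (Maybe; just; nothing)
open import Data.Nat.Base as ℕ using (ℕ; zero; suc)
open import Data.Integer.Base as ℤ using (ℤ; +_; -[1+_])
import Data.Integer.Properties as ℤₚ
import Data.Sign.Base as Sign
open import Relation.Nullary.Decidable.Core using (yes; no)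
open import Relation.Binary.PropositionalEquality.Core as ≡ using (_≡_)
import Relation.Binary.Reasoning.Setoid as SetoidReasoning

-- Any power saving in the character sums suffices. The window length is about a twentieth of log₂
-- p, so `Z = 2 ^ L` satisfies Z^20 ≤ p, and the loss 2^L is itself a small power of p. This leaves
-- room for a wasteful form of Stepanov's method: M is Z times factors polynomial in L and d, and
-- the linear system for the auxiliary polynomial is solved by counting vectors. Only upper bounds
-- for the level sets of the values 1 and -1 are proved. These two sets and the few zeros fill all p
-- points, so an upper bound close to p / 2 for one of them is a lower bound for the other. The
-- potential keeps the whole argument in the integers. Its values have size m², but they enter only
-- through boundary terms; the main sum contains V_a, whose size is linear in m. An irreducible
-- factor of F is never computed. Its existence is shown up to double negation, which is enough
-- because the conclusion drawn from it, that a polynomial is zero, is decidable.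

-- Ring solver with integer coefficients.

module IntegerSolver (R : CommutativeRing 0ℓ 0ℓ) where
  open CommutativeRing R
  open RingProperties ring using (-‿distribˡ-*; -‿distribʳ-*)
  open GroupProperties +-group using () renaming (⁻¹-involutive to -‿involutive; ε⁻¹≈ε to -0≈0)
  open AbelianGroupProperties +-abelianGroup using () renaming (⁻¹-∙-comm to -‿+-comm)
  open Multiples semiring using (_×_; 1+×; ×-homo-+; ×1-homo-*)
  open SetoidReasoning setoid

  -- For the chosen form of multiples, the images of 0 and 1 compute to `0#` and `1#`, so solved
  -- equations show these constants in the form in which goals contain them.
  ⟦_⟧ℤ : ℤ → Carrier
  ⟦ + n ⟧ℤ = n × 1#
  ⟦ -[1+ n ] ⟧ℤ = - (suc n × 1#)

  ⟦⟧ℤ-⊖ : ∀ m n → ⟦ m ℤ.⊖ n ⟧ℤ ≈ m × 1# - n × 1#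
  ⟦⟧ℤ-⊖ m zero = sym (trans (+-congˡ -0≈0) (+-identityʳ _))
  ⟦⟧ℤ-⊖ zero (suc n) = sym (+-identityˡ _)
  ⟦⟧ℤ-⊖ (suc m) (suc n) = begin
    ⟦ suc m ℤ.⊖ suc n ⟧ℤ ≡⟨ ≡.cong ⟦_⟧ℤ (ℤₚ.[1+m]⊖[1+n]≡m⊖n m n) ⟩
    ⟦ m ℤ.⊖ n ⟧ℤ ≈⟨ ⟦⟧ℤ-⊖ m n ⟩
    a - b ≈⟨ +-congʳ (sym (+-identityˡ a)) ⟩
    0# + a - b ≈⟨ +-congʳ (+-congʳ (sym (-‿inverseʳ 1#))) ⟩
    1# - 1# + a - b ≈⟨ +-congʳ (trans (+-assoc _ _ _) (trans (+-congˡ (+-comm _ _)) (sym (+-assoc _ _ _)))) ⟩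
    1# + a - 1# - b ≈⟨ +-assoc _ _ _ ⟩
    1# + a + (- 1# - b) ≈⟨ +-congˡ (-‿+-comm 1# b) ⟩
    1# + a - (1# + b) ≈⟨ +-cong (1+× m 1#) (-‿cong (1+× n 1#)) ⟨
    suc m × 1# - suc n × 1# ∎
    where
    a = m × 1#
    b = n × 1#

  ⟦⟧ℤ-neg : ∀ i → ⟦ ℤ.- i ⟧ℤ ≈ - ⟦ i ⟧ℤ
  ⟦⟧ℤ-neg (+ zero) = sym -0≈0
  ⟦⟧ℤ-neg (+ suc n) = refl
  ⟦⟧ℤ-neg -[1+ n ] = sym (-‿involutive _)

  ⟦⟧ℤ-+ : ∀ i j → ⟦ i ℤ.+ j ⟧ℤ ≈ ⟦ i ⟧ℤ + ⟦ j ⟧ℤ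
  ⟦⟧ℤ-+ (+ m) (+ n) = ×-homo-+ 1# m n
  ⟦⟧ℤ-+ (+ m) -[1+ n ] = ⟦⟧ℤ-⊖ m (suc n)
  ⟦⟧ℤ-+ -[1+ m ] (+ n) = trans (⟦⟧ℤ-⊖ n (suc m)) (+-comm _ _)
  ⟦⟧ℤ-+ -[1+ m ] -[1+ n ] = begin
    - (suc (suc (m ℕ.+ n)) × 1#) ≡⟨ ≡.cong (λ k → - (k × 1#)) (≡.cong suc (ℕ+-suc m n)) ⟨
    - ((suc m ℕ.+ suc n) × 1#) ≈⟨ -‿cong (×-homo-+ 1# (suc m) (suc n)) ⟩
    - (suc m × 1# + suc n × 1#) ≈⟨ -‿+-comm _ _ ⟨
    - (suc m × 1#) - suc n × 1# ∎
    where open import Data.Nat.Properties using () renaming (+-suc to ℕ+-suc)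

  ⟦⟧ℤ-+◃ : ∀ n → ⟦ Sign.+ ℤ.◃ n ⟧ℤ ≈ n × 1#
  ⟦⟧ℤ-+◃ n = reflexive (≡.cong ⟦_⟧ℤ (ℤₚ.+◃n≡+n n))

  ⟦⟧ℤ--◃ : ∀ n → ⟦ Sign.- ℤ.◃ n ⟧ℤ ≈ - (n × 1#)
  ⟦⟧ℤ--◃ n = trans (reflexive (≡.cong ⟦_⟧ℤ (ℤₚ.-◃n≡-n n))) (⟦⟧ℤ-neg (+ n))

  ⟦⟧ℤ-* : ∀ i j → ⟦ i ℤ.* j ⟧ℤ ≈ ⟦ i ⟧ℤ * ⟦ j ⟧ℤ
  ⟦⟧ℤ-* (+ m) (+ n) = trans (⟦⟧ℤ-+◃ (m ℕ.* n)) (×1-homo-* m n)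
  ⟦⟧ℤ-* (+ m) -[1+ n ] =
    trans (⟦⟧ℤ--◃ (m ℕ.* suc n)) (trans (-‿cong (×1-homo-* m (suc n))) (-‿distribʳ-* _ _))
  ⟦⟧ℤ-* -[1+ m ] (+ n) =
    trans (⟦⟧ℤ--◃ (suc m ℕ.* n)) (trans (-‿cong (×1-homo-* (suc m) n)) (-‿distribˡ-* _ _))
  ⟦⟧ℤ-* -[1+ m ] -[1+ n ] = begin
    ⟦ Sign.+ ℤ.◃ (suc m ℕ.* suc n) ⟧ℤ ≈⟨ ⟦⟧ℤ-+◃ (suc m ℕ.* suc n) ⟩
    (suc m ℕ.* suc n) × 1# ≈⟨ ×1-homo-* (suc m) (suc n) ⟩
    suc m × 1# * (suc n × 1#) ≈⟨ -‿involutive _ ⟨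
    - - (suc m × 1# * (suc n × 1#)) ≈⟨ -‿cong (-‿distribʳ-* _ _) ⟩
    - (suc m × 1# * - (suc n × 1#)) ≈⟨ -‿distribˡ-* _ _ ⟩
    - (suc m × 1#) * - (suc n × 1#) ∎

  almostCommutativeRing : ACR.AlmostCommutativeRing 0ℓ 0ℓ
  almostCommutativeRing = ACR.fromCommutativeRing R

  ℤ-morphism : ℤ.+-*-rawRing ACR.-Raw-AlmostCommutative⟶ almostCommutativeRing
  ℤ-morphism = record
    { ⟦_⟧ = ⟦_⟧ℤ ; +-homo = ⟦⟧ℤ-+ ; *-homo = ⟦⟧ℤ-* ; -‿homo = ⟦⟧ℤ-neg ; 0-homo = refl ; 1-homo = refl }

  coeff≟ : ∀ i j → Maybe (⟦ i ⟧ℤ ≈ ⟦ j ⟧ℤ)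
  coeff≟ i j with i ℤₚ.≟ j
  ... | yes ≡.refl = just refl
  ... | no _ = nothing

  open RingSolver ℤ.+-*-rawRing almostCommutativeRing ℤ-morphism coeff≟ public
    using (solve; _:=_; con; _:+_; _:*_; _:-_; :-_)

open import Defs
open import Algebra.Structures using (IsCommutativeRing)
open import Data.Bool.Base using (true; false; if_then_else_) renaming (T to IsTrue)
open import Data.Empty using (⊥; ⊥-elim)
open import Data.Fin.Base using (Fin; toℕ; fromℕ<; finToFun; funToFin; combine; remQuot)
import Data.Fin.Properties as Finₚ
open import Data.Integer using (+_)
open import Data.Integer.DivMod using (_%ℕ_; _/ℕ_; a≡a%ℕn+[a/ℕn]*n; n%ℕd<d)
import Data.Integer.Solver
open import Data.List.Base using (List; []; _∷_; map; length; drop; tabulate; upTo)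
open import Data.List.Membership.Propositional using (lose; find)
open import Data.List.Membership.Propositional.Properties using (∈-upTo⁺)
open import Data.List.Properties using (length-map; length-tabulate)
open import Data.List.Relation.Unary.All as All using (All; []; _∷_)
import Data.List.Relation.Unary.All.Properties as Allₚ
open import Data.List.Relation.Unary.AllPairs using ([]; _∷_)
import Data.List.Relation.Unary.Any.Properties as Anyₚ
open import Data.List.Relation.Unary.Unique.Propositional using (Unique)
import Data.List.Relation.Unary.Unique.Propositional.Properties as Uniqueₚ
open import Data.Nat using (_+_; _*_; _∸_; _^_; _≤_; _<_; z≤n; s≤s; _≡ᵇ_; NonZero; ⌊_/2⌋; ⌈_/2⌉)
import Data.Nat.Coprimality as Coprimality
open import Data.Nat.Divisibility using (_∣_; divides; m%n≡0⇒n∣m; n∣m⇒m%n≡0; >⇒∤)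
open import Data.Nat.DivMod using (_%_; _mod_; m%n<n; m<n⇒m%n≡m; %-distribˡ-+; %-distribˡ-*; m≡m%n+[m/n]*n; m/n*n≤m; m*n/n≡m; /-monoˡ-≤) renaming (_/_ to _div_)
open import Data.Nat.GCD using (module Bézout)
open import Data.Nat.Induction using (<-rec)
open import Data.Nat.Logarithm using (⌊log₂_⌋; ⌊log₂⌋-mono-≤; ⌊log₂⌊n/2⌋⌋≡⌊log₂n⌋∸1; ⌊log₂[2^n]⌋≡n)
open import Data.Nat.Primality using (Prime; euclidsLemma; prime⇒nonZero; prime⇒nonTrivial; prime⇒irreducible)
import Data.Nat.Properties as ℕₚ
import Data.Nat.Solver
open import Data.Product using (Σ; ∃; ∃₂; _×_; _,_; proj₁; proj₂)
open import Data.Rational as ℚ using (ℚ; _/_; toℚᵘ)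
import Data.Rational.Properties as ℚₚ
open import Data.Rational.Unnormalised as ℚᵘ using (mkℚᵘ; _≃_; *≡*; *≤*)
import Data.Rational.Unnormalised.Properties as ℚᵘₚ
open import Data.Sum.Base using (_⊎_; inj₁; inj₂; [_,_]′)
open import Relation.Binary.Bundles using (Setoid)
open import Relation.Binary.Definitions using (tri<; tri≈; tri>)
open import Relation.Binary.PropositionalEquality using (_≢_; refl; sym; trans; cong; cong₂; subst; subst₂; isEquivalence; module ≡-Reasoning)
open import Relation.Binary.Structures using (IsEquivalence)
open import Relation.Nullary using (¬_; Dec; contradiction)
open import Relation.Nullary.Decidable using (decidable-stable)

-- Prime fields: an abstract interface and its realisation by residues.

-- With the field as a variable, none of its operations unfolds to arithmetic in `Fin p`. The map
-- `toFin` retains what finiteness is used for: decidable equality, counting of vectors and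
-- enumeration of all elements.
record PrimeField (p : ℕ) : Set₁ where
  infixl 6 _⊕_
  infixl 7 _⊗_
  infix 8 ⊖_
  field
    K : Set
    _⊕_ _⊗_ : K → K → K
    ⊖_ : K → K
    0ᴷ 1ᴷ : K
    isCommutativeRing : IsCommutativeRing _≡_ _⊕_ _⊗_ ⊖_ 0ᴷ 1ᴷ
    prime : Prime p
    fromℕ : ℕ → K
    fromℕ-0 : fromℕ 0 ≡ 0ᴷ
    fromℕ-1 : fromℕ 1 ≡ 1ᴷ
    fromℕ-+ : ∀ a b → fromℕ (a + b) ≡ fromℕ a ⊕ fromℕ b
    fromℕ-* : ∀ a b → fromℕ (a * b) ≡ fromℕ a ⊗ fromℕ b
    fromℕ≡0⇒∣ : ∀ a → fromℕ a ≡ 0ᴷ → p ∣ a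
    ∣⇒fromℕ≡0 : ∀ a → p ∣ a → fromℕ a ≡ 0ᴷ
    toFin : K → Fin p
    fromℕ-toFin : ∀ x → fromℕ (toℕ (toFin x)) ≡ x

  commutativeRing : CommutativeRing 0ℓ 0ℓ
  commutativeRing = record { isCommutativeRing = isCommutativeRing }

  open IsCommutativeRing isCommutativeRing public
    using (+-assoc; +-comm; +-identityˡ; +-identityʳ; *-assoc; *-comm; *-identityˡ; *-identityʳ;
           distribˡ; distribʳ; zeroˡ; zeroʳ; -‿inverseˡ; -‿inverseʳ)

  module Solver = IntegerSolver commutativeRing

  repr : K → ℕ
  repr x = toℕ (toFin x)

  repr-injective : ∀ {x y} → repr x ≡ repr y → x ≡ y
  repr-injective {x} {y} eq = trans (sym (fromℕ-toFin x)) (trans (cong fromℕ eq) (fromℕ-toFin y))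

  fromℕ-suc : ∀ n → 1ᴷ ⊕ fromℕ n ≡ fromℕ (suc n)
  fromℕ-suc n = trans (cong (_⊕ fromℕ n) (sym fromℕ-1)) (sym (fromℕ-+ 1 n))

  infix 4 _≟ᴷ_
  _≟ᴷ_ : (x y : K) → Dec (x ≡ y)
  x ≟ᴷ y with repr x ℕₚ.≟ repr y
  ... | yes eq = yes (repr-injective eq)
  ... | no neq = no λ eq → neq (cong repr eq)

  fromℕ-p : fromℕ p ≡ 0ᴷ
  fromℕ-p = ∣⇒fromℕ≡0 p (divides 1 (sym (ℕₚ.*-identityˡ p)))

  fromℕ≢0 : ∀ {a} → 1 ≤ a → a < p → fromℕ a ≢ 0ᴷ
  fromℕ≢0 {suc a} _ a<p eq = >⇒∤ a<p (fromℕ≡0⇒∣ (suc a) eq)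

  1<p : 1 < p
  1<p = ℕ.nonTrivial⇒n>1 p {{prime⇒nonTrivial prime}}

  1≢0 : 1ᴷ ≢ 0ᴷ
  1≢0 eq = fromℕ≢0 ℕₚ.≤-refl 1<p (trans fromℕ-1 eq)

  x⊗y≡0 : ∀ x y → x ⊗ y ≡ 0ᴷ → x ≡ 0ᴷ ⊎ y ≡ 0ᴷ
  x⊗y≡0 x y eq with euclidsLemma (repr x) (repr y) prime (fromℕ≡0⇒∣ (repr x * repr y)
    (trans (fromℕ-* _ _) (trans (cong₂ _⊗_ (fromℕ-toFin x) (fromℕ-toFin y)) eq)))
  ... | inj₁ p∣x = inj₁ (trans (sym (fromℕ-toFin x)) (∣⇒fromℕ≡0 _ p∣x))
  ... | inj₂ p∣y = inj₂ (trans (sym (fromℕ-toFin y)) (∣⇒fromℕ≡0 _ p∣y))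

  ⊗-≢0 : ∀ {x y} → x ≢ 0ᴷ → y ≢ 0ᴷ → x ⊗ y ≢ 0ᴷ
  ⊗-≢0 {x} {y} x≢0 y≢0 eq = [ x≢0 , y≢0 ]′ (x⊗y≡0 x y eq)

  x⊖y≡0⇒x≡y : ∀ {x y} → x ⊕ ⊖ y ≡ 0ᴷ → x ≡ y
  x⊖y≡0⇒x≡y {x} {y} eq = begin
    x ≡⟨ solve 2 (λ x y → x := (x :- y) :+ y) refl x y ⟩
    x ⊕ ⊖ y ⊕ y ≡⟨ cong (_⊕ y) eq ⟩
    0ᴷ ⊕ y ≡⟨ +-identityˡ y ⟩
    y ∎
    where open ≡-Reasoning
          open Solver

  ⊗-cancelˡ : ∀ {x y z} → x ≢ 0ᴷ → x ⊗ y ≡ x ⊗ z → y ≡ z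
  ⊗-cancelˡ {x} {y} {z} x≢0 eq with x⊗y≡0 x (y ⊕ ⊖ z) (trans
    (solve 3 (λ x y z → x :* (y :- z) := x :* y :- x :* z) refl x y z)
    (trans (cong (_⊕ ⊖ (x ⊗ z)) eq) (-‿inverseʳ _)))
    where open Solver
  ... | inj₁ x≡0 = contradiction x≡0 x≢0
  ... | inj₂ y-z≡0 = x⊖y≡0⇒x≡y y-z≡0

  repr<p : ∀ x → repr x < p
  repr<p x = Finₚ.toℕ<n (toFin x)

  repr≢0 : ∀ {x} → x ≢ 0ᴷ → NonZero (repr x)
  repr≢0 {x} x≢0 = ℕ.≢-nonZero λ eq → x≢0 (trans (sym (fromℕ-toFin x)) (trans (cong fromℕ eq) fromℕ-0))

  inverse : ∀ x → x ≢ 0ᴷ → Σ K λ y → x ⊗ y ≡ 1ᴷ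
  inverse x x≢0 with Coprimality.coprime-Bézout (Coprimality.prime⇒coprime prime {{repr≢0 x≢0}} (repr<p x))
  ... | Bézout.+- u v eq = ⊖ fromℕ v , (begin
    x ⊗ ⊖ fromℕ v ≡⟨ solve 2 (λ x v → x :* (:- v) := con (+ 1) :- (con (+ 1) :+ v :* x)) refl x (fromℕ v) ⟩
    1ᴷ ⊕ ⊖ (1ᴷ ⊕ fromℕ v ⊗ x) ≡⟨ cong (λ z → 1ᴷ ⊕ ⊖ z) key ⟩
    1ᴷ ⊕ ⊖ 0ᴷ ≡⟨ solve 0 (con (+ 1) :- con (+ 0) := con (+ 1)) refl ⟩
    1ᴷ ∎)
    where
    open ≡-Reasoning
    open Solver
    key : 1ᴷ ⊕ fromℕ v ⊗ x ≡ 0ᴷ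
    key = begin
      1ᴷ ⊕ fromℕ v ⊗ x ≡⟨ cong₂ (λ a b → a ⊕ fromℕ v ⊗ b) (sym fromℕ-1) (sym (fromℕ-toFin x)) ⟩
      fromℕ 1 ⊕ fromℕ v ⊗ fromℕ (repr x) ≡⟨ cong (fromℕ 1 ⊕_) (fromℕ-* v (repr x)) ⟨
      fromℕ 1 ⊕ fromℕ (v * repr x) ≡⟨ fromℕ-+ 1 _ ⟨
      fromℕ (1 + v * repr x) ≡⟨ ∣⇒fromℕ≡0 _ (divides u eq) ⟩
      0ᴷ ∎
  ... | Bézout.-+ u v eq = fromℕ v , (begin
    x ⊗ fromℕ v ≡⟨ cong (_⊗ fromℕ v) (fromℕ-toFin x) ⟨
    fromℕ (repr x) ⊗ fromℕ v ≡⟨ *-comm _ _ ⟩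
    fromℕ v ⊗ fromℕ (repr x) ≡⟨ fromℕ-* v _ ⟨
    fromℕ (v * repr x) ≡⟨ cong fromℕ eq ⟨
    fromℕ (1 + u * p) ≡⟨ fromℕ-+ 1 _ ⟩
    fromℕ 1 ⊕ fromℕ (u * p) ≡⟨ cong₂ _⊕_ fromℕ-1 (∣⇒fromℕ≡0 _ (divides u refl)) ⟩
    1ᴷ ⊕ 0ᴷ ≡⟨ +-identityʳ 1ᴷ ⟩
    1ᴷ ∎)
    where open ≡-Reasoning

module _ (p : ℕ) (p-prime : Prime p) where
  private
    instance
      p-nonZero : NonZero p
      p-nonZero = prime⇒nonZero p-prime

    𝔽 : Set
    𝔽 = Fin p

    [_] : ℕ → 𝔽
    [ a ] = a mod p

    toℕ-[] : ∀ a → toℕ [ a ] ≡ a % p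
    toℕ-[] a = Finₚ.toℕ-fromℕ< (m%n<n a p)

    []-cong : ∀ {a b} → a % p ≡ b % p → [ a ] ≡ [ b ]
    []-cong {a} {b} eq = Finₚ.toℕ-injective (trans (toℕ-[] a) (trans eq (sym (toℕ-[] b))))

    []-toℕ : ∀ x → [ toℕ x ] ≡ x
    []-toℕ x = Finₚ.toℕ-injective (trans (toℕ-[] _) (m<n⇒m%n≡m (Finₚ.toℕ<n x)))

    infixl 6 _⊕_
    infixl 7 _⊗_
    _⊕_ _⊗_ : 𝔽 → 𝔽 → 𝔽
    x ⊕ y = [ toℕ x + toℕ y ]
    x ⊗ y = [ toℕ x * toℕ y ]

    ⊖_ : 𝔽 → 𝔽
    ⊖ x = [ p ∸ toℕ x ]

    []-+ : ∀ a b → [ a + b ] ≡ [ a ] ⊕ [ b ]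
    []-+ a b = []-cong (trans (%-distribˡ-+ a b p) (cong (_% p) (sym (cong₂ _+_ (toℕ-[] a) (toℕ-[] b)))))

    []-* : ∀ a b → [ a * b ] ≡ [ a ] ⊗ [ b ]
    []-* a b = []-cong (trans (%-distribˡ-* a b p) (cong (_% p) (sym (cong₂ _*_ (toℕ-[] a) (toℕ-[] b)))))

    -- A view of each element as the class of a natural number. After matching, every ring law is
    -- the image of the same law in ℕ, since `[_]` respects sums and products.
    data Residue : 𝔽 → Set where
      residue : ∀ a → Residue [ a ]

    residueOf : ∀ x → Residue x
    residueOf x = subst Residue ([]-toℕ x) (residue (toℕ x))

    ⊕-assoc : ∀ x y z → (x ⊕ y) ⊕ z ≡ x ⊕ (y ⊕ z)
    ⊕-assoc x y z with residueOf x | residueOf y | residueOf z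
    ... | residue a | residue b | residue c =
      trans (cong (_⊕ [ c ]) (sym ([]-+ a b))) (trans (sym ([]-+ (a + b) c))
        (trans (cong [_] (ℕₚ.+-assoc a b c)) (trans ([]-+ a (b + c)) (cong ([ a ] ⊕_) ([]-+ b c)))))

    ⊗-assoc : ∀ x y z → (x ⊗ y) ⊗ z ≡ x ⊗ (y ⊗ z)
    ⊗-assoc x y z with residueOf x | residueOf y | residueOf z
    ... | residue a | residue b | residue c =
      trans (cong (_⊗ [ c ]) (sym ([]-* a b))) (trans (sym ([]-* (a * b) c))
        (trans (cong [_] (ℕₚ.*-assoc a b c)) (trans ([]-* a (b * c)) (cong ([ a ] ⊗_) ([]-* b c)))))

    ⊕-comm : ∀ x y → x ⊕ y ≡ y ⊕ x
    ⊕-comm x y = cong [_] (ℕₚ.+-comm (toℕ x) (toℕ y))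

    ⊗-comm : ∀ x y → x ⊗ y ≡ y ⊗ x
    ⊗-comm x y = cong [_] (ℕₚ.*-comm (toℕ x) (toℕ y))

    ⊕-identityˡ : ∀ x → [ 0 ] ⊕ x ≡ x
    ⊕-identityˡ x with residueOf x
    ... | residue a = sym ([]-+ 0 a)

    ⊗-identityˡ : ∀ x → [ 1 ] ⊗ x ≡ x
    ⊗-identityˡ x with residueOf x
    ... | residue a = trans (sym ([]-* 1 a)) (cong [_] (ℕₚ.*-identityˡ a))

    ⊗-distribˡ : ∀ x y z → x ⊗ (y ⊕ z) ≡ x ⊗ y ⊕ x ⊗ z
    ⊗-distribˡ x y z with residueOf x | residueOf y | residueOf z
    ... | residue a | residue b | residue c =
      trans (cong ([ a ] ⊗_) (sym ([]-+ b c))) (trans (sym ([]-* a (b + c)))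
        (trans (cong [_] (ℕₚ.*-distribˡ-+ a b c)) (trans ([]-+ (a * b) (a * c)) (cong₂ _⊕_ ([]-* a b) ([]-* a c)))))

    ∣⇒[]≡0 : ∀ a → p ∣ a → [ a ] ≡ [ 0 ]
    ∣⇒[]≡0 a p∣a = []-cong (trans (n∣m⇒m%n≡0 a p p∣a) (sym (m<n⇒m%n≡m (ℕₚ.n≢0⇒n>0 (ℕ.≢-nonZero⁻¹ p)))))

    []≡0⇒∣ : ∀ a → [ a ] ≡ [ 0 ] → p ∣ a
    []≡0⇒∣ a eq = m%n≡0⇒n∣m a p (trans (sym (toℕ-[] a)) (trans (cong toℕ eq)
      (trans (toℕ-[] 0) (m<n⇒m%n≡m (ℕₚ.n≢0⇒n>0 (ℕ.≢-nonZero⁻¹ p))))))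

    ⊖-inverseˡ : ∀ x → ⊖ x ⊕ x ≡ [ 0 ]
    ⊖-inverseˡ x = trans (cong (⊖ x ⊕_) (sym ([]-toℕ x))) (trans (sym ([]-+ (p ∸ toℕ x) (toℕ x)))
      (∣⇒[]≡0 _ (divides 1 (trans (ℕₚ.m∸n+n≡m (ℕₚ.<⇒≤ (Finₚ.toℕ<n x))) (sym (ℕₚ.*-identityˡ p))))))

    viaComm : ∀ x y {z} → x ⊕ y ≡ z → y ⊕ x ≡ z
    viaComm x y eq = trans (⊕-comm y x) eq

    Fin-isCommutativeRing : IsCommutativeRing _≡_ _⊕_ _⊗_ ⊖_ [ 0 ] [ 1 ]
    Fin-isCommutativeRing = record
      { isRing = record
        { +-isAbelianGroup = record
          { isGroup = record
            { isMonoid = record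
              { isSemigroup = record
                { isMagma = record { isEquivalence = isEquivalence ; ∙-cong = cong₂ _⊕_ }
                ; assoc = ⊕-assoc }
              ; identity = ⊕-identityˡ , λ x → viaComm [ 0 ] x (⊕-identityˡ x) }
            ; inverse = ⊖-inverseˡ , λ x → viaComm (⊖ x) x (⊖-inverseˡ x)
            ; ⁻¹-cong = cong ⊖_ }
          ; comm = ⊕-comm }
        ; *-cong = cong₂ _⊗_
        ; *-assoc = ⊗-assoc
        ; *-identity = ⊗-identityˡ , λ x → trans (⊗-comm x [ 1 ]) (⊗-identityˡ x)
        ; distrib = ⊗-distribˡ , λ x y z → trans (⊗-comm (y ⊕ z) x)
            (trans (⊗-distribˡ x y z) (cong₂ _⊕_ (⊗-comm x y) (⊗-comm x z))) }
      ; *-comm = ⊗-comm }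

  residueField : PrimeField p
  residueField = record
    { isCommutativeRing = Fin-isCommutativeRing
    ; prime = p-prime
    ; fromℕ = [_]
    ; fromℕ-0 = refl
    ; fromℕ-1 = refl
    ; fromℕ-+ = []-+
    ; fromℕ-* = []-*
    ; fromℕ≡0⇒∣ = []≡0⇒∣
    ; ∣⇒fromℕ≡0 = ∣⇒[]≡0
    ; toFin = λ x → x
    ; fromℕ-toFin = []-toℕ }

-- Polynomials over the prime field.

module Polynomial {p : ℕ} (𝔽 : PrimeField p) where
  open PrimeField 𝔽
  open ≡-Reasoning

  infixl 6 _+ᴾ_
  infixl 7 _*ᴾ_
  infix 8 -ᴾ_
  infixr 8 _^ᴾ_ _^ᴷ_
  infix 4 _≈_

  Pol : Set
  Pol = List K

  coef : Pol → ℕ → K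
  coef [] _ = 0ᴷ
  coef (a ∷ A) zero = a
  coef (a ∷ A) (suc k) = coef A k

  -- Lists may end in zeros, so equality of polynomials is coefficientwise. It is a record and not a
  -- function type so that both polynomials can be inferred from a proof.
  record _≈_ (A B : Pol) : Set where
    constructor coefwise
    field at : ∀ k → coef A k ≡ coef B k
  open _≈_ public

  ≈-refl : ∀ {A} → A ≈ A
  ≈-refl = coefwise λ _ → refl

  ≈-sym : ∀ {A B} → A ≈ B → B ≈ A
  ≈-sym eq = coefwise λ k → sym (at eq k)

  ≈-trans : ∀ {A B C} → A ≈ B → B ≈ C → A ≈ C
  ≈-trans eq eq′ = coefwise λ k → trans (at eq k) (at eq′ k)

  ≈-isEquivalence : IsEquivalence _≈_
  ≈-isEquivalence = record { refl = ≈-refl ; sym = ≈-sym ; trans = ≈-trans }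

  ≈-setoid : Setoid 0ℓ 0ℓ
  ≈-setoid = record { isEquivalence = ≈-isEquivalence }

  module ≈-Reasoning = SetoidReasoning ≈-setoid

  _+ᴾ_ : Pol → Pol → Pol
  [] +ᴾ B = B
  (a ∷ A) +ᴾ [] = a ∷ A
  (a ∷ A) +ᴾ (b ∷ B) = (a ⊕ b) ∷ (A +ᴾ B)

  scale : K → Pol → Pol
  scale c = map (c ⊗_)

  -ᴾ_ : Pol → Pol
  -ᴾ_ = map ⊖_

  _*ᴾ_ : Pol → Pol → Pol
  [] *ᴾ B = []
  (a ∷ A) *ᴾ B = scale a B +ᴾ (0ᴷ ∷ A *ᴾ B)

  const : K → Pol
  const c = c ∷ []

  1ᴾ : Pol
  1ᴾ = const 1ᴷ

  -0≡0 : ⊖ 0ᴷ ≡ 0ᴷ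
  -0≡0 = solve 0 (:- con (+ 0) := con (+ 0)) refl
    where open Solver

  coef-+ : ∀ A B k → coef (A +ᴾ B) k ≡ coef A k ⊕ coef B k
  coef-+ [] B k = sym (+-identityˡ _)
  coef-+ (a ∷ A) [] k = sym (+-identityʳ _)
  coef-+ (a ∷ A) (b ∷ B) zero = refl
  coef-+ (a ∷ A) (b ∷ B) (suc k) = coef-+ A B k

  coef-scale : ∀ c A k → coef (scale c A) k ≡ c ⊗ coef A k
  coef-scale c [] k = sym (zeroʳ c)
  coef-scale c (a ∷ A) zero = refl
  coef-scale c (a ∷ A) (suc k) = coef-scale c A k

  coef-neg : ∀ A k → coef (-ᴾ A) k ≡ ⊖ coef A k
  coef-neg [] k = sym -0≡0
  coef-neg (a ∷ A) zero = refl
  coef-neg (a ∷ A) (suc k) = coef-neg A k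

  ∷-cong : ∀ {a b A B} → a ≡ b → A ≈ B → a ∷ A ≈ b ∷ B
  ∷-cong a≡b A≈B = coefwise λ { zero → a≡b ; (suc k) → at A≈B k }

  tail-cong : ∀ {a b A B} → a ∷ A ≈ b ∷ B → A ≈ B
  tail-cong eq = coefwise λ k → at eq (suc k)

  0∷[]≈[] : 0ᴷ ∷ [] ≈ []
  0∷[]≈[] = coefwise λ { zero → refl ; (suc k) → refl }

  const-cong : ∀ {a b} → a ≡ b → const a ≈ const b
  const-cong eq = ∷-cong eq (≈-refl {[]})

  const-zero : ∀ {a} → a ≡ 0ᴷ → const a ≈ []
  const-zero eq = ≈-trans (const-cong eq) 0∷[]≈[]

  0∷-zero : ∀ {A} → A ≈ [] → 0ᴷ ∷ A ≈ []
  0∷-zero eq = ≈-trans (∷-cong refl eq) 0∷[]≈[]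

  +ᴾ-cong : ∀ {A A′ B B′} → A ≈ A′ → B ≈ B′ → A +ᴾ B ≈ A′ +ᴾ B′
  +ᴾ-cong {A} {A′} {B} {B′} eq eq′ = coefwise λ k →
    trans (coef-+ A B k) (trans (cong₂ _⊕_ (at eq k) (at eq′ k)) (sym (coef-+ A′ B′ k)))

  +ᴾ-comm : ∀ A B → A +ᴾ B ≈ B +ᴾ A
  +ᴾ-comm A B = coefwise λ k → trans (coef-+ A B k) (trans (+-comm _ _) (sym (coef-+ B A k)))

  +ᴾ-assoc : ∀ A B C → (A +ᴾ B) +ᴾ C ≈ A +ᴾ (B +ᴾ C)
  +ᴾ-assoc A B C = coefwise λ k → begin
    coef ((A +ᴾ B) +ᴾ C) k ≡⟨ trans (coef-+ (A +ᴾ B) C k) (cong (_⊕ coef C k) (coef-+ A B k)) ⟩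
    coef A k ⊕ coef B k ⊕ coef C k ≡⟨ +-assoc _ _ _ ⟩
    coef A k ⊕ (coef B k ⊕ coef C k) ≡⟨ trans (coef-+ A (B +ᴾ C) k) (cong (coef A k ⊕_) (coef-+ B C k)) ⟨
    coef (A +ᴾ (B +ᴾ C)) k ∎

  +ᴾ-identityʳ : ∀ A → A +ᴾ [] ≈ A
  +ᴾ-identityʳ A = +ᴾ-comm A []

  -ᴾ-inverseˡ : ∀ A → -ᴾ A +ᴾ A ≈ []
  -ᴾ-inverseˡ A = coefwise λ k →
    trans (coef-+ (-ᴾ A) A k) (trans (cong (_⊕ coef A k) (coef-neg A k)) (-‿inverseˡ _))

  -ᴾ-cong : ∀ {A B} → A ≈ B → -ᴾ A ≈ -ᴾ B
  -ᴾ-cong {A} {B} eq = coefwise λ k → trans (coef-neg A k) (trans (cong ⊖_ (at eq k)) (sym (coef-neg B k)))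

  scale-cong : ∀ c {A B} → A ≈ B → scale c A ≈ scale c B
  scale-cong c {A} {B} eq = coefwise λ k →
    trans (coef-scale c A k) (trans (cong (c ⊗_) (at eq k)) (sym (coef-scale c B k)))

  scale-+ : ∀ c A B → scale c (A +ᴾ B) ≈ scale c A +ᴾ scale c B
  scale-+ c A B = coefwise λ k → begin
    coef (scale c (A +ᴾ B)) k ≡⟨ trans (coef-scale c (A +ᴾ B) k) (cong (c ⊗_) (coef-+ A B k)) ⟩
    c ⊗ (coef A k ⊕ coef B k) ≡⟨ distribˡ _ _ _ ⟩
    c ⊗ coef A k ⊕ c ⊗ coef B k ≡⟨ cong₂ _⊕_ (coef-scale c A k) (coef-scale c B k) ⟨
    coef (scale c A) k ⊕ coef (scale c B) k ≡⟨ coef-+ (scale c A) (scale c B) k ⟨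
    coef (scale c A +ᴾ scale c B) k ∎

  scale-⊗ : ∀ c d A → scale (c ⊗ d) A ≈ scale c (scale d A)
  scale-⊗ c d A = coefwise λ k → begin
    coef (scale (c ⊗ d) A) k ≡⟨ coef-scale (c ⊗ d) A k ⟩
    c ⊗ d ⊗ coef A k ≡⟨ *-assoc _ _ _ ⟩
    c ⊗ (d ⊗ coef A k) ≡⟨ trans (coef-scale c (scale d A) k) (cong (c ⊗_) (coef-scale d A k)) ⟨
    coef (scale c (scale d A)) k ∎

  scale-1 : ∀ A → scale 1ᴷ A ≈ A
  scale-1 A = coefwise λ k → trans (coef-scale 1ᴷ A k) (*-identityˡ _)

  scale-0 : ∀ A → scale 0ᴷ A ≈ []
  scale-0 A = coefwise λ k → trans (coef-scale 0ᴷ A k) (zeroˡ _)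

  private
    interchange : ∀ A B C D → (A +ᴾ B) +ᴾ (C +ᴾ D) ≈ (A +ᴾ C) +ᴾ (B +ᴾ D)
    interchange A B C D =
      ≈-trans (+ᴾ-assoc A B (C +ᴾ D)) (≈-trans (+ᴾ-cong (≈-refl {A}) (≈-trans (≈-sym (+ᴾ-assoc B C D))
        (≈-trans (+ᴾ-cong (+ᴾ-comm B C) ≈-refl) (+ᴾ-assoc C B D)))) (≈-sym (+ᴾ-assoc A C (B +ᴾ D))))

    exchange : ∀ A B C → A +ᴾ (B +ᴾ C) ≈ B +ᴾ (A +ᴾ C)
    exchange A B C = ≈-trans (≈-sym (+ᴾ-assoc A B C)) (≈-trans (+ᴾ-cong (+ᴾ-comm A B) ≈-refl) (+ᴾ-assoc B A C))

  0∷-+ : ∀ A B → 0ᴷ ∷ (A +ᴾ B) ≈ (0ᴷ ∷ A) +ᴾ (0ᴷ ∷ B)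
  0∷-+ A B = ∷-cong (sym (+-identityˡ 0ᴷ)) ≈-refl

  scale-0∷ : ∀ c A → scale c (0ᴷ ∷ A) ≈ 0ᴷ ∷ scale c A
  scale-0∷ c A = ∷-cong (zeroʳ c) ≈-refl

  *ᴾ-congˡ : ∀ A {B B′} → B ≈ B′ → A *ᴾ B ≈ A *ᴾ B′
  *ᴾ-congˡ [] eq = ≈-refl
  *ᴾ-congˡ (a ∷ A) eq = +ᴾ-cong (scale-cong a eq) (∷-cong refl (*ᴾ-congˡ A eq))

  *ᴾ-zeroʳ : ∀ A → A *ᴾ [] ≈ []
  *ᴾ-zeroʳ [] = ≈-refl
  *ᴾ-zeroʳ (a ∷ A) = 0∷-zero (*ᴾ-zeroʳ A)

  *ᴾ-∷ʳ : ∀ A b B → A *ᴾ (b ∷ B) ≈ scale b A +ᴾ (0ᴷ ∷ A *ᴾ B)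
  *ᴾ-∷ʳ [] b B = ≈-sym 0∷[]≈[]
  *ᴾ-∷ʳ (a ∷ A) b B = ∷-cong (cong (_⊕ 0ᴷ) (*-comm a b))
    (≈-trans (+ᴾ-cong (≈-refl {scale a B}) (*ᴾ-∷ʳ A b B)) (exchange (scale a B) (scale b A) (0ᴷ ∷ A *ᴾ B)))

  *ᴾ-comm : ∀ A B → A *ᴾ B ≈ B *ᴾ A
  *ᴾ-comm [] B = ≈-sym (*ᴾ-zeroʳ B)
  *ᴾ-comm (a ∷ A) B = ≈-trans (+ᴾ-cong (≈-refl {scale a B}) (∷-cong refl (*ᴾ-comm A B))) (≈-sym (*ᴾ-∷ʳ B a A))

  *ᴾ-cong : ∀ {A A′ B B′} → A ≈ A′ → B ≈ B′ → A *ᴾ B ≈ A′ *ᴾ B′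
  *ᴾ-cong {A} {A′} {B} {B′} eq eq′ =
    ≈-trans (*ᴾ-congˡ A eq′) (≈-trans (*ᴾ-comm A B′) (≈-trans (*ᴾ-congˡ B′ eq) (*ᴾ-comm B′ A′)))

  *ᴾ-distribˡ : ∀ A B C → A *ᴾ (B +ᴾ C) ≈ A *ᴾ B +ᴾ A *ᴾ C
  *ᴾ-distribˡ [] B C = ≈-refl
  *ᴾ-distribˡ (a ∷ A) B C = ≈-trans
    (+ᴾ-cong (scale-+ a B C) (≈-trans (∷-cong refl (*ᴾ-distribˡ A B C)) (0∷-+ (A *ᴾ B) (A *ᴾ C))))
    (interchange (scale a B) (scale a C) (0ᴷ ∷ A *ᴾ B) (0ᴷ ∷ A *ᴾ C))

  *ᴾ-distribʳ : ∀ A B C → (B +ᴾ C) *ᴾ A ≈ B *ᴾ A +ᴾ C *ᴾ A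
  *ᴾ-distribʳ A B C = ≈-trans (*ᴾ-comm (B +ᴾ C) A) (≈-trans (*ᴾ-distribˡ A B C) (+ᴾ-cong (*ᴾ-comm A B) (*ᴾ-comm A C)))

  scale-*ᴾ : ∀ c A B → scale c A *ᴾ B ≈ scale c (A *ᴾ B)
  scale-*ᴾ c [] B = ≈-refl
  scale-*ᴾ c (a ∷ A) B = ≈-trans
    (+ᴾ-cong (scale-⊗ c a B) (≈-trans (∷-cong refl (scale-*ᴾ c A B)) (≈-sym (scale-0∷ c (A *ᴾ B)))))
    (≈-sym (scale-+ c (scale a B) (0ᴷ ∷ A *ᴾ B)))

  0∷-*ᴾ : ∀ A B → (0ᴷ ∷ A) *ᴾ B ≈ 0ᴷ ∷ A *ᴾ B
  0∷-*ᴾ A B = +ᴾ-cong (scale-0 B) ≈-refl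

  *ᴾ-assoc : ∀ A B C → (A *ᴾ B) *ᴾ C ≈ A *ᴾ (B *ᴾ C)
  *ᴾ-assoc [] B C = ≈-refl
  *ᴾ-assoc (a ∷ A) B C = ≈-trans (*ᴾ-distribʳ C (scale a B) (0ᴷ ∷ A *ᴾ B))
    (+ᴾ-cong (scale-*ᴾ a B C) (≈-trans (0∷-*ᴾ (A *ᴾ B) C) (∷-cong refl (*ᴾ-assoc A B C))))

  const-*ᴾ : ∀ c A → const c *ᴾ A ≈ scale c A
  const-*ᴾ c A = ≈-trans (+ᴾ-cong (≈-refl {scale c A}) 0∷[]≈[]) (+ᴾ-identityʳ _)

  *ᴾ-identityˡ : ∀ A → 1ᴾ *ᴾ A ≈ A
  *ᴾ-identityˡ A = ≈-trans (const-*ᴾ 1ᴷ A) (scale-1 A)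

  polynomialRing : CommutativeRing 0ℓ 0ℓ
  polynomialRing = record
    { Carrier = Pol ; _≈_ = _≈_ ; _+_ = _+ᴾ_ ; _*_ = _*ᴾ_ ; -_ = -ᴾ_ ; 0# = [] ; 1# = 1ᴾ
    ; isCommutativeRing = record
      { isRing = record
        { +-isAbelianGroup = record
          { isGroup = record
            { isMonoid = record
              { isSemigroup = record
                { isMagma = record { isEquivalence = ≈-isEquivalence ; ∙-cong = +ᴾ-cong }
                ; assoc = +ᴾ-assoc }
              ; identity = (λ A → ≈-refl) , +ᴾ-identityʳ }
            ; inverse = -ᴾ-inverseˡ , λ A → ≈-trans (+ᴾ-comm A (-ᴾ A)) (-ᴾ-inverseˡ A)
            ; ⁻¹-cong = -ᴾ-cong }
          ; comm = +ᴾ-comm }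
        ; *-cong = *ᴾ-cong
        ; *-assoc = *ᴾ-assoc
        ; *-identity = *ᴾ-identityˡ , λ A → ≈-trans (*ᴾ-comm A 1ᴾ) (*ᴾ-identityˡ A)
        ; distrib = *ᴾ-distribˡ , *ᴾ-distribʳ }
      ; *-comm = *ᴾ-comm } }

  module PSolver = IntegerSolver polynomialRing

  A-B≈0⇒A≈B : ∀ {A B} → A +ᴾ -ᴾ B ≈ [] → A ≈ B
  A-B≈0⇒A≈B {A} {B} eq = ≈-trans (solve 2 (λ A B → A := (A :- B) :+ B) ≈-refl A B) (+ᴾ-cong eq (≈-refl {B}))
    where open PSolver

  A≈B⇒A-B≈0 : ∀ {A B} → A ≈ B → A +ᴾ -ᴾ B ≈ []
  A≈B⇒A-B≈0 {A} {B} eq = ≈-trans (+ᴾ-cong eq ≈-refl) (solve 1 (λ B → B :- B := con (+ 0)) ≈-refl B)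
    where open PSolver

  _^ᴾ_ : Pol → ℕ → Pol
  A ^ᴾ zero = 1ᴾ
  A ^ᴾ suc n = A *ᴾ A ^ᴾ n

  ^ᴾ-+ : ∀ A m n → A ^ᴾ (m + n) ≈ A ^ᴾ m *ᴾ A ^ᴾ n
  ^ᴾ-+ A zero n = ≈-sym (*ᴾ-identityˡ _)
  ^ᴾ-+ A (suc m) n = ≈-trans (*ᴾ-congˡ A (^ᴾ-+ A m n)) (≈-sym (*ᴾ-assoc A _ _))

  _^ᴷ_ : K → ℕ → K
  x ^ᴷ zero = 1ᴷ
  x ^ᴷ suc n = x ⊗ x ^ᴷ n

  evalᴾ : Pol → K → K
  evalᴾ [] x = 0ᴷ
  evalᴾ (a ∷ A) x = a ⊕ x ⊗ evalᴾ A x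

  eval-zero : ∀ {A} → A ≈ [] → ∀ x → evalᴾ A x ≡ 0ᴷ
  eval-zero {[]} eq x = refl
  eval-zero {a ∷ A} eq x = begin
    a ⊕ x ⊗ evalᴾ A x ≡⟨ cong₂ (λ u v → u ⊕ x ⊗ v) (at eq 0) (eval-zero {A} (coefwise λ k → at eq (suc k)) x) ⟩
    0ᴷ ⊕ x ⊗ 0ᴷ ≡⟨ solve 1 (λ x → con (+ 0) :+ x :* con (+ 0) := con (+ 0)) refl x ⟩
    0ᴷ ∎
    where open Solver

  eval-cong : ∀ {A B} → A ≈ B → ∀ x → evalᴾ A x ≡ evalᴾ B x
  eval-cong {[]} {B} eq x = sym (eval-zero (≈-sym eq) x)
  eval-cong {a ∷ A} {[]} eq x = eval-zero eq x
  eval-cong {a ∷ A} {b ∷ B} eq x = cong₂ (λ u v → u ⊕ x ⊗ v) (at eq 0) (eval-cong (tail-cong eq) x)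

  eval-+ : ∀ A B x → evalᴾ (A +ᴾ B) x ≡ evalᴾ A x ⊕ evalᴾ B x
  eval-+ [] B x = sym (+-identityˡ _)
  eval-+ (a ∷ A) [] x = sym (+-identityʳ _)
  eval-+ (a ∷ A) (b ∷ B) x = trans (cong (λ u → a ⊕ b ⊕ x ⊗ u) (eval-+ A B x))
    (solve 5 (λ a b x u v → a :+ b :+ x :* (u :+ v) := (a :+ x :* u) :+ (b :+ x :* v)) refl a b x _ _)
    where open Solver

  eval-scale : ∀ c A x → evalᴾ (scale c A) x ≡ c ⊗ evalᴾ A x
  eval-scale c [] x = sym (zeroʳ c)
  eval-scale c (a ∷ A) x = trans (cong (λ u → c ⊗ a ⊕ x ⊗ u) (eval-scale c A x))
    (solve 4 (λ c a x u → c :* a :+ x :* (c :* u) := c :* (a :+ x :* u)) refl c a x _)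
    where open Solver

  eval-neg : ∀ A x → evalᴾ (-ᴾ A) x ≡ ⊖ evalᴾ A x
  eval-neg [] x = sym -0≡0
  eval-neg (a ∷ A) x = trans (cong (λ u → ⊖ a ⊕ x ⊗ u) (eval-neg A x))
    (solve 3 (λ a x u → :- a :+ x :* (:- u) := :- (a :+ x :* u)) refl a x _)
    where open Solver

  eval-* : ∀ A B x → evalᴾ (A *ᴾ B) x ≡ evalᴾ A x ⊗ evalᴾ B x
  eval-* [] B x = sym (zeroˡ _)
  eval-* (a ∷ A) B x = begin
    evalᴾ (scale a B +ᴾ (0ᴷ ∷ A *ᴾ B)) x ≡⟨ eval-+ (scale a B) (0ᴷ ∷ A *ᴾ B) x ⟩
    evalᴾ (scale a B) x ⊕ (0ᴷ ⊕ x ⊗ evalᴾ (A *ᴾ B) x) ≡⟨ cong₂ (λ u v → u ⊕ (0ᴷ ⊕ x ⊗ v)) (eval-scale a B x) (eval-* A B x) ⟩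
    a ⊗ evalᴾ B x ⊕ (0ᴷ ⊕ x ⊗ (evalᴾ A x ⊗ evalᴾ B x))
      ≡⟨ solve 4 (λ a x u v → a :* v :+ (con (+ 0) :+ x :* (u :* v)) := (a :+ x :* u) :* v) refl a x _ _ ⟩
    (a ⊕ x ⊗ evalᴾ A x) ⊗ evalᴾ B x ∎
    where open Solver

  eval-const : ∀ c x → evalᴾ (const c) x ≡ c
  eval-const c x = trans (cong (c ⊕_) (zeroʳ x)) (+-identityʳ c)

  eval-^ : ∀ A n x → evalᴾ (A ^ᴾ n) x ≡ evalᴾ A x ^ᴷ n
  eval-^ A zero x = eval-const 1ᴷ x
  eval-^ A (suc n) x = trans (eval-* A (A ^ᴾ n) x) (cong (evalᴾ A x ⊗_) (eval-^ A n x))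

  -- The recursion is the product rule applied to a + X A.
  D : Pol → Pol
  D [] = []
  D (a ∷ A) = A +ᴾ (0ᴷ ∷ D A)

  coef-D : ∀ A k → coef (D A) k ≡ fromℕ (suc k) ⊗ coef A (suc k)
  coef-D [] k = sym (zeroʳ _)
  coef-D (a ∷ A) zero = trans (coef-+ A (0ᴷ ∷ D A) 0) (trans (+-identityʳ _)
    (sym (trans (cong (_⊗ coef A 0) fromℕ-1) (*-identityˡ _))))
  coef-D (a ∷ A) (suc k) = begin
    coef (A +ᴾ (0ᴷ ∷ D A)) (suc k) ≡⟨ coef-+ A (0ᴷ ∷ D A) (suc k) ⟩
    coef A (suc k) ⊕ coef (D A) k ≡⟨ cong (coef A (suc k) ⊕_) (coef-D A k) ⟩
    coef A (suc k) ⊕ fromℕ (suc k) ⊗ coef A (suc k)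
      ≡⟨ solve 2 (λ u v → u :+ v :* u := (con (+ 1) :+ v) :* u) refl _ _ ⟩
    (1ᴷ ⊕ fromℕ (suc k)) ⊗ coef A (suc k)
      ≡⟨ cong (_⊗ coef A (suc k)) (fromℕ-suc (suc k)) ⟩
    fromℕ (suc (suc k)) ⊗ coef A (suc k) ∎
    where open Solver

  D-cong : ∀ {A B} → A ≈ B → D A ≈ D B
  D-cong {A} {B} eq = coefwise λ k →
    trans (coef-D A k) (trans (cong (fromℕ (suc k) ⊗_) (at eq (suc k))) (sym (coef-D B k)))

  D-+ : ∀ A B → D (A +ᴾ B) ≈ D A +ᴾ D B
  D-+ [] B = ≈-refl
  D-+ (a ∷ A) [] = ≈-sym (+ᴾ-identityʳ _)
  D-+ (a ∷ A) (b ∷ B) = ≈-trans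
    (+ᴾ-cong (≈-refl {A +ᴾ B}) (≈-trans (∷-cong refl (D-+ A B)) (0∷-+ (D A) (D B))))
    (interchange A B (0ᴷ ∷ D A) (0ᴷ ∷ D B))

  D-scale : ∀ c A → D (scale c A) ≈ scale c (D A)
  D-scale c [] = ≈-refl
  D-scale c (a ∷ A) = ≈-trans
    (+ᴾ-cong (≈-refl {scale c A}) (≈-trans (∷-cong refl (D-scale c A)) (≈-sym (scale-0∷ c (D A)))))
    (≈-sym (scale-+ c A (0ᴷ ∷ D A)))

  D-* : ∀ A B → D (A *ᴾ B) ≈ D A *ᴾ B +ᴾ A *ᴾ D B
  D-* [] B = ≈-refl
  D-* (a ∷ A) B = begin′
    D (scale a B +ᴾ (0ᴷ ∷ A *ᴾ B)) ≈⟨ D-+ (scale a B) (0ᴷ ∷ A *ᴾ B) ⟩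
    D (scale a B) +ᴾ (A *ᴾ B +ᴾ (0ᴷ ∷ D (A *ᴾ B)))
      ≈⟨ +ᴾ-cong (D-scale a B) (+ᴾ-cong (≈-refl {A *ᴾ B}) (≈-trans (∷-cong refl (D-* A B)) (0∷-+ (D A *ᴾ B) (A *ᴾ D B)))) ⟩
    scale a (D B) +ᴾ (A *ᴾ B +ᴾ ((0ᴷ ∷ D A *ᴾ B) +ᴾ (0ᴷ ∷ A *ᴾ D B)))
      ≈⟨ solve 4 (λ s u v w → s :+ (u :+ (v :+ w)) := (u :+ v) :+ (s :+ w)) ≈-refl _ (A *ᴾ B) (0ᴷ ∷ D A *ᴾ B) (0ᴷ ∷ A *ᴾ D B) ⟩
    (A *ᴾ B +ᴾ (0ᴷ ∷ D A *ᴾ B)) +ᴾ (scale a (D B) +ᴾ (0ᴷ ∷ A *ᴾ D B))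
      ≈⟨ +ᴾ-cong (+ᴾ-cong (≈-refl {A *ᴾ B}) (≈-sym (0∷-*ᴾ (D A) B))) ≈-refl ⟩
    (A *ᴾ B +ᴾ (0ᴷ ∷ D A) *ᴾ B) +ᴾ (a ∷ A) *ᴾ D B ≈⟨ +ᴾ-cong (≈-sym (*ᴾ-distribʳ B A (0ᴷ ∷ D A))) ≈-refl ⟩
    (A +ᴾ (0ᴷ ∷ D A)) *ᴾ B +ᴾ (a ∷ A) *ᴾ D B ∎′
    where open ≈-Reasoning renaming (begin_ to begin′_; _∎ to _∎′)
          open PSolver

  D-const : ∀ c → D (const c) ≈ []
  D-const c = 0∷[]≈[]

  D-^ : ∀ A n → D (A ^ᴾ suc n) ≈ const (fromℕ (suc n)) *ᴾ A ^ᴾ n *ᴾ D A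
  D-^ A zero = begin′
    D (A *ᴾ 1ᴾ) ≈⟨ D-cong (≈-trans (*ᴾ-comm A 1ᴾ) (*ᴾ-identityˡ A)) ⟩
    D A ≈⟨ solve 1 (λ A → A := con (+ 1) :* con (+ 1) :* A) ≈-refl (D A) ⟩
    1ᴾ *ᴾ 1ᴾ *ᴾ D A ≈⟨ *ᴾ-cong (*ᴾ-cong (const-cong (sym fromℕ-1)) (≈-refl {1ᴾ})) (≈-refl {D A}) ⟩
    const (fromℕ 1) *ᴾ 1ᴾ *ᴾ D A ∎′
    where open ≈-Reasoning renaming (begin_ to begin′_; _∎ to _∎′)
          open PSolver
  D-^ A (suc n) = begin′
    D (A *ᴾ A ^ᴾ suc n) ≈⟨ D-* A (A ^ᴾ suc n) ⟩
    D A *ᴾ A ^ᴾ suc n +ᴾ A *ᴾ D (A ^ᴾ suc n) ≈⟨ +ᴾ-cong (≈-refl {D A *ᴾ A ^ᴾ suc n}) (*ᴾ-congˡ A (D-^ A n)) ⟩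
    D A *ᴾ (A *ᴾ A ^ᴾ n) +ᴾ A *ᴾ (const (fromℕ (suc n)) *ᴾ A ^ᴾ n *ᴾ D A)
      ≈⟨ solve 4 (λ d a u c → d :* (a :* u) :+ a :* (c :* u :* d) := (con (+ 1) :+ c) :* (a :* u) :* d)
           ≈-refl (D A) A (A ^ᴾ n) (const (fromℕ (suc n))) ⟩
    (1ᴾ +ᴾ const (fromℕ (suc n))) *ᴾ (A *ᴾ A ^ᴾ n) *ᴾ D A
      ≈⟨ *ᴾ-cong (*ᴾ-cong (const-cong (fromℕ-suc (suc n)))
           (≈-refl {A *ᴾ A ^ᴾ n})) (≈-refl {D A}) ⟩
    const (fromℕ (suc (suc n))) *ᴾ A ^ᴾ suc n *ᴾ D A ∎′
    where open ≈-Reasoning renaming (begin_ to begin′_; _∎ to _∎′)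
          open PSolver

  -- A strict upper bound in place of a degree function: it needs no convention for the zero
  -- polynomial, which is the case n = 0.
  record Deg< (n : ℕ) (A : Pol) : Set where
    constructor deg<
    field above : ∀ k → n ≤ k → coef A k ≡ 0ᴷ
  open Deg< public

  Deg<-cong : ∀ {n A B} → A ≈ B → Deg< n A → Deg< n B
  Deg<-cong eq a = deg< λ k n≤k → trans (sym (at eq k)) (above a k n≤k)

  Deg<-mono : ∀ {m n A} → m ≤ n → Deg< m A → Deg< n A
  Deg<-mono m≤n a = deg< λ k n≤k → above a k (ℕₚ.≤-trans m≤n n≤k)

  Deg<0 : ∀ {A} → Deg< 0 A → A ≈ []
  Deg<0 a = coefwise λ k → above a k z≤n

  Deg<-zero : ∀ {n A} → A ≈ [] → Deg< n A
  Deg<-zero eq = deg< λ k _ → at eq k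

  Deg<-+ : ∀ {n A B} → Deg< n A → Deg< n B → Deg< n (A +ᴾ B)
  Deg<-+ {n} {A} {B} a b = deg< λ k n≤k →
    trans (coef-+ A B k) (trans (cong₂ _⊕_ (above a k n≤k) (above b k n≤k)) (+-identityˡ 0ᴷ))

  Deg<-neg : ∀ {n A} → Deg< n A → Deg< n (-ᴾ A)
  Deg<-neg {n} {A} a = deg< λ k n≤k → trans (coef-neg A k) (trans (cong ⊖_ (above a k n≤k)) -0≡0)

  Deg<-scale : ∀ {n A} c → Deg< n A → Deg< n (scale c A)
  Deg<-scale {n} {A} c a = deg< λ k n≤k → trans (coef-scale c A k) (trans (cong (c ⊗_) (above a k n≤k)) (zeroʳ c))

  Deg<-∷ : ∀ {n a A} → Deg< n A → Deg< (suc n) (a ∷ A)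
  Deg<-∷ d = deg< λ { (suc k) (s≤s n≤k) → above d k n≤k }

  Deg<-tail : ∀ {n a A} → Deg< (suc n) (a ∷ A) → Deg< n A
  Deg<-tail d = deg< λ k n≤k → above d (suc k) (s≤s n≤k)

  Deg<-const : ∀ c → Deg< 1 (const c)
  Deg<-const c = Deg<-∷ (Deg<-zero ≈-refl)

  Deg<-* : ∀ {m n A B} → Deg< (suc m) A → Deg< n B → Deg< (m + n) (A *ᴾ B)
  Deg<-* {A = []} a b = Deg<-zero ≈-refl
  Deg<-* {zero} {A = x ∷ A} {B} a b = Deg<-+ (Deg<-scale x b)
    (Deg<-zero (0∷-zero (*ᴾ-cong {A} {[]} {B} (Deg<0 (Deg<-tail a)) ≈-refl)))
  Deg<-* {suc m} {A = x ∷ A} a b = Deg<-+ (Deg<-mono (ℕₚ.m≤n+m _ _) (Deg<-scale x b)) (Deg<-∷ (Deg<-* (Deg<-tail a) b))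

  Deg<-^ : ∀ {m A} n → Deg< (suc m) A → Deg< (suc (n * m)) (A ^ᴾ n)
  Deg<-^ zero a = Deg<-const 1ᴷ
  Deg<-^ {m} (suc n) a = Deg<-mono (ℕₚ.≤-reflexive (ℕₚ.+-suc m (n * m))) (Deg<-* a (Deg<-^ n a))

  Deg<-D : ∀ {n A} → Deg< (suc n) A → Deg< n (D A)
  Deg<-D {n} {A} a = deg< λ k n≤k → trans (coef-D A k) (trans (cong (fromℕ (suc k) ⊗_) (above a (suc k) (s≤s n≤k))) (zeroʳ _))

  record HasDeg (n : ℕ) (A : Pol) : Set where
    constructor hasDeg
    field
      leading≢0 : coef A n ≢ 0ᴷ
      bounded : Deg< (suc n) A
  open HasDeg public

  HasDeg-cong : ∀ {n A B} → A ≈ B → HasDeg n A → HasDeg n B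
  HasDeg-cong eq a = hasDeg (λ z → leading≢0 a (trans (at eq _) z)) (Deg<-cong eq (bounded a))

  HasDeg⇒≉0 : ∀ {n A} → HasDeg n A → ¬ A ≈ []
  HasDeg⇒≉0 a eq = leading≢0 a (at eq _)

  zero-or-degree : ∀ A → A ≈ [] ⊎ ∃ λ n → HasDeg n A
  zero-or-degree [] = inj₁ ≈-refl
  zero-or-degree (a ∷ A) with zero-or-degree A
  ... | inj₂ (n , h) = inj₂ (suc n , hasDeg (leading≢0 h) (Deg<-∷ (bounded h)))
  ... | inj₁ A≈0 with a ≟ᴷ 0ᴷ
  ...   | yes refl = inj₁ (0∷-zero A≈0)
  ...   | no a≢0 = inj₂ (0 , hasDeg a≢0 (Deg<-∷ (Deg<-zero A≈0)))

  HasDeg-< : ∀ {m n A} → HasDeg m A → Deg< n A → m < n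
  HasDeg-< {m} {n} h d with m ℕₚ.<? n
  ... | yes m<n = m<n
  ... | no m≮n = contradiction (above d m (ℕₚ.≮⇒≥ m≮n)) (leading≢0 h)

  HasDeg-unique : ∀ {m n A} → HasDeg m A → HasDeg n A → m ≡ n
  HasDeg-unique h h′ = ℕₚ.≤-antisym (ℕ.s≤s⁻¹ (HasDeg-< h (bounded h′))) (ℕ.s≤s⁻¹ (HasDeg-< h′ (bounded h)))

  coef-*-top : ∀ {m n} A B → Deg< (suc m) A → Deg< (suc n) B → coef (A *ᴾ B) (m + n) ≡ coef A m ⊗ coef B n
  coef-*-top [] B a b = sym (zeroˡ _)
  coef-*-top {zero} {n} (x ∷ A) B a b = begin
    coef (scale x B +ᴾ (0ᴷ ∷ A *ᴾ B)) n ≡⟨ coef-+ (scale x B) _ n ⟩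
    coef (scale x B) n ⊕ coef (0ᴷ ∷ A *ᴾ B) n
      ≡⟨ cong₂ _⊕_ (coef-scale x B n) (at (0∷-zero (*ᴾ-cong {A} {[]} {B} (Deg<0 (Deg<-tail a)) ≈-refl)) n) ⟩
    x ⊗ coef B n ⊕ 0ᴷ ≡⟨ +-identityʳ _ ⟩
    x ⊗ coef B n ∎
  coef-*-top {suc m} {n} (x ∷ A) B a b = begin
    coef (scale x B +ᴾ (0ᴷ ∷ A *ᴾ B)) (suc m + n) ≡⟨ coef-+ (scale x B) _ (suc m + n) ⟩
    coef (scale x B) (suc m + n) ⊕ coef (A *ᴾ B) (m + n)
      ≡⟨ cong₂ _⊕_ (above (Deg<-scale x b) (suc m + n) (s≤s (ℕₚ.m≤n+m n m))) (coef-*-top A B (Deg<-tail a) b) ⟩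
    0ᴷ ⊕ coef A m ⊗ coef B n ≡⟨ +-identityˡ _ ⟩
    coef A m ⊗ coef B n ∎

  HasDeg-* : ∀ {m n A B} → HasDeg m A → HasDeg n B → HasDeg (m + n) (A *ᴾ B)
  HasDeg-* {m} {n} {A} {B} a b = hasDeg
    (λ eq → ⊗-≢0 (leading≢0 a) (leading≢0 b) (trans (sym (coef-*-top A B (bounded a) (bounded b))) eq))
    (Deg<-mono (ℕₚ.≤-reflexive (ℕₚ.+-suc m n)) (Deg<-* (bounded a) (bounded b)))

  A*B≈0 : ∀ A B → A *ᴾ B ≈ [] → A ≈ [] ⊎ B ≈ []
  A*B≈0 A B eq with zero-or-degree A | zero-or-degree B
  ... | inj₁ A≈0 | _ = inj₁ A≈0
  ... | inj₂ _ | inj₁ B≈0 = inj₂ B≈0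
  ... | inj₂ (_ , a) | inj₂ (_ , b) = contradiction eq (HasDeg⇒≉0 (HasDeg-* a b))

  *ᴾ-cancelˡ-0 : ∀ {A B} → ¬ A ≈ [] → A *ᴾ B ≈ [] → B ≈ []
  *ᴾ-cancelˡ-0 {A} {B} A≉0 eq = [ (λ A≈0 → contradiction A≈0 A≉0) , (λ B≈0 → B≈0) ]′ (A*B≈0 A B eq)

  *ᴾ-cancelˡ : ∀ {A B C} → ¬ A ≈ [] → A *ᴾ B ≈ A *ᴾ C → B ≈ C
  *ᴾ-cancelˡ {A} {B} {C} A≉0 eq = A-B≈0⇒A≈B (*ᴾ-cancelˡ-0 A≉0 (≈-trans
    (solve 3 (λ A B C → A :* (B :- C) := A :* B :- A :* C) ≈-refl A B C) (A≈B⇒A-B≈0 eq)))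
    where open PSolver

-- Roots with multiplicity, p-th powers and Fermat's little theorem.

module Roots {p : ℕ} (𝔽 : PrimeField p) where
  open PrimeField 𝔽
  open Polynomial 𝔽
  open ≡-Reasoning

  shift : ℕ → Pol → Pol
  shift zero A = A
  shift (suc n) A = 0ᴷ ∷ shift n A

  shift-cong : ∀ n {A B} → A ≈ B → shift n A ≈ shift n B
  shift-cong zero eq = eq
  shift-cong (suc n) eq = ∷-cong refl (shift-cong n eq)

  coef-shift-< : ∀ n A k → k < n → coef (shift n A) k ≡ 0ᴷ
  coef-shift-< (suc n) A zero _ = refl
  coef-shift-< (suc n) A (suc k) (s≤s k<n) = coef-shift-< n A k k<n

  coef-shift-+ : ∀ n A k → coef (shift n A) (n + k) ≡ coef A k
  coef-shift-+ zero A k = refl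
  coef-shift-+ (suc n) A k = coef-shift-+ n A k

  eval-shift : ∀ n A x → evalᴾ (shift n A) x ≡ x ^ᴷ n ⊗ evalᴾ A x
  eval-shift zero A x = sym (*-identityˡ _)
  eval-shift (suc n) A x = begin
    0ᴷ ⊕ x ⊗ evalᴾ (shift n A) x ≡⟨ +-identityˡ _ ⟩
    x ⊗ evalᴾ (shift n A) x ≡⟨ cong (x ⊗_) (eval-shift n A x) ⟩
    x ⊗ (x ^ᴷ n ⊗ evalᴾ A x) ≡⟨ *-assoc _ _ _ ⟨
    x ^ᴷ suc n ⊗ evalᴾ A x ∎

  eval-at-0 : ∀ A → evalᴾ A 0ᴷ ≡ coef A 0
  eval-at-0 [] = refl
  eval-at-0 (a ∷ A) = trans (cong (a ⊕_) (zeroˡ _)) (+-identityʳ a)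

  Deg<-shift : ∀ n {m A} → Deg< m A → Deg< (n + m) (shift n A)
  Deg<-shift zero a = a
  Deg<-shift (suc n) a = Deg<-∷ (Deg<-shift n a)

  1≤p : 1 ≤ p
  1≤p = ℕₚ.<⇒≤ 1<p

  p-1 : ℕ
  p-1 = ℕ.pred p

  suc-p-1 : suc p-1 ≡ p
  suc-p-1 = ℕₚ.suc-pred p {{ℕ.>-nonZero 1≤p}}

  D-^p : ∀ A → D (A ^ᴾ p) ≈ []
  D-^p A = subst (λ n → D (A ^ᴾ n) ≈ []) suc-p-1 (≈-trans (D-^ A p-1)
    (*ᴾ-cong {const (fromℕ (suc p-1)) *ᴾ A ^ᴾ p-1} {[]} {D A} {D A}
      (*ᴾ-cong {const (fromℕ (suc p-1))} {[]} {A ^ᴾ p-1} {A ^ᴾ p-1}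
        (const-zero (trans (cong fromℕ suc-p-1) fromℕ-p)) ≈-refl) ≈-refl))

  -- The derivative of a p-th power is zero, so k times the k-th coefficient is 0, and k is
  -- invertible. This takes the place of divisibility properties of binomial coefficients.
  coef-^p : ∀ A k → 1 ≤ k → k < p → coef (A ^ᴾ p) k ≡ 0ᴷ
  coef-^p A (suc k) _ k<p = [ (λ eq → contradiction eq (fromℕ≢0 (s≤s z≤n) k<p)) , (λ eq → eq) ]′
    (x⊗y≡0 _ _ (trans (sym (coef-D (A ^ᴾ p) k)) (at (D-^p A) k)))

  coef-^p-0 : ∀ A → coef (A ^ᴾ p) 0 ≡ coef A 0 ^ᴷ p
  coef-^p-0 A = trans (sym (eval-at-0 (A ^ᴾ p))) (trans (eval-^ A p 0ᴷ) (cong (_^ᴷ p) (eval-at-0 A)))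

  ^ᴷ-≢0 : ∀ {x} n → x ≢ 0ᴷ → x ^ᴷ n ≢ 0ᴷ
  ^ᴷ-≢0 zero x≢0 = 1≢0
  ^ᴷ-≢0 (suc n) x≢0 = ⊗-≢0 x≢0 (^ᴷ-≢0 n x≢0)

  1^ : ∀ n → 1ᴷ ^ᴷ n ≡ 1ᴷ
  1^ zero = refl
  1^ (suc n) = trans (*-identityˡ _) (1^ n)

  0^p : 0ᴷ ^ᴷ p ≡ 0ᴷ
  0^p = subst (λ n → 0ᴷ ^ᴷ n ≡ 0ᴷ) suc-p-1 (zeroˡ _)

  coef-^-top : ∀ {m} A n → Deg< (suc m) A → coef (A ^ᴾ n) (n * m) ≡ coef A m ^ᴷ n
  coef-^-top A zero a = refl
  coef-^-top {m} A (suc n) a = trans (coef-*-top A (A ^ᴾ n) a (Deg<-^ n a)) (cong (coef A m ⊗_) (coef-^-top A n a))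

  1+X : Pol
  1+X = 1ᴷ ∷ 1ᴷ ∷ []

  Deg<-1+X : Deg< 2 1+X
  Deg<-1+X = Deg<-∷ (Deg<-∷ (Deg<-zero ≈-refl))

  [1+X]^p : 1+X ^ᴾ p ≈ 1ᴾ +ᴾ shift p 1ᴾ
  [1+X]^p = coefwise λ k → trans (value k) (sym (coef-+ 1ᴾ (shift p 1ᴾ) k))
    where
    value : ∀ k → coef (1+X ^ᴾ p) k ≡ coef 1ᴾ k ⊕ coef (shift p 1ᴾ) k
    value zero = trans (coef-^p-0 1+X) (trans (1^ p) (sym (trans (cong (1ᴷ ⊕_) (coef-shift-< p 1ᴾ 0 1≤p)) (+-identityʳ _))))
    value (suc k) with ℕₚ.<-cmp (suc k) p
    ... | tri< k<p _ _ = trans (coef-^p 1+X (suc k) (s≤s z≤n) k<p)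
      (sym (trans (+-identityˡ _) (coef-shift-< p 1ᴾ (suc k) k<p)))
    ... | tri≈ _ k≡p _ = begin
      coef (1+X ^ᴾ p) (suc k) ≡⟨ cong (coef (1+X ^ᴾ p)) (trans k≡p (sym (ℕₚ.*-identityʳ p))) ⟩
      coef (1+X ^ᴾ p) (p * 1) ≡⟨ coef-^-top 1+X p Deg<-1+X ⟩
      1ᴷ ^ᴷ p ≡⟨ 1^ p ⟩
      1ᴷ ≡⟨ trans (+-identityˡ _) (coef-shift-+ p 1ᴾ 0) ⟨
      0ᴷ ⊕ coef (shift p 1ᴾ) (p + 0) ≡⟨ cong (λ j → 0ᴷ ⊕ coef (shift p 1ᴾ) j) (trans (ℕₚ.+-identityʳ p) (sym k≡p)) ⟩
      0ᴷ ⊕ coef (shift p 1ᴾ) (suc k) ∎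
    ... | tri> _ _ k>p with ℕₚ.m≤n⇒∃[o]m+o≡n (ℕₚ.<⇒≤ k>p)
    ...   | zero , eq = contradiction (trans (sym (ℕₚ.+-identityʳ p)) eq) (ℕₚ.<⇒≢ k>p)
    ...   | suc j , eq = begin
      coef (1+X ^ᴾ p) (suc k) ≡⟨ above (Deg<-^ p Deg<-1+X) (suc k) (subst (_< suc k) (sym (ℕₚ.*-identityʳ p)) k>p) ⟩
      0ᴷ ≡⟨ trans (+-identityˡ _) (coef-shift-+ p 1ᴾ (suc j)) ⟨
      0ᴷ ⊕ coef (shift p 1ᴾ) (p + suc j) ≡⟨ cong (λ i → 0ᴷ ⊕ coef (shift p 1ᴾ) i) eq ⟩
      0ᴷ ⊕ coef (shift p 1ᴾ) (suc k) ∎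

  [1+x]^p : ∀ x → (1ᴷ ⊕ x) ^ᴷ p ≡ 1ᴷ ⊕ x ^ᴷ p
  [1+x]^p x = begin
    (1ᴷ ⊕ x) ^ᴷ p ≡⟨ cong (_^ᴷ p) (solve 1 (λ x → con (+ 1) :+ x := con (+ 1) :+ x :* (con (+ 1) :+ x :* con (+ 0))) refl x) ⟩
    evalᴾ 1+X x ^ᴷ p ≡⟨ eval-^ 1+X p x ⟨
    evalᴾ (1+X ^ᴾ p) x ≡⟨ eval-cong [1+X]^p x ⟩
    evalᴾ (1ᴾ +ᴾ shift p 1ᴾ) x ≡⟨ eval-+ 1ᴾ (shift p 1ᴾ) x ⟩
    evalᴾ 1ᴾ x ⊕ evalᴾ (shift p 1ᴾ) x ≡⟨ cong₂ _⊕_ (eval-const 1ᴷ x) (eval-shift p 1ᴾ x) ⟩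
    1ᴷ ⊕ x ^ᴷ p ⊗ evalᴾ 1ᴾ x ≡⟨ cong (λ u → 1ᴷ ⊕ x ^ᴷ p ⊗ u) (eval-const 1ᴷ x) ⟩
    1ᴷ ⊕ x ^ᴷ p ⊗ 1ᴷ ≡⟨ cong (1ᴷ ⊕_) (*-identityʳ _) ⟩
    1ᴷ ⊕ x ^ᴷ p ∎
    where open Solver

  fermat-fromℕ : ∀ n → fromℕ n ^ᴷ p ≡ fromℕ n
  fermat-fromℕ zero = trans (cong (_^ᴷ p) fromℕ-0) (trans 0^p (sym fromℕ-0))
  fermat-fromℕ (suc n) = begin
    fromℕ (1 + n) ^ᴷ p ≡⟨ cong (_^ᴷ p) (fromℕ-suc n) ⟨
    (1ᴷ ⊕ fromℕ n) ^ᴷ p ≡⟨ [1+x]^p (fromℕ n) ⟩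
    1ᴷ ⊕ fromℕ n ^ᴷ p ≡⟨ cong (1ᴷ ⊕_) (fermat-fromℕ n) ⟩
    1ᴷ ⊕ fromℕ n ≡⟨ fromℕ-suc n ⟩
    fromℕ (1 + n) ∎

  fermat : ∀ x → x ^ᴷ p ≡ x
  fermat x = subst (λ y → y ^ᴷ p ≡ y) (fromℕ-toFin x) (fermat-fromℕ (repr x))

  X-_ : K → Pol
  X- x = ⊖ x ∷ 1ᴷ ∷ []

  -- Synthetic division: the coefficients of the quotient by X - x are the intermediate values of
  -- Horner's scheme at x.
  quotient : K → Pol → Pol
  quotient x [] = []
  quotient x (a ∷ A) = evalᴾ A x ∷ quotient x A

  horner : ∀ x A → A ≈ (X- x) *ᴾ quotient x A +ᴾ const (evalᴾ A x)
  horner x [] = ≈-sym (≈-trans (+ᴾ-cong (*ᴾ-zeroʳ (X- x)) (≈-refl {const 0ᴷ})) 0∷[]≈[])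
  horner x (a ∷ A) = begin′
    a ∷ A ≈⟨ ∷-cong refl (horner x A) ⟩
    a ∷ ((X- x) *ᴾ q +ᴾ const e) ≈⟨ ∷-cong (solve 3 (λ a x e → a := :- x :* e :+ con (+ 0) :+ (a :+ x :* e)) refl a x e) tails ⟩
    (X- x) *ᴾ (e ∷ q) +ᴾ const (a ⊕ x ⊗ e) ∎′
    where
    open ≈-Reasoning renaming (begin_ to begin′_; _∎ to _∎′)
    open Solver using (solve; _:=_; _:+_; _:*_; :-_; con)
    q = quotient x A
    e = evalᴾ A x
    tails : (X- x) *ᴾ q +ᴾ const e ≈ (scale (⊖ x) q +ᴾ 1ᴾ *ᴾ (e ∷ q)) +ᴾ []
    tails = begin′
      (scale (⊖ x) q +ᴾ (0ᴷ ∷ 1ᴾ *ᴾ q)) +ᴾ const e ≈⟨ +ᴾ-assoc (scale (⊖ x) q) _ (const e) ⟩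
      scale (⊖ x) q +ᴾ ((0ᴷ ∷ 1ᴾ *ᴾ q) +ᴾ const e)
        ≈⟨ +ᴾ-cong (≈-refl {scale (⊖ x) q}) (∷-cong (+-identityˡ e) (≈-trans (+ᴾ-identityʳ _) (*ᴾ-identityˡ q))) ⟩
      scale (⊖ x) q +ᴾ (e ∷ q) ≈⟨ +ᴾ-cong (≈-refl {scale (⊖ x) q}) (≈-sym (*ᴾ-identityˡ (e ∷ q))) ⟩
      scale (⊖ x) q +ᴾ 1ᴾ *ᴾ (e ∷ q) ≈⟨ +ᴾ-identityʳ _ ⟨
      (scale (⊖ x) q +ᴾ 1ᴾ *ᴾ (e ∷ q)) +ᴾ [] ∎′

  factor-root : ∀ x A → evalᴾ A x ≡ 0ᴷ → A ≈ (X- x) *ᴾ quotient x A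
  factor-root x A eq = ≈-trans (horner x A) (≈-trans
    (+ᴾ-cong (≈-refl {(X- x) *ᴾ quotient x A}) (const-zero eq)) (+ᴾ-identityʳ _))

  Deg<-quotient : ∀ x {n A} → Deg< (suc n) A → Deg< n (quotient x A)
  Deg<-quotient x {A = []} a = Deg<-zero ≈-refl
  Deg<-quotient x {zero} {b ∷ A} a = Deg<-zero (≈-trans
    (∷-cong (eval-zero (Deg<0 (Deg<-tail a)) x) (Deg<0 (Deg<-quotient x (Deg<-mono z≤n (Deg<-tail a))))) 0∷[]≈[])
  Deg<-quotient x {suc n} {b ∷ A} a = Deg<-∷ (Deg<-quotient x (Deg<-tail a))

  D^ : ℕ → Pol → Pol
  D^ zero A = A
  D^ (suc k) A = D (D^ k A)

  D^-cong : ∀ k {A B} → A ≈ B → D^ k A ≈ D^ k B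
  D^-cong zero eq = eq
  D^-cong (suc k) eq = D-cong (D^-cong k eq)

  -- Multiplicity is measured by iterated ordinary derivatives. This is faithful only up to order p,
  -- because factorials of the orders involved must be invertible; hence the assumptions `M ≤ p`
  -- below.
  Vanishes : ℕ → Pol → K → Set
  Vanishes M A x = ∀ k → k < M → evalᴾ (D^ k A) x ≡ 0ᴷ

  Vanishes-cong : ∀ {M A B x} → A ≈ B → Vanishes M A x → Vanishes M B x
  Vanishes-cong {x = x} eq v k k<M = trans (sym (eval-cong (D^-cong k eq) x)) (v k k<M)

  D-X- : ∀ x → D (X- x) ≈ 1ᴾ
  D-X- x = ∷-cong (+-identityʳ 1ᴷ) 0∷[]≈[]

  D^-X-* : ∀ x Q k → D^ (suc k) ((X- x) *ᴾ Q) ≈ (X- x) *ᴾ D^ (suc k) Q +ᴾ const (fromℕ (suc k)) *ᴾ D^ k Q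
  D^-X-* x Q zero = begin′
    D ((X- x) *ᴾ Q) ≈⟨ D-* (X- x) Q ⟩
    D (X- x) *ᴾ Q +ᴾ (X- x) *ᴾ D Q ≈⟨ +ᴾ-comm (D (X- x) *ᴾ Q) _ ⟩
    (X- x) *ᴾ D Q +ᴾ D (X- x) *ᴾ Q
      ≈⟨ +ᴾ-cong (≈-refl {(X- x) *ᴾ D Q}) (*ᴾ-cong (≈-trans (D-X- x) (const-cong (sym fromℕ-1))) (≈-refl {Q})) ⟩
    (X- x) *ᴾ D Q +ᴾ const (fromℕ 1) *ᴾ Q ∎′
    where open ≈-Reasoning renaming (begin_ to begin′_; _∎ to _∎′)
  D^-X-* x Q (suc k) = begin′
    D (D^ (suc k) (L *ᴾ Q)) ≈⟨ D-cong (D^-X-* x Q k) ⟩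
    D (L *ᴾ E +ᴾ c *ᴾ F) ≈⟨ D-+ (L *ᴾ E) (c *ᴾ F) ⟩
    D (L *ᴾ E) +ᴾ D (c *ᴾ F) ≈⟨ +ᴾ-cong (D-* L E) (D-* c F) ⟩
    (D L *ᴾ E +ᴾ L *ᴾ D E) +ᴾ (D c *ᴾ F +ᴾ c *ᴾ E)
      ≈⟨ +ᴾ-cong (+ᴾ-cong (*ᴾ-cong (D-X- x) (≈-refl {E})) (≈-refl {L *ᴾ D E}))
          (+ᴾ-cong (*ᴾ-cong (D-const (fromℕ (suc k))) (≈-refl {F})) (≈-refl {c *ᴾ E})) ⟩
    (1ᴾ *ᴾ E +ᴾ L *ᴾ D E) +ᴾ c *ᴾ E
      ≈⟨ solve 3 (λ e u c → (con (+ 1) :* e :+ u) :+ c :* e := u :+ (con (+ 1) :+ c) :* e) ≈-refl E (L *ᴾ D E) c ⟩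
    L *ᴾ D E +ᴾ (1ᴾ +ᴾ c) *ᴾ E
      ≈⟨ +ᴾ-cong (≈-refl {L *ᴾ D E}) (*ᴾ-cong (const-cong (fromℕ-suc (suc k))) (≈-refl {E})) ⟩
    L *ᴾ D E +ᴾ const (fromℕ (suc (suc k))) *ᴾ E ∎′
    where
    open ≈-Reasoning renaming (begin_ to begin′_; _∎ to _∎′)
    open PSolver
    L = X- x
    F = D^ k Q
    E = D^ (suc k) Q
    c = const (fromℕ (suc k))

  eval-X- : ∀ x y → evalᴾ (X- x) y ≡ y ⊕ ⊖ x
  eval-X- x y = solve 2 (λ x y → :- x :+ y :* (con (+ 1) :+ y :* con (+ 0)) := y :- x) refl x y
    where open Solver

  eval-D^-X-* : ∀ x Q k y → evalᴾ (D^ (suc k) ((X- x) *ᴾ Q)) y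
    ≡ (y ⊕ ⊖ x) ⊗ evalᴾ (D^ (suc k) Q) y ⊕ fromℕ (suc k) ⊗ evalᴾ (D^ k Q) y
  eval-D^-X-* x Q k y = begin
    evalᴾ (D^ (suc k) ((X- x) *ᴾ Q)) y ≡⟨ eval-cong (D^-X-* x Q k) y ⟩
    evalᴾ ((X- x) *ᴾ D^ (suc k) Q +ᴾ c *ᴾ D^ k Q) y ≡⟨ eval-+ ((X- x) *ᴾ D^ (suc k) Q) _ y ⟩
    evalᴾ ((X- x) *ᴾ D^ (suc k) Q) y ⊕ evalᴾ (c *ᴾ D^ k Q) y ≡⟨ cong₂ _⊕_ (eval-* (X- x) (D^ (suc k) Q) y) (eval-* c (D^ k Q) y) ⟩
    evalᴾ (X- x) y ⊗ evalᴾ (D^ (suc k) Q) y ⊕ evalᴾ c y ⊗ evalᴾ (D^ k Q) y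
      ≡⟨ cong₂ (λ u v → u ⊗ evalᴾ (D^ (suc k) Q) y ⊕ v ⊗ evalᴾ (D^ k Q) y) (eval-X- x y) (eval-const (fromℕ (suc k)) y) ⟩
    (y ⊕ ⊖ x) ⊗ evalᴾ (D^ (suc k) Q) y ⊕ fromℕ (suc k) ⊗ evalᴾ (D^ k Q) y ∎
    where c = const (fromℕ (suc k))

  -- At x itself the Leibniz rule leaves only (k + 1) times the k-th derivative of Q, and 0 < k + 1
  -- < p.
  Vanishes-quotient : ∀ {M} x Q → suc M ≤ p → Vanishes (suc M) ((X- x) *ᴾ Q) x → Vanishes M Q x
  Vanishes-quotient x Q 1+M≤p v k k<M = [ (λ eq → contradiction eq (fromℕ≢0 (s≤s z≤n) (ℕₚ.<-≤-trans (s≤s k<M) 1+M≤p))) , (λ eq → eq) ]′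
    (x⊗y≡0 _ _ (begin
      fromℕ (suc k) ⊗ evalᴾ (D^ k Q) x
        ≡⟨ solve 3 (λ x u v → v := (x :- x) :* u :+ v) refl x (evalᴾ (D^ (suc k) Q) x) _ ⟩
      (x ⊕ ⊖ x) ⊗ evalᴾ (D^ (suc k) Q) x ⊕ fromℕ (suc k) ⊗ evalᴾ (D^ k Q) x ≡⟨ eval-D^-X-* x Q k x ⟨
      evalᴾ (D^ (suc k) ((X- x) *ᴾ Q)) x ≡⟨ v (suc k) (s≤s k<M) ⟩
      0ᴷ ∎))
    where open Solver

  -- Induction on the order: in the Leibniz rule at y the lower derivative of Q is already known to
  -- vanish, and the other term carries the nonzero factor y - x.
  Vanishes-quotient-≢ : ∀ {M} x Q y → x ≢ y → Vanishes M ((X- x) *ᴾ Q) y → Vanishes M Q y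
  Vanishes-quotient-≢ {M} x Q y x≢y v k k<M = cancel (product≡0 k k<M)
    where
    cancel : ∀ {u} → (y ⊕ ⊖ x) ⊗ u ≡ 0ᴷ → u ≡ 0ᴷ
    cancel eq = [ (λ e → contradiction (sym (x⊖y≡0⇒x≡y e)) x≢y) , (λ e → e) ]′ (x⊗y≡0 _ _ eq)
    product≡0 : ∀ k → k < M → (y ⊕ ⊖ x) ⊗ evalᴾ (D^ k Q) y ≡ 0ᴷ
    product≡0 zero k<M = trans (cong (_⊗ evalᴾ Q y) (sym (eval-X- x y))) (trans (sym (eval-* (X- x) Q y)) (v 0 k<M))
    product≡0 (suc k) k<M = begin
      (y ⊕ ⊖ x) ⊗ evalᴾ (D^ (suc k) Q) y ≡⟨ +-identityʳ _ ⟨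
      (y ⊕ ⊖ x) ⊗ evalᴾ (D^ (suc k) Q) y ⊕ 0ᴷ
        ≡⟨ cong ((y ⊕ ⊖ x) ⊗ evalᴾ (D^ (suc k) Q) y ⊕_)
             (sym (trans (cong (fromℕ (suc k) ⊗_) (cancel (product≡0 k (ℕₚ.<-trans (ℕₚ.n<1+n k) k<M)))) (zeroʳ _))) ⟩
      (y ⊕ ⊖ x) ⊗ evalᴾ (D^ (suc k) Q) y ⊕ fromℕ (suc k) ⊗ evalᴾ (D^ k Q) y ≡⟨ eval-D^-X-* x Q k y ⟨
      evalᴾ (D^ (suc k) ((X- x) *ᴾ Q)) y ≡⟨ v (suc k) k<M ⟩
      0ᴷ ∎

  -- The quotient by (X - x)^M, described not by an equation but by the three properties on which
  -- the induction over the roots in `too-many-roots` runs.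
  divide-out : ∀ M {n} x A → M ≤ p → Deg< (M + n) A → Vanishes M A x →
    Σ Pol λ Q → Deg< n Q × (Q ≈ [] → A ≈ []) × (∀ {N} y → x ≢ y → Vanishes N A y → Vanishes N Q y)
  divide-out zero x A _ a v = A , a , (λ eq → eq) , λ _ _ v → v
  divide-out (suc M) x A M<p a v
    with factor-root x A (v 0 (s≤s z≤n))
  ... | A≈ with divide-out M x (quotient x A) (ℕₚ.<⇒≤ M<p) (Deg<-quotient x a)
                  (Vanishes-quotient x (quotient x A) M<p (Vanishes-cong A≈ v))
  ...   | Q , q , Q≈0⇒ , transfer = Q , q
        , (λ Q≈0 → ≈-trans A≈ (≈-trans (*ᴾ-congˡ (X- x) (Q≈0⇒ Q≈0)) (*ᴾ-zeroʳ (X- x))))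
        , λ y x≢y vy → transfer y x≢y (Vanishes-quotient-≢ x (quotient x A) y x≢y (Vanishes-cong A≈ vy))

  too-many-roots : ∀ {M} A (xs : List K) → M ≤ p → Unique xs → All (Vanishes M A) xs → Deg< (length xs * M) A → A ≈ []
  too-many-roots A [] _ _ _ a = Deg<0 a
  too-many-roots {M} A (x ∷ xs) M≤p (x∉xs ∷ xs!) (v ∷ vs) a with divide-out M x A M≤p a v
  ... | Q , q , Q≈0⇒ , transfer = Q≈0⇒ (too-many-roots Q xs M≤p xs!
    (All.zipWith (λ { (x≢y , vy) → transfer _ x≢y vy }) (x∉xs , vs)) q)

  too-many-simple-roots : ∀ A (xs : List K) → Unique xs → All (λ x → evalᴾ A x ≡ 0ᴷ) xs → Deg< (length xs) A → A ≈ []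
  too-many-simple-roots A xs xs! vs a = too-many-roots {1} A xs 1≤p xs!
    (All.map (λ eq → λ { zero _ → eq ; (suc _) (s≤s ()) }) vs) (Deg<-mono (ℕₚ.≤-reflexive (sym (ℕₚ.*-identityʳ _))) a)

-- Pigeonhole principle for vectors over the field.

module FieldPigeonhole {p : ℕ} (𝔽 : PrimeField p) where
  open PrimeField 𝔽

  private
    fromℕ-≮ : ∀ {a b} → a < b → b < p → fromℕ a ≢ fromℕ b
    fromℕ-≮ {a} {b} a<b b<p eq = fromℕ≢0 (ℕₚ.m<n⇒0<n∸m a<b) (ℕₚ.≤-<-trans (ℕₚ.m∸n≤m b a) b<p) (begin
      fromℕ (b ∸ a) ≡⟨ solve 2 (λ u v → u := (v :+ u) :- v) refl (fromℕ (b ∸ a)) (fromℕ a) ⟩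
      (fromℕ a ⊕ fromℕ (b ∸ a)) ⊕ ⊖ fromℕ a ≡⟨ cong (_⊕ ⊖ fromℕ a) (trans (sym (fromℕ-+ a (b ∸ a))) (cong fromℕ (ℕₚ.m+[n∸m]≡n (ℕₚ.<⇒≤ a<b)))) ⟩
      fromℕ b ⊕ ⊖ fromℕ a ≡⟨ cong (λ u → fromℕ b ⊕ ⊖ u) eq ⟩
      fromℕ b ⊕ ⊖ fromℕ b ≡⟨ -‿inverseʳ _ ⟩
      0ᴷ ∎)
      where open ≡-Reasoning
            open Solver

  fromℕ-injective : ∀ {a b} → a < p → b < p → fromℕ a ≡ fromℕ b → a ≡ b
  fromℕ-injective {a} {b} a<p b<p eq with ℕₚ.<-cmp a b
  ... | tri< a<b _ _ = contradiction eq (fromℕ-≮ a<b b<p)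
  ... | tri≈ _ a≡b _ = a≡b
  ... | tri> _ _ b<a = contradiction (sym eq) (fromℕ-≮ b<a a<p)

  private
    toVector : ∀ U → Fin (p ^ U) → ℕ → K
    toVector U i n with n ℕₚ.<? U
    ... | yes n<U = fromℕ (toℕ (finToFun {p} {U} i (fromℕ< n<U)))
    ... | no _ = 0ᴷ

    toVector-injective : ∀ U i j → (∀ n → n < U → toVector U i n ≡ toVector U j n) → i ≡ j
    toVector-injective U i j eq = begin
      i ≡⟨ Finₚ.funToFin-finToFin {U} i ⟨
      funToFin (finToFun {p} {U} i) ≡⟨ funToFin-cong (λ k → Finₚ.toℕ-injective (fromℕ-injective (Finₚ.toℕ<n _) (Finₚ.toℕ<n _) (entries k))) ⟩
      funToFin (finToFun {p} {U} j) ≡⟨ Finₚ.funToFin-finToFin {U} j ⟩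
      j ∎
      where
      open ≡-Reasoning
      open import Data.Fin.Base using (zero; suc)
      funToFin-cong : ∀ {m n} {f g : Fin m → Fin n} → (∀ k → f k ≡ g k) → funToFin f ≡ funToFin g
      funToFin-cong {zero} f≗g = refl
      funToFin-cong {suc m} f≗g = cong₂ combine (f≗g zero) (funToFin-cong λ k → f≗g (suc k))
      entries : ∀ (k : Fin U) → fromℕ (toℕ (finToFun {p} {U} i k)) ≡ fromℕ (toℕ (finToFun {p} {U} j k))
      entries k with toℕ k ℕₚ.<? U | eq (toℕ k) (Finₚ.toℕ<n k)
      ... | yes k<U | e = subst (λ l → fromℕ (toℕ (finToFun {p} {U} i l)) ≡ fromℕ (toℕ (finToFun {p} {U} j l))) (Finₚ.fromℕ<-toℕ k k<U) e
      ... | no k≮U | _ = contradiction (Finₚ.toℕ<n k) k≮U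

  -- Substitute for the nonzero solution of a homogeneous linear system with more unknowns than
  -- equations: p^U vectors have at most p^V images. When `G` is linear, the difference of the two
  -- vectors is such a solution.
  pigeonhole-functions : ∀ {U V} → V < U → (G : (ℕ → K) → Fin V → K) →
    ∃₂ λ v w → (∀ e → G v e ≡ G w e) × ¬ (∀ n → n < U → v n ≡ w n)
  pigeonhole-functions {U} {V} V<U G
    with Finₚ.pigeonhole (ℕₚ.^-monoʳ-< p 1<p V<U) (λ i → funToFin (λ e → toFin (G (toVector U i) e)))
  ... | i , j , i<j , eq = toVector U i , toVector U j
      , (λ e → repr-injective (cong toℕ (trans (sym (Finₚ.finToFun-funToFin _ e)) (trans (cong (λ k → finToFun k e) eq) (Finₚ.finToFun-funToFin _ e)))))
      , λ same → contradiction (cong toℕ (toVector-injective U i j same)) (ℕₚ.<⇒≢ i<j)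

-- Stepanov's method.

module Stepanov {p : ℕ} (𝔽 : PrimeField p) (f : List (PrimeField.K 𝔽)) (q : ℕ) where
  open PrimeField 𝔽
  open Polynomial 𝔽
  open Roots 𝔽
  open FieldPigeonhole 𝔽

  g : Pol
  g = f ^ᴾ q

  Family : Set
  Family = List (Pol × Pol)

  Φ : Family → Pol
  Φ [] = []
  Φ ((r , s) ∷ L) = (r +ᴾ s *ᴾ g) +ᴾ shift p (Φ L)

  -- What Φ becomes at a point x with g(x) = a, because x ^ p = x.
  reduced : K → Family → Pol
  reduced a [] = []
  reduced a ((r , s) ∷ L) = (r +ᴾ scale a s) +ᴾ (0ᴷ ∷ reduced a L)

  eval-Φ : ∀ {a} x → evalᴾ g x ≡ a → ∀ L → evalᴾ (Φ L) x ≡ evalᴾ (reduced a L) x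
  eval-Φ x eq [] = refl
  eval-Φ {a} x eq ((r , s) ∷ L) = begin
    evalᴾ ((r +ᴾ s *ᴾ g) +ᴾ shift p (Φ L)) x ≡⟨ eval-+ (r +ᴾ s *ᴾ g) _ x ⟩
    evalᴾ (r +ᴾ s *ᴾ g) x ⊕ evalᴾ (shift p (Φ L)) x ≡⟨ cong₂ _⊕_ (trans (eval-+ r _ x) (cong (evalᴾ r x ⊕_) s-part)) shift-part ⟩
    evalᴾ r x ⊕ evalᴾ (scale a s) x ⊕ evalᴾ (0ᴷ ∷ reduced a L) x ≡⟨ cong (_⊕ evalᴾ (0ᴷ ∷ reduced a L) x) (eval-+ r (scale a s) x) ⟨
    evalᴾ (r +ᴾ scale a s) x ⊕ evalᴾ (0ᴷ ∷ reduced a L) x ≡⟨ eval-+ (r +ᴾ scale a s) (0ᴷ ∷ reduced a L) x ⟨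
    evalᴾ ((r +ᴾ scale a s) +ᴾ (0ᴷ ∷ reduced a L)) x ∎
    where
    open ≡-Reasoning
    s-part : evalᴾ (s *ᴾ g) x ≡ evalᴾ (scale a s) x
    s-part = begin
      evalᴾ (s *ᴾ g) x ≡⟨ eval-* s g x ⟩
      evalᴾ s x ⊗ evalᴾ g x ≡⟨ *-comm _ _ ⟩
      evalᴾ g x ⊗ evalᴾ s x ≡⟨ cong (_⊗ evalᴾ s x) eq ⟩
      a ⊗ evalᴾ s x ≡⟨ eval-scale a s x ⟨
      evalᴾ (scale a s) x ∎
    shift-part : evalᴾ (shift p (Φ L)) x ≡ evalᴾ (0ᴷ ∷ reduced a L) x
    shift-part = begin
      evalᴾ (shift p (Φ L)) x ≡⟨ eval-shift p (Φ L) x ⟩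
      x ^ᴷ p ⊗ evalᴾ (Φ L) x ≡⟨ cong₂ _⊗_ (fermat x) (eval-Φ x eq L) ⟩
      x ⊗ evalᴾ (reduced a L) x ≡⟨ +-identityˡ _ ⟨
      0ᴷ ⊕ x ⊗ evalᴾ (reduced a L) x ∎

  -- D (f ^ e · A) = f ^ (e − 1) · P e A.
  P : ℕ → Pol → Pol
  P e A = const (fromℕ e) *ᴾ D f *ᴾ A +ᴾ f *ᴾ D A

  -- The exponent for `s` is larger by `q` because `s` comes with the factor g = f^q, and f^e s g is
  -- f^(e + q) s. Differentiation thus keeps the shape of a family and never has to differentiate g.
  T : ℕ → Pol × Pol → Pol × Pol
  T e (r , s) = P e r , P (e + q) s

  P-cong : ∀ e {A B} → A ≈ B → P e A ≈ P e B
  P-cong e eq = +ᴾ-cong (*ᴾ-congˡ (const (fromℕ e) *ᴾ D f) eq) (*ᴾ-congˡ f (D-cong eq))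

  P-+ : ∀ e A B → P e (A +ᴾ B) ≈ P e A +ᴾ P e B
  P-+ e A B = ≈-trans (+ᴾ-cong (≈-refl {c *ᴾ (A +ᴾ B)}) (*ᴾ-congˡ f (D-+ A B)))
    (solve 6 (λ c A B f a b → c :* (A :+ B) :+ f :* (a :+ b) := (c :* A :+ f :* a) :+ (c :* B :+ f :* b)) ≈-refl c A B f (D A) (D B))
    where
    open PSolver
    c = const (fromℕ e) *ᴾ D f

  D-f^-* : ∀ e A → D (f ^ᴾ suc e *ᴾ A) ≈ f ^ᴾ e *ᴾ P (suc e) A
  D-f^-* e A = begin
    D (f ^ᴾ suc e *ᴾ A) ≈⟨ D-* (f ^ᴾ suc e) A ⟩
    D (f ^ᴾ suc e) *ᴾ A +ᴾ f ^ᴾ suc e *ᴾ D A ≈⟨ +ᴾ-cong (*ᴾ-cong (D-^ f e) (≈-refl {A})) (≈-refl {f ^ᴾ suc e *ᴾ D A}) ⟩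
    const (fromℕ (suc e)) *ᴾ f ^ᴾ e *ᴾ D f *ᴾ A +ᴾ f *ᴾ f ^ᴾ e *ᴾ D A
      ≈⟨ solve 6 (λ c u d A f a → c :* u :* d :* A :+ f :* u :* a := u :* (c :* d :* A :+ f :* a)) ≈-refl
           (const (fromℕ (suc e))) (f ^ᴾ e) (D f) A f (D A) ⟩
    f ^ᴾ e *ᴾ P (suc e) A ∎
    where
    open ≈-Reasoning
    open PSolver

  f*Dg : f *ᴾ D g ≈ const (fromℕ q) *ᴾ D f *ᴾ g
  f*Dg = go q
    where
    open ≈-Reasoning
    open PSolver
    go : ∀ q → f *ᴾ D (f ^ᴾ q) ≈ const (fromℕ q) *ᴾ D f *ᴾ f ^ᴾ q
    go zero = begin
      f *ᴾ D 1ᴾ ≈⟨ *ᴾ-congˡ f (D-const 1ᴷ) ⟩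
      f *ᴾ [] ≈⟨ solve 3 (λ f d u → f :* con (+ 0) := con (+ 0) :* d :* u) ≈-refl f (D f) 1ᴾ ⟩
      [] *ᴾ D f *ᴾ 1ᴾ ≈⟨ *ᴾ-cong (*ᴾ-cong (≈-sym (const-zero fromℕ-0)) (≈-refl {D f})) (≈-refl {1ᴾ}) ⟩
      const (fromℕ 0) *ᴾ D f *ᴾ 1ᴾ ∎
    go (suc q) = begin
      f *ᴾ D (f ^ᴾ suc q) ≈⟨ *ᴾ-congˡ f (D-^ f q) ⟩
      f *ᴾ (const (fromℕ (suc q)) *ᴾ f ^ᴾ q *ᴾ D f)
        ≈⟨ solve 4 (λ f c u d → f :* (c :* u :* d) := c :* d :* (f :* u)) ≈-refl f (const (fromℕ (suc q))) (f ^ᴾ q) (D f) ⟩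
      const (fromℕ (suc q)) *ᴾ D f *ᴾ f ^ᴾ suc q ∎

  const-+ : ∀ m n → const (fromℕ (m + n)) ≈ const (fromℕ m) +ᴾ const (fromℕ n)
  const-+ m n = const-cong (fromℕ-+ m n)

  P-*g : ∀ e s → P e (s *ᴾ g) ≈ P (e + q) s *ᴾ g
  P-*g e s = begin
    const (fromℕ e) *ᴾ D f *ᴾ (s *ᴾ g) +ᴾ f *ᴾ D (s *ᴾ g)
      ≈⟨ +ᴾ-cong (≈-refl {const (fromℕ e) *ᴾ D f *ᴾ (s *ᴾ g)}) (*ᴾ-congˡ f (D-* s g)) ⟩
    const (fromℕ e) *ᴾ D f *ᴾ (s *ᴾ g) +ᴾ f *ᴾ (D s *ᴾ g +ᴾ s *ᴾ D g)
      ≈⟨ solve 7 (λ c d s g f s′ g′ → c :* d :* (s :* g) :+ f :* (s′ :* g :+ s :* g′) := c :* d :* (s :* g) :+ f :* s′ :* g :+ s :* (f :* g′))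
           ≈-refl (const (fromℕ e)) (D f) s g f (D s) (D g) ⟩
    const (fromℕ e) *ᴾ D f *ᴾ (s *ᴾ g) +ᴾ f *ᴾ D s *ᴾ g +ᴾ s *ᴾ (f *ᴾ D g)
      ≈⟨ +ᴾ-cong (≈-refl {const (fromℕ e) *ᴾ D f *ᴾ (s *ᴾ g) +ᴾ f *ᴾ D s *ᴾ g}) (*ᴾ-congˡ s f*Dg) ⟩
    const (fromℕ e) *ᴾ D f *ᴾ (s *ᴾ g) +ᴾ f *ᴾ D s *ᴾ g +ᴾ s *ᴾ (const (fromℕ q) *ᴾ D f *ᴾ g)
      ≈⟨ solve 7 (λ c d s g f s′ b → c :* d :* (s :* g) :+ f :* s′ :* g :+ s :* (b :* d :* g) := ((c :+ b) :* d :* s :+ f :* s′) :* g)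
           ≈-refl (const (fromℕ e)) (D f) s g f (D s) (const (fromℕ q)) ⟩
    ((const (fromℕ e) +ᴾ const (fromℕ q)) *ᴾ D f *ᴾ s +ᴾ f *ᴾ D s) *ᴾ g
      ≈⟨ *ᴾ-cong (+ᴾ-cong (*ᴾ-cong (*ᴾ-cong (≈-sym (const-+ e q)) (≈-refl {D f})) (≈-refl {s})) (≈-refl {f *ᴾ D s})) (≈-refl {g}) ⟩
    P (e + q) s *ᴾ g ∎
    where
    open ≈-Reasoning
    open PSolver

  X : Pol
  X = 0ᴷ ∷ 1ᴷ ∷ []

  X-* : ∀ A → X *ᴾ A ≈ 0ᴷ ∷ A
  X-* A = ≈-trans (0∷-*ᴾ 1ᴾ A) (∷-cong refl (*ᴾ-identityˡ A))

  shift≈X^* : ∀ n A → shift n A ≈ X ^ᴾ n *ᴾ A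
  shift≈X^* zero A = ≈-sym (*ᴾ-identityˡ A)
  shift≈X^* (suc n) A = ≈-trans (∷-cong refl (shift≈X^* n A)) (≈-trans (≈-sym (X-* _)) (≈-sym (*ᴾ-assoc X (X ^ᴾ n) A)))

  -- X^p has derivative zero and behaves like a constant.
  P-shift : ∀ e A → P e (shift p A) ≈ shift p (P e A)
  P-shift e A = begin
    P e (shift p A) ≈⟨ P-cong e (shift≈X^* p A) ⟩
    P e (Y *ᴾ A) ≈⟨ +ᴾ-cong (≈-refl {c *ᴾ (Y *ᴾ A)}) (*ᴾ-congˡ f (D-* Y A)) ⟩
    c *ᴾ (Y *ᴾ A) +ᴾ f *ᴾ (D Y *ᴾ A +ᴾ Y *ᴾ D A)
      ≈⟨ +ᴾ-cong (≈-refl {c *ᴾ (Y *ᴾ A)}) (*ᴾ-congˡ f (+ᴾ-cong (*ᴾ-cong (D-^p X) (≈-refl {A})) (≈-refl {Y *ᴾ D A}))) ⟩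
    c *ᴾ (Y *ᴾ A) +ᴾ f *ᴾ (Y *ᴾ D A)
      ≈⟨ solve 5 (λ c Y A f a → c :* (Y :* A) :+ f :* (Y :* a) := Y :* (c :* A :+ f :* a)) ≈-refl c Y A f (D A) ⟩
    Y *ᴾ P e A ≈⟨ shift≈X^* p (P e A) ⟨
    shift p (P e A) ∎
    where
    open ≈-Reasoning
    open PSolver
    Y = X ^ᴾ p
    c = const (fromℕ e) *ᴾ D f

  P-[] : ∀ e → P e [] ≈ []
  P-[] e = solve 2 (λ c f → c :* con (+ 0) :+ f :* con (+ 0) := con (+ 0)) ≈-refl (const (fromℕ e) *ᴾ D f) f
    where open PSolver

  P-Φ : ∀ e L → P e (Φ L) ≈ Φ (map (T e) L)
  P-Φ e [] = P-[] e
  P-Φ e ((r , s) ∷ L) = begin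
    P e ((r +ᴾ s *ᴾ g) +ᴾ shift p (Φ L)) ≈⟨ P-+ e (r +ᴾ s *ᴾ g) _ ⟩
    P e (r +ᴾ s *ᴾ g) +ᴾ P e (shift p (Φ L))
      ≈⟨ +ᴾ-cong (≈-trans (P-+ e r (s *ᴾ g)) (+ᴾ-cong (≈-refl {P e r}) (P-*g e s)))
                 (≈-trans (P-shift e (Φ L)) (shift-cong p (P-Φ e L))) ⟩
    (P e r +ᴾ P (e + q) s *ᴾ g) +ᴾ shift p (Φ (map (T e) L)) ∎
    where open ≈-Reasoning

  -- Here `e` is the exponent of f that is left after all k derivatives. The innermost operator
  -- therefore acts with exponent k + e and the outermost one with `suc e`.
  derived : ℕ → ℕ → Family → Family
  derived zero e L = L
  derived (suc k) e L = map (T (suc e)) (derived k (suc e) L)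

  D^-f^-Φ : ∀ k e L → D^ k (f ^ᴾ (k + e) *ᴾ Φ L) ≈ f ^ᴾ e *ᴾ Φ (derived k e L)
  D^-f^-Φ zero e L = ≈-refl
  D^-f^-Φ (suc k) e L = begin
    D (D^ k (f ^ᴾ (suc k + e) *ᴾ Φ L)) ≡⟨ cong (λ n → D (D^ k (f ^ᴾ n *ᴾ Φ L))) (ℕₚ.+-suc k e) ⟨
    D (D^ k (f ^ᴾ (k + suc e) *ᴾ Φ L)) ≈⟨ D-cong (D^-f^-Φ k (suc e) L) ⟩
    D (f ^ᴾ suc e *ᴾ Φ L′) ≈⟨ D-f^-* e (Φ L′) ⟩
    f ^ᴾ e *ᴾ P (suc e) (Φ L′) ≈⟨ *ᴾ-congˡ (f ^ᴾ e) (P-Φ (suc e) L′) ⟩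
    f ^ᴾ e *ᴾ Φ (map (T (suc e)) L′) ∎
    where
    open ≈-Reasoning
    L′ = derived k (suc e) L

  -- The gain of the method: the hypotheses are identities between polynomials of small degree,
  -- hence few conditions on the coefficients, and they do not mention x. They force vanishing to
  -- order M at all points with g(x) = a at once.
  Vanishes-Φ : ∀ {a} M L x → evalᴾ g x ≡ a →
    (∀ k → k < M → reduced a (derived k (M ∸ k) L) ≈ []) → Vanishes M (f ^ᴾ M *ᴾ Φ L) x
  Vanishes-Φ {a} M L x eq zeros k k<M = begin
    evalᴾ (D^ k (f ^ᴾ M *ᴾ Φ L)) x ≡⟨ cong (λ n → evalᴾ (D^ k (f ^ᴾ n *ᴾ Φ L)) x) (ℕₚ.m+[n∸m]≡n (ℕₚ.<⇒≤ k<M)) ⟨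
    evalᴾ (D^ k (f ^ᴾ (k + e) *ᴾ Φ L)) x ≡⟨ eval-cong (D^-f^-Φ k e L) x ⟩
    evalᴾ (f ^ᴾ e *ᴾ Φ (derived k e L)) x ≡⟨ eval-* (f ^ᴾ e) _ x ⟩
    evalᴾ (f ^ᴾ e) x ⊗ evalᴾ (Φ (derived k e L)) x
      ≡⟨ cong (evalᴾ (f ^ᴾ e) x ⊗_) (trans (eval-Φ x eq (derived k e L)) (eval-zero (zeros k k<M) x)) ⟩
    evalᴾ (f ^ᴾ e) x ⊗ 0ᴷ ≡⟨ zeroʳ _ ⟩
    0ᴷ ∎
    where
    open ≡-Reasoning
    e = M ∸ k

  Bounded : ℕ → Family → Set
  Bounded n = All (λ { (r , s) → Deg< n r × Deg< n s })

  module _ {d : ℕ} (f-deg : Deg< (suc d) f) where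

    Deg<-P : ∀ e {n A} → Deg< n A → Deg< (d + n) (P e A)
    Deg<-P e {n} {A} a = Deg<-+
      (Deg<-* (Deg<-* {0} {suc d} (Deg<-const (fromℕ e)) (Deg<-mono (ℕₚ.n≤1+n d) (Deg<-D f-deg))) a)
      (Deg<-* f-deg (Deg<-D (Deg<-mono (ℕₚ.n≤1+n n) a)))

    Bounded-map-T : ∀ e {n} L → Bounded n L → Bounded (d + n) (map (T e) L)
    Bounded-map-T e [] [] = []
    Bounded-map-T e ((r , s) ∷ L) ((br , bs) ∷ b) = (Deg<-P e br , Deg<-P (e + q) bs) ∷ Bounded-map-T e L b

    Bounded-derived : ∀ k e {n} L → Bounded n L → Bounded (k * d + n) (derived k e L)
    Bounded-derived zero e L b = b
    Bounded-derived (suc k) e {n} L b = subst (λ m → Bounded m (derived (suc k) e L)) (sym (ℕₚ.+-assoc d (k * d) n))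
      (Bounded-map-T (suc e) (derived k (suc e) L) (Bounded-derived k (suc e) L b))

    Deg<-Φ : ∀ {n} L → Bounded n L → Deg< (q * d + n + length L * p) (Φ L)
    Deg<-Φ [] _ = Deg<-zero ≈-refl
    Deg<-Φ {n} ((r , s) ∷ L) ((br , bs) ∷ b) = Deg<-+
      (Deg<-+ (Deg<-mono (ℕₚ.≤-trans (ℕₚ.m≤n+m n (q * d)) (ℕₚ.m≤m+n _ _)) br)
        (Deg<-mono (ℕₚ.m≤m+n _ _) (Deg<-cong (*ᴾ-comm g s) (Deg<-* (Deg<-^ q f-deg) bs))))
      (Deg<-mono (ℕₚ.≤-reflexive (trans (ℕₚ.+-comm p _) (trans (ℕₚ.+-assoc (q * d + n) (length L * p) p)
        (cong (λ m → q * d + n + m) (ℕₚ.+-comm (length L * p) p))))) (Deg<-shift p (Deg<-Φ L b)))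

  Deg<-reduced : ∀ a {n} L → Bounded n L → Deg< (n + length L) (reduced a L)
  Deg<-reduced a [] _ = Deg<-zero ≈-refl
  Deg<-reduced a {n} ((r , s) ∷ L) ((br , bs) ∷ b) = Deg<-+
    (Deg<-mono (ℕₚ.m≤m+n n _) (Deg<-+ br (Deg<-scale a bs)))
    (Deg<-mono (ℕₚ.≤-reflexive (sym (ℕₚ.+-suc n (length L)))) (Deg<-∷ (Deg<-reduced a L b)))

  length-derived : ∀ k e L → length (derived k e L) ≡ length L
  length-derived zero e L = refl
  length-derived (suc k) e L = trans (length-map (T (suc e)) (derived k (suc e) L)) (length-derived k (suc e) L)

  -- All the linearity that the pigeonhole argument needs: the first family is the difference of the
  -- other two, entry by entry, and this relation passes through `derived` and `reduced`.
  data Difference : Family → Family → Family → Set where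
    [] : Difference [] [] []
    _∷_ : ∀ {r s r₁ s₁ r₂ s₂ L L₁ L₂} → (r ≈ r₁ +ᴾ -ᴾ r₂) × (s ≈ s₁ +ᴾ -ᴾ s₂) →
      Difference L L₁ L₂ → Difference ((r , s) ∷ L) ((r₁ , s₁) ∷ L₁) ((r₂ , s₂) ∷ L₂)

  -ᴾ-as-scale : ∀ A → -ᴾ A ≈ scale (⊖ 1ᴷ) A
  -ᴾ-as-scale A = coefwise λ k → trans (coef-neg A k) (trans
    (solve 1 (λ a → :- a := (:- con (+ 1)) :* a) refl (coef A k)) (sym (coef-scale (⊖ 1ᴷ) A k)))
    where open Solver

  D-neg : ∀ A → D (-ᴾ A) ≈ -ᴾ D A
  D-neg A = ≈-trans (D-cong (-ᴾ-as-scale A)) (≈-trans (D-scale (⊖ 1ᴷ) A) (≈-sym (-ᴾ-as-scale (D A))))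

  P-difference : ∀ e {A B C} → A ≈ B +ᴾ -ᴾ C → P e A ≈ P e B +ᴾ -ᴾ P e C
  P-difference e {A} {B} {C} eq = begin
    P e A ≈⟨ P-cong e eq ⟩
    P e (B +ᴾ -ᴾ C) ≈⟨ P-+ e B (-ᴾ C) ⟩
    P e B +ᴾ (c *ᴾ (-ᴾ C) +ᴾ f *ᴾ D (-ᴾ C)) ≈⟨ +ᴾ-cong (≈-refl {P e B}) (+ᴾ-cong (≈-refl {c *ᴾ (-ᴾ C)}) (*ᴾ-congˡ f (D-neg C))) ⟩
    P e B +ᴾ (c *ᴾ (-ᴾ C) +ᴾ f *ᴾ (-ᴾ D C))
      ≈⟨ +ᴾ-cong (≈-refl {P e B}) (solve 4 (λ c C f d → c :* (:- C) :+ f :* (:- d) := :- (c :* C :+ f :* d)) ≈-refl c C f (D C)) ⟩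
    P e B +ᴾ -ᴾ P e C ∎
    where
    open ≈-Reasoning
    open PSolver
    c = const (fromℕ e) *ᴾ D f

  Difference-map-T : ∀ e {L L₁ L₂} → Difference L L₁ L₂ → Difference (map (T e) L) (map (T e) L₁) (map (T e) L₂)
  Difference-map-T e [] = []
  Difference-map-T e ((er , es) ∷ δ) = (P-difference e er , P-difference (e + q) es) ∷ Difference-map-T e δ

  Difference-derived : ∀ k e {L L₁ L₂} → Difference L L₁ L₂ → Difference (derived k e L) (derived k e L₁) (derived k e L₂)
  Difference-derived zero e δ = δ
  Difference-derived (suc k) e δ = Difference-map-T (suc e) (Difference-derived k (suc e) δ)

  reduced-difference : ∀ a {L L₁ L₂} → Difference L L₁ L₂ → reduced a L ≈ reduced a L₁ +ᴾ -ᴾ reduced a L₂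
  reduced-difference a [] = ≈-refl
  reduced-difference a {(r , s) ∷ L} {(r₁ , s₁) ∷ L₁} {(r₂ , s₂) ∷ L₂} ((er , es) ∷ δ) = begin
    (r +ᴾ scale a s) +ᴾ (0ᴷ ∷ reduced a L)
      ≈⟨ +ᴾ-cong (+ᴾ-cong er (≈-trans (≈-sym (const-*ᴾ a s)) (*ᴾ-congˡ (const a) es)))
           (≈-trans (∷-cong refl (reduced-difference a δ)) (≈-sym (X-* _))) ⟩
    ((r₁ +ᴾ -ᴾ r₂) +ᴾ const a *ᴾ (s₁ +ᴾ -ᴾ s₂)) +ᴾ X *ᴾ (E₁ +ᴾ -ᴾ E₂)
      ≈⟨ solve 8 (λ r₁ r₂ c s₁ s₂ x e₁ e₂ → ((r₁ :- r₂) :+ c :* (s₁ :- s₂)) :+ x :* (e₁ :- e₂)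
           := ((r₁ :+ c :* s₁) :+ x :* e₁) :- ((r₂ :+ c :* s₂) :+ x :* e₂)) ≈-refl r₁ r₂ (const a) s₁ s₂ X E₁ E₂ ⟩
    ((r₁ +ᴾ const a *ᴾ s₁) +ᴾ X *ᴾ E₁) +ᴾ -ᴾ ((r₂ +ᴾ const a *ᴾ s₂) +ᴾ X *ᴾ E₂)
      ≈⟨ +ᴾ-cong (side r₁ s₁ E₁) (-ᴾ-cong (side r₂ s₂ E₂)) ⟩
    ((r₁ +ᴾ scale a s₁) +ᴾ (0ᴷ ∷ E₁)) +ᴾ -ᴾ ((r₂ +ᴾ scale a s₂) +ᴾ (0ᴷ ∷ E₂)) ∎
    where
    open ≈-Reasoning
    open PSolver
    E₁ = reduced a L₁
    E₂ = reduced a L₂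
    side : ∀ r s E → (r +ᴾ const a *ᴾ s) +ᴾ X *ᴾ E ≈ (r +ᴾ scale a s) +ᴾ (0ᴷ ∷ E)
    side r s E = +ᴾ-cong (+ᴾ-cong (≈-refl {r}) (const-*ᴾ a s)) (X-* E)

  segment : ℕ → ℕ → (ℕ → K) → Pol
  segment zero o v = []
  segment (suc n) o v = v o ∷ segment n (suc o) v

  -- From position `o` on, the vector is cut into blocks of length `B` that serve alternately as r_j
  -- and s_j, so that J pairs consume J (B + B) unknowns.
  family : (B J o : ℕ) → (ℕ → K) → Family
  family B zero o v = []
  family B (suc J) o v = (segment B o v , segment B (B + o) v) ∷ family B J (B + (B + o)) v

  Deg<-segment : ∀ n o v → Deg< n (segment n o v)
  Deg<-segment zero o v = Deg<-zero ≈-refl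
  Deg<-segment (suc n) o v = Deg<-∷ (Deg<-segment n (suc o) v)

  Bounded-family : ∀ B J o v → Bounded B (family B J o v)
  Bounded-family B zero o v = []
  Bounded-family B (suc J) o v = (Deg<-segment B o v , Deg<-segment B (B + o) v) ∷ Bounded-family B J _ v

  length-family : ∀ B J o v → length (family B J o v) ≡ J
  length-family B zero o v = refl
  length-family B (suc J) o v = cong suc (length-family B J _ v)

  segment-difference : ∀ n o v w → segment n o (λ i → v i ⊕ ⊖ w i) ≈ segment n o v +ᴾ -ᴾ segment n o w
  segment-difference zero o v w = ≈-refl
  segment-difference (suc n) o v w = ∷-cong refl (segment-difference n (suc o) v w)

  family-difference : ∀ B J o v w → Difference (family B J o (λ i → v i ⊕ ⊖ w i)) (family B J o v) (family B J o w)
  family-difference B zero o v w = []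
  family-difference B (suc J) o v w = (segment-difference B o v w , segment-difference B (B + o) v w) ∷ family-difference B J _ v w

  AllZero : Family → Set
  AllZero = All (λ { (r , s) → r ≈ [] × s ≈ [] })

  segment-zero : ∀ n o v → segment n o v ≈ [] → ∀ i → i < n → v (o + i) ≡ 0ᴷ
  segment-zero (suc n) o v eq zero _ = trans (cong v (ℕₚ.+-identityʳ o)) (at eq 0)
  segment-zero (suc n) o v eq (suc i) (s≤s i<n) = trans (cong v (ℕₚ.+-suc o i))
    (segment-zero n (suc o) v (coefwise λ k → at eq (suc k)) i i<n)

  family-zero : ∀ B J o v → AllZero (family B J o v) → ∀ i → i < J * (B + B) → v (o + i) ≡ 0ᴷ
  family-zero B (suc J) o v ((zr , zs) ∷ zL) i i<U with i ℕₚ.<? B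
  ... | yes i<B = segment-zero B o v zr i i<B
  ... | no i≮B with ℕₚ.m≤n⇒∃[o]m+o≡n (ℕₚ.≮⇒≥ i≮B)
  ...   | i′ , refl with i′ ℕₚ.<? B
  ...     | yes i′<B = trans (cong v (trans (sym (ℕₚ.+-assoc o B i′)) (cong (_+ i′) (ℕₚ.+-comm o B)))) (segment-zero B (B + o) v zs i′ i′<B)
  ...     | no i′≮B with ℕₚ.m≤n⇒∃[o]m+o≡n (ℕₚ.≮⇒≥ i′≮B)
  ...       | j , refl = trans (cong v reindex) (family-zero B J (B + (B + o)) v zL j
    (ℕₚ.+-cancelˡ-< (B + B) j (J * (B + B)) (subst (_< B + B + J * (B + B)) (sym (ℕₚ.+-assoc B B j)) i<U)))
    where
    reindex : o + (B + (B + j)) ≡ B + (B + o) + j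
    reindex = solve 3 (λ o B j → o :+ (B :+ (B :+ j)) := B :+ (B :+ o) :+ j) refl o B j
      where open Data.Nat.Solver.+-*-Solver

  module _ (a : K) {d B J M : ℕ} (f-deg : Deg< (suc d) f) (enough : M * (M * d + B + J) < J * (B + B)) where
    private
      W = M * d + B + J

      equation : (ℕ → K) → Fin M × Fin W → K
      equation v (k , c) = coef (reduced a (derived (toℕ k) (M ∸ toℕ k) (family B J 0 v))) (toℕ c)

      equations : (ℕ → K) → Fin (M * W) → K
      equations v i = equation v (remQuot {M} W i)

      equations-combine : ∀ v k c → equations v (combine {M} {W} k c) ≡ equation v (k , c)
      equations-combine v k c = cong (equation v) (Finₚ.remQuot-combine {M} {W} k c)

    -- Each of the M conditions is the vanishing of a polynomial with at most `W` coefficients, and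
    -- `enough` says that M W is below the number J (B + B) of unknowns. The family is built from
    -- the difference of two distinct vectors with the same values of `equations`.
    auxiliary-family : Σ Family λ L → Bounded B L × length L ≡ J × ¬ AllZero L ×
      (∀ k → k < M → reduced a (derived k (M ∸ k) L) ≈ [])
    auxiliary-family with pigeonhole-functions enough equations
    ... | v , w , same , v≢w = L , Bounded-family B J 0 u , length-family B J 0 u
      , (λ zeros → v≢w λ n n<U → x⊖y≡0⇒x≡y (family-zero B J 0 u zeros n n<U))
      , λ k k<M → ≈-trans (reduced-difference a (Difference-derived k (M ∸ k) (family-difference B J 0 v w)))
          (A≈B⇒A-B≈0 {reduced a (derived k (M ∸ k) (family B J 0 v))} {reduced a (derived k (M ∸ k) (family B J 0 w))}
            (coefwise (agree k k<M)))
      where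
      u : ℕ → K
      u i = v i ⊕ ⊖ w i
      L = family B J 0 u
      bound : ∀ x k → k < M → Deg< W (reduced a (derived k (M ∸ k) (family B J 0 x)))
      bound x k k<M = Deg<-mono
        (ℕₚ.+-mono-≤ (ℕₚ.+-monoˡ-≤ B (ℕₚ.*-monoˡ-≤ d (ℕₚ.<⇒≤ k<M)))
          (ℕₚ.≤-reflexive (trans (length-derived k (M ∸ k) _) (length-family B J 0 x))))
        (Deg<-reduced a _ (Bounded-derived f-deg k (M ∸ k) _ (Bounded-family B J 0 x)))
      agree : ∀ k → k < M → ∀ c → coef (reduced a (derived k (M ∸ k) (family B J 0 v))) c
        ≡ coef (reduced a (derived k (M ∸ k) (family B J 0 w))) c
      agree k k<M c with c ℕₚ.<? W
      ... | no c≮W = trans (above (bound v k k<M) c (ℕₚ.≮⇒≥ c≮W)) (sym (above (bound w k k<M) c (ℕₚ.≮⇒≥ c≮W)))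
      ... | yes c<W = subst₂ (λ k c → coef (reduced a (derived k (M ∸ k) (family B J 0 v))) c
          ≡ coef (reduced a (derived k (M ∸ k) (family B J 0 w))) c) (Finₚ.toℕ-fromℕ< k<M) (Finₚ.toℕ-fromℕ< c<W)
        (trans (sym (equations-combine v (fromℕ< k<M) (fromℕ< c<W)))
          (trans (same _) (equations-combine w (fromℕ< k<M) (fromℕ< c<W))))

  NonSquare : Set
  NonSquare = ∀ r s c → c ≢ 0ᴷ → r *ᴾ r *ᴾ f ≈ scale c (s *ᴾ s) → r ≈ [] × s ≈ []

  shift-Deg< : ∀ n {A Z} → Deg< n A → A ≈ shift n Z → A ≈ []
  shift-Deg< n {A} {Z} a eq = coefwise λ k → value k
    where
    value : ∀ k → coef A k ≡ 0ᴷ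
    value k with k ℕₚ.<? n
    ... | yes k<n = trans (at eq k) (coef-shift-< n Z k k<n)
    ... | no k≮n = above a k (ℕₚ.≮⇒≥ k≮n)

  shift-zero : ∀ n {A} → shift n A ≈ [] → A ≈ []
  shift-zero n {A} eq = coefwise λ k → trans (sym (coef-shift-+ n A k)) (at eq (n + k))

  -- By `coef-^p` a p-th power has no coefficients strictly between 0 and p, so modulo X^p it is a
  -- constant.
  f^p≈ : f ^ᴾ p ≈ const (coef f 0 ^ᴷ p) +ᴾ shift p (drop p (f ^ᴾ p))
  f^p≈ = coefwise λ k → trans (value k) (sym (coef-+ (const c) (shift p R) k))
    where
    c = coef f 0 ^ᴷ p
    R = drop p (f ^ᴾ p)
    coef-drop : ∀ n A k → coef (drop n A) k ≡ coef A (n + k)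
    coef-drop zero A k = refl
    coef-drop (suc n) [] k = refl
    coef-drop (suc n) (x ∷ A) k = coef-drop n A k
    value : ∀ k → coef (f ^ᴾ p) k ≡ coef (const c) k ⊕ coef (shift p R) k
    value zero = trans (coef-^p-0 f) (sym (trans (cong (c ⊕_) (coef-shift-< p R 0 1≤p)) (+-identityʳ c)))
    value (suc k) with suc k ℕₚ.<? p
    ... | yes k<p = trans (coef-^p f (suc k) (s≤s z≤n) k<p) (sym (trans (+-identityˡ _) (coef-shift-< p R (suc k) k<p)))
    ... | no k≮p with ℕₚ.m≤n⇒∃[o]m+o≡n (ℕₚ.≮⇒≥ k≮p)
    ...   | j , eq = trans (cong (coef (f ^ᴾ p)) (sym eq)) (trans (sym (coef-drop p (f ^ᴾ p) j))
      (trans (sym (coef-shift-+ p R j)) (trans (cong (coef (shift p R)) eq) (sym (+-identityˡ _)))))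

  private
    -- This identity and the next two are solved for variables, so that the solver does not meet the
    -- large terms later substituted for them.
    isolate : ∀ r s g y → r ≈ (r +ᴾ s *ᴾ g +ᴾ y) +ᴾ -ᴾ (s *ᴾ g +ᴾ y)
    isolate = solve 4 (λ r s g y → r := (r :+ s :* g :+ y) :- (s :* g :+ y)) ≈-refl
      where open PSolver

    expand : ∀ s g Y h f c → (-ᴾ (s *ᴾ g +ᴾ Y *ᴾ h)) *ᴾ (-ᴾ (s *ᴾ g +ᴾ Y *ᴾ h)) *ᴾ f +ᴾ -ᴾ (c *ᴾ (s *ᴾ s)) ≈
      s *ᴾ s *ᴾ (f *ᴾ (g *ᴾ g)) +ᴾ Y *ᴾ (f *ᴾ ((s *ᴾ g) *ᴾ h +ᴾ (s *ᴾ g) *ᴾ h +ᴾ Y *ᴾ (h *ᴾ h))) +ᴾ -ᴾ (c *ᴾ (s *ᴾ s))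
    expand = solve 6 (λ s g Y h f c → (:- (s :* g :+ Y :* h)) :* (:- (s :* g :+ Y :* h)) :* f :- c :* (s :* s)
      := s :* s :* (f :* (g :* g)) :+ Y :* (f :* ((s :* g) :* h :+ (s :* g) :* h :+ Y :* (h :* h))) :- c :* (s :* s)) ≈-refl
      where open PSolver

    collect : ∀ s c Y k u → s *ᴾ s *ᴾ (c +ᴾ Y *ᴾ k) +ᴾ Y *ᴾ u +ᴾ -ᴾ (c *ᴾ (s *ᴾ s)) ≈ Y *ᴾ (u +ᴾ s *ᴾ s *ᴾ k)
    collect = solve 5 (λ s c Y k u → s :* s :* (c :+ Y :* k) :+ Y :* u :- c :* (s :* s) := Y :* (u :+ s :* s :* k)) ≈-refl
      where open PSolver

  module _ (p-odd : suc (q + q) ≡ p) {d B : ℕ} (f-deg : Deg< (suc d) f) (small : d + (B + B) ≤ p)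
           (f₀≢0 : coef f 0 ≢ 0ᴷ) (nonSquare : NonSquare) where

    f*g*g : f *ᴾ (g *ᴾ g) ≈ f ^ᴾ p
    f*g*g = ≈-trans (*ᴾ-congˡ f (≈-sym (^ᴾ-+ f q q))) (subst (λ n → f ^ᴾ suc (q + q) ≈ f ^ᴾ n) p-odd ≈-refl)

    -- Modulo X ^ p, r + s g ≡ 0 gives r² f ≡ s² f ^ p ≡ f(0) ^ p s², and both sides have degree below p.
    Φ-nonzero : ∀ L → Bounded B L → Φ L ≈ [] → AllZero L
    Φ-nonzero [] _ _ = []
    Φ-nonzero ((r , s) ∷ L) ((br , bs) ∷ b) eq = (r≈0 , s≈0) ∷ Φ-nonzero L b (shift-zero p (begin
      shift p (Φ L) ≈⟨ +ᴾ-cong (≈-refl {[] +ᴾ [] *ᴾ g}) (≈-refl {shift p (Φ L)}) ⟨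
      ([] +ᴾ [] *ᴾ g) +ᴾ shift p (Φ L) ≈⟨ +ᴾ-cong (+ᴾ-cong r≈0 (*ᴾ-cong s≈0 (≈-refl {g}))) (≈-refl {shift p (Φ L)}) ⟨
      (r +ᴾ s *ᴾ g) +ᴾ shift p (Φ L) ≈⟨ eq ⟩
      [] ∎))
      where
      open ≈-Reasoning
      Y = X ^ᴾ p
      h = Φ L
      c = coef f 0 ^ᴷ p
      k = drop p (f ^ᴾ p)
      Z = f *ᴾ ((s *ᴾ g) *ᴾ h +ᴾ (s *ᴾ g) *ᴾ h +ᴾ Y *ᴾ (h *ᴾ h)) +ᴾ s *ᴾ s *ᴾ k
      r≈ : r ≈ -ᴾ (s *ᴾ g +ᴾ Y *ᴾ h)
      r≈ = begin
        r ≈⟨ isolate r s g (Y *ᴾ h) ⟩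
        (r +ᴾ s *ᴾ g +ᴾ Y *ᴾ h) +ᴾ -ᴾ (s *ᴾ g +ᴾ Y *ᴾ h)
          ≈⟨ +ᴾ-cong (≈-trans (+ᴾ-cong (≈-refl {r +ᴾ s *ᴾ g}) (≈-sym (shift≈X^* p h))) eq) (≈-refl { -ᴾ (s *ᴾ g +ᴾ Y *ᴾ h)}) ⟩
        -ᴾ (s *ᴾ g +ᴾ Y *ᴾ h) ∎
      difference≈ : r *ᴾ r *ᴾ f +ᴾ -ᴾ scale c (s *ᴾ s) ≈ shift p Z
      difference≈ = begin
        r *ᴾ r *ᴾ f +ᴾ -ᴾ scale c (s *ᴾ s)
          ≈⟨ +ᴾ-cong (*ᴾ-cong (*ᴾ-cong r≈ r≈) (≈-refl {f})) (-ᴾ-cong (≈-sym (const-*ᴾ c (s *ᴾ s)))) ⟩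
        (-ᴾ (s *ᴾ g +ᴾ Y *ᴾ h)) *ᴾ (-ᴾ (s *ᴾ g +ᴾ Y *ᴾ h)) *ᴾ f +ᴾ -ᴾ (const c *ᴾ (s *ᴾ s))
          ≈⟨ expand s g Y h f (const c) ⟩
        s *ᴾ s *ᴾ (f *ᴾ (g *ᴾ g)) +ᴾ Y *ᴾ (f *ᴾ ((s *ᴾ g) *ᴾ h +ᴾ (s *ᴾ g) *ᴾ h +ᴾ Y *ᴾ (h *ᴾ h))) +ᴾ -ᴾ (const c *ᴾ (s *ᴾ s))
          ≈⟨ +ᴾ-cong (+ᴾ-cong (*ᴾ-congˡ (s *ᴾ s) (≈-trans f*g*g (≈-trans f^p≈ (+ᴾ-cong (≈-refl {const c}) (shift≈X^* p k)))))
               (≈-refl {Y *ᴾ (f *ᴾ ((s *ᴾ g) *ᴾ h +ᴾ (s *ᴾ g) *ᴾ h +ᴾ Y *ᴾ (h *ᴾ h)))})) (≈-refl { -ᴾ (const c *ᴾ (s *ᴾ s))}) ⟩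
        s *ᴾ s *ᴾ (const c +ᴾ Y *ᴾ k) +ᴾ Y *ᴾ (f *ᴾ ((s *ᴾ g) *ᴾ h +ᴾ (s *ᴾ g) *ᴾ h +ᴾ Y *ᴾ (h *ᴾ h))) +ᴾ -ᴾ (const c *ᴾ (s *ᴾ s))
          ≈⟨ collect s (const c) Y k (f *ᴾ ((s *ᴾ g) *ᴾ h +ᴾ (s *ᴾ g) *ᴾ h +ᴾ Y *ᴾ (h *ᴾ h))) ⟩
        Y *ᴾ Z ≈⟨ shift≈X^* p Z ⟨
        shift p Z ∎
      square-deg : ∀ {A} → Deg< B A → Deg< (B + B) (A *ᴾ A)
      square-deg a = Deg<-* (Deg<-mono (ℕₚ.n≤1+n B) a) a
      difference-deg : Deg< p (r *ᴾ r *ᴾ f +ᴾ -ᴾ scale c (s *ᴾ s))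
      difference-deg = Deg<-+
        (Deg<-mono small (Deg<-cong (*ᴾ-comm f (r *ᴾ r)) (Deg<-* f-deg (square-deg br))))
        (Deg<-neg (Deg<-scale c (Deg<-mono (ℕₚ.≤-trans (ℕₚ.m≤n+m (B + B) d) small) (square-deg bs))))
      both-zero : r ≈ [] × s ≈ []
      both-zero = nonSquare r s c (^ᴷ-≢0 p f₀≢0) (A-B≈0⇒A≈B (shift-Deg< p difference-deg difference≈))
      r≈0 = proj₁ both-zero
      s≈0 = proj₂ both-zero

    f≉0 : ¬ f ≈ []
    f≉0 eq = f₀≢0 (at eq 0)

    f^≉0 : ∀ n → ¬ f ^ᴾ n ≈ []
    f^≉0 zero eq = 1≢0 (at eq 0)
    f^≉0 (suc n) eq = f^≉0 n (*ᴾ-cancelˡ-0 {f} {f ^ᴾ n} f≉0 eq)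

    -- The right-hand side bounds the degree of f^M Φ, which vanishes to order M at every point of
    -- `xs`. With more points it would be zero, then Φ would be, and `Φ-nonzero` would make the
    -- whole family zero.
    stepanov-bound : ∀ {J M} a (xs : List K) → M ≤ p → M * (M * d + B + J) < J * (B + B) →
      Unique xs → All (λ x → evalᴾ f x ^ᴷ q ≡ a) xs → length xs * M < M * d + (q * d + B + J * p)
    stepanov-bound {J} {M} a xs M≤p enough xs! values = ℕₚ.≰⇒> λ large → impossible large (auxiliary-family a f-deg enough)
      where
      impossible : M * d + (q * d + B + J * p) ≤ length xs * M →
        (Σ Family λ L → Bounded B L × length L ≡ J × ¬ AllZero L × (∀ k → k < M → reduced a (derived k (M ∸ k) L) ≈ [])) → ⊥
      impossible large (L , b , refl , L≢0 , zeros) = L≢0 (Φ-nonzero L b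
        (*ᴾ-cancelˡ-0 {f ^ᴾ M} {Φ L} (f^≉0 M) (too-many-roots (f ^ᴾ M *ᴾ Φ L) xs M≤p xs!
          (All.map (λ {x} eq → Vanishes-Φ M L x (trans (eval-^ f q x) eq) zeros) values)
          (Deg<-mono large (Deg<-* {M * d} (Deg<-^ M f-deg) (Deg<-Φ f-deg L b))))))

-- Translates, irreducible factors and products of translates that are not squares.

module Factorization {p : ℕ} (𝔽 : PrimeField p) where
  open PrimeField 𝔽
  open Polynomial 𝔽
  open Roots 𝔽
  open FieldPigeonhole 𝔽

  X+_ : K → Pol
  X+ c = c ∷ 1ᴷ ∷ []

  -- A(X + c)
  translate : K → Pol → Pol
  translate c [] = []
  translate c (a ∷ A) = const a +ᴾ (X+ c) *ᴾ translate c A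

  translate-zero : ∀ c {A} → A ≈ [] → translate c A ≈ []
  translate-zero c {[]} eq = ≈-refl
  translate-zero c {a ∷ A} eq = ≈-trans
    (+ᴾ-cong (const-zero (at eq 0))
      (*ᴾ-congˡ (X+ c) (translate-zero c {A} (coefwise λ k → at eq (suc k)))))
    (*ᴾ-zeroʳ (X+ c))

  translate-cong : ∀ c {A B} → A ≈ B → translate c A ≈ translate c B
  translate-cong c {[]} {B} eq = ≈-sym (translate-zero c (≈-sym eq))
  translate-cong c {a ∷ A} {[]} eq = translate-zero c eq
  translate-cong c {a ∷ A} {b ∷ B} eq =
    +ᴾ-cong (const-cong (at eq 0)) (*ᴾ-congˡ (X+ c) (translate-cong c (tail-cong eq)))

  translate-+ : ∀ c A B → translate c (A +ᴾ B) ≈ translate c A +ᴾ translate c B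
  translate-+ c [] B = ≈-refl
  translate-+ c (a ∷ A) [] = ≈-sym (+ᴾ-identityʳ _)
  translate-+ c (a ∷ A) (b ∷ B) = ≈-trans
    (+ᴾ-cong (≈-refl {const a +ᴾ const b}) (*ᴾ-congˡ (X+ c) (translate-+ c A B)))
    (solve 5 (λ a b l u v → (a :+ b) :+ l :* (u :+ v) := (a :+ l :* u) :+ (b :+ l :* v)) ≈-refl
      (const a) (const b) (X+ c) (translate c A) (translate c B))
    where open PSolver

  const-⊗ : ∀ a b → const (a ⊗ b) ≈ const a *ᴾ const b
  const-⊗ a b = ≈-sym (const-*ᴾ a (const b))

  translate-scale : ∀ c a B → translate c (scale a B) ≈ const a *ᴾ translate c B
  translate-scale c a [] = ≈-sym (*ᴾ-zeroʳ (const a))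
  translate-scale c a (b ∷ B) = ≈-trans
    (+ᴾ-cong (const-⊗ a b) (*ᴾ-congˡ (X+ c) (translate-scale c a B)))
    (solve 4 (λ a b l u → a :* b :+ l :* (a :* u) := a :* (b :+ l :* u)) ≈-refl (const a) (const b) (X+ c) (translate c B))
    where open PSolver

  translate-0∷ : ∀ c A → translate c (0ᴷ ∷ A) ≈ (X+ c) *ᴾ translate c A
  translate-0∷ c A = +ᴾ-cong 0∷[]≈[] (≈-refl {(X+ c) *ᴾ translate c A})

  translate-* : ∀ c A B → translate c (A *ᴾ B) ≈ translate c A *ᴾ translate c B
  translate-* c [] B = ≈-refl
  translate-* c (a ∷ A) B = begin
    translate c (scale a B +ᴾ (0ᴷ ∷ A *ᴾ B)) ≈⟨ translate-+ c (scale a B) (0ᴷ ∷ A *ᴾ B) ⟩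
    translate c (scale a B) +ᴾ translate c (0ᴷ ∷ A *ᴾ B)
      ≈⟨ +ᴾ-cong (translate-scale c a B) (≈-trans (translate-0∷ c (A *ᴾ B)) (*ᴾ-congˡ (X+ c) (translate-* c A B))) ⟩
    const a *ᴾ translate c B +ᴾ (X+ c) *ᴾ (translate c A *ᴾ translate c B)
      ≈⟨ solve 4 (λ a u l v → a :* u :+ l :* (v :* u) := (a :+ l :* v) :* u) ≈-refl (const a) (translate c B) (X+ c) (translate c A) ⟩
    (const a +ᴾ (X+ c) *ᴾ translate c A) *ᴾ translate c B ∎
    where open ≈-Reasoning
          open PSolver

  translate-const : ∀ c a → translate c (const a) ≈ const a
  translate-const c a = ≈-trans (+ᴾ-cong (≈-refl {const a}) (*ᴾ-zeroʳ (X+ c))) (+ᴾ-identityʳ (const a))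

  translate-X+ : ∀ c d → translate c (X+ d) ≈ X+ (d ⊕ c)
  translate-X+ c d = ≈-trans
    (+ᴾ-cong (≈-refl {const d}) (≈-trans (*ᴾ-congˡ (X+ c) (translate-const c 1ᴷ)) (≈-trans (*ᴾ-comm (X+ c) 1ᴾ) (*ᴾ-identityˡ (X+ c)))))
    ≈-refl

  translate-translate : ∀ c d A → translate c (translate d A) ≈ translate (d ⊕ c) A
  translate-translate c d [] = ≈-refl
  translate-translate c d (a ∷ A) = ≈-trans (translate-+ c (const a) ((X+ d) *ᴾ translate d A))
    (+ᴾ-cong (translate-const c a) (≈-trans (translate-* c (X+ d) (translate d A))
      (*ᴾ-cong (translate-X+ c d) (translate-translate c d A))))

  translate-0 : ∀ A → translate 0ᴷ A ≈ A
  translate-0 [] = ≈-refl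
  translate-0 (a ∷ A) = ≈-trans
    (+ᴾ-cong (≈-refl {const a}) (≈-trans (0∷-*ᴾ 1ᴾ (translate 0ᴷ A)) (∷-cong refl (≈-trans (*ᴾ-identityˡ _) (translate-0 A)))))
    (∷-cong (+-identityʳ a) ≈-refl)

  translate-inverse : ∀ c A → translate (⊖ c) (translate c A) ≈ A
  translate-inverse c A = ≈-trans (translate-translate (⊖ c) c A)
    (subst (λ z → translate z A ≈ A) (sym (-‿inverseʳ c)) (translate-0 A))

  eval-translate : ∀ c A x → evalᴾ (translate c A) x ≡ evalᴾ A (x ⊕ c)
  eval-translate c [] x = refl
  eval-translate c (a ∷ A) x = begin′
    evalᴾ (const a +ᴾ (X+ c) *ᴾ translate c A) x ≡⟨ eval-+ (const a) ((X+ c) *ᴾ translate c A) x ⟩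
    evalᴾ (const a) x ⊕ evalᴾ ((X+ c) *ᴾ translate c A) x ≡⟨ cong₂ _⊕_ (eval-const a x) (eval-* (X+ c) (translate c A) x) ⟩
    a ⊕ (c ⊕ x ⊗ (1ᴷ ⊕ x ⊗ 0ᴷ)) ⊗ evalᴾ (translate c A) x ≡⟨ cong (λ u → a ⊕ (c ⊕ x ⊗ (1ᴷ ⊕ x ⊗ 0ᴷ)) ⊗ u) (eval-translate c A x) ⟩
    a ⊕ (c ⊕ x ⊗ (1ᴷ ⊕ x ⊗ 0ᴷ)) ⊗ evalᴾ A (x ⊕ c)
      ≡⟨ solve 4 (λ a c x u → a :+ (c :+ x :* (con (+ 1) :+ x :* con (+ 0))) :* u := a :+ (x :+ c) :* u) refl a c x _ ⟩
    a ⊕ (x ⊕ c) ⊗ evalᴾ A (x ⊕ c) ∎′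
    where open ≡-Reasoning renaming (begin_ to begin′_; _∎ to _∎′)
          open Solver

  Deg<-translate : ∀ c {n A} → Deg< n A → Deg< n (translate c A)
  Deg<-translate c {n} {[]} a = Deg<-zero ≈-refl
  Deg<-translate c {zero} {x ∷ A} a = Deg<-zero (translate-zero c (Deg<0 a))
  Deg<-translate c {suc n} {x ∷ A} a = Deg<-+ (Deg<-mono (s≤s z≤n) (Deg<-const x))
    (Deg<-* {1} (Deg<-∷ (Deg<-∷ (Deg<-zero ≈-refl))) (Deg<-translate c (Deg<-tail a)))

  Deg<-untranslate : ∀ c {n A} → Deg< n (translate c A) → Deg< n A
  Deg<-untranslate c {n} {A} a = Deg<-cong (translate-inverse c A) (Deg<-translate (⊖ c) a)

  -- Translation does not raise the degree, and neither does its inverse.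
  HasDeg-translate : ∀ c {n A} → HasDeg n A → HasDeg n (translate c A)
  HasDeg-translate c {n} {A} h with zero-or-degree (translate c A)
  ... | inj₁ eq = contradiction (≈-trans (≈-sym (translate-inverse c A)) (translate-zero (⊖ c) eq)) (HasDeg⇒≉0 h)
  ... | inj₂ (m , h′) with ℕₚ.≤-antisym (ℕ.s≤s⁻¹ (HasDeg-< h′ (Deg<-translate c (bounded h))))
                           (ℕ.s≤s⁻¹ (HasDeg-< h (Deg<-untranslate c (bounded h′))))
  ...   | refl = h′

  infix 4 _∣ᴾ_
  record _∣ᴾ_ (A B : Pol) : Set where
    constructor dividesᴾ
    field
      cofactor : Pol
      product≈ : A *ᴾ cofactor ≈ B
  open _∣ᴾ_

  ∣-cong : ∀ {A A′ B B′} → A ≈ A′ → B ≈ B′ → A ∣ᴾ B → A′ ∣ᴾ B′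
  ∣-cong eqA eqB (dividesᴾ Q eq) = dividesᴾ Q (≈-trans (*ᴾ-cong (≈-sym eqA) (≈-refl {Q})) (≈-trans eq eqB))

  ∣-*ʳ : ∀ {A B} C → A ∣ᴾ B → A ∣ᴾ B *ᴾ C
  ∣-*ʳ {A} C (dividesᴾ Q eq) = dividesᴾ (Q *ᴾ C) (≈-trans (≈-sym (*ᴾ-assoc A Q C)) (*ᴾ-cong eq (≈-refl {C})))

  ∣-*ˡ : ∀ {A B} C → A ∣ᴾ B → A ∣ᴾ C *ᴾ B
  ∣-*ˡ {A} {B} C d = ∣-cong ≈-refl (*ᴾ-comm B C) (∣-*ʳ C d)

  ∣-- : ∀ {A B C} → A ∣ᴾ B → A ∣ᴾ C → A ∣ᴾ B +ᴾ -ᴾ C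
  ∣-- {A} (dividesᴾ Q eq) (dividesᴾ R eq′) = dividesᴾ (Q +ᴾ -ᴾ R)
    (≈-trans (solve 3 (λ A Q R → A :* (Q :- R) := A :* Q :- A :* R) ≈-refl A Q R) (+ᴾ-cong eq (-ᴾ-cong eq′)))
    where open PSolver

  ∣-translate : ∀ c {A B} → A ∣ᴾ B → translate c A ∣ᴾ translate c B
  ∣-translate c {A} (dividesᴾ Q eq) = dividesᴾ (translate c Q) (≈-trans (≈-sym (translate-* c A Q)) (translate-cong c eq))

  ∣-scale⁻¹ : ∀ {u A B} → u ≢ 0ᴷ → A ∣ᴾ scale u B → A ∣ᴾ B
  ∣-scale⁻¹ {u} {A} {B} u≢0 d with inverse u u≢0
  ... | v , uv≡1 = ∣-cong ≈-refl
    (≈-trans (const-*ᴾ v (scale u B)) (≈-trans (≈-sym (scale-⊗ v u B))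
      (subst (λ w → scale w B ≈ B) (sym (trans (*-comm v u) uv≡1)) (scale-1 B))))
    (∣-*ˡ (const v) d)

  ∣-small : ∀ {n A B} → HasDeg n A → Deg< n B → A ∣ᴾ B → B ≈ []
  ∣-small {n} {A} {B} a b (dividesᴾ Q eq) with zero-or-degree Q
  ... | inj₁ Q≈0 = ≈-trans (≈-sym eq) (≈-trans (*ᴾ-congˡ A Q≈0) (*ᴾ-zeroʳ A))
  ... | inj₂ (m , q) = contradiction (ℕₚ.m≤m+n n m) (ℕₚ.<⇒≱ (HasDeg-< (HasDeg-cong eq (HasDeg-* a q)) b))

  -- Recursion on the list: X times the division of the tail, plus `a`, leaves a remainder of degree
  -- at most n, and one multiple of B removes its n-th coefficient.
  division : ∀ {n B} → HasDeg n B → ∀ A → ∃₂ λ Q R → A ≈ B *ᴾ Q +ᴾ R × Deg< n R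
  division {n} {B} b [] = [] , [] , ≈-sym (≈-trans (+ᴾ-identityʳ _) (*ᴾ-zeroʳ B)) , Deg<-zero ≈-refl
  division {n} {B} b (a ∷ A) with division b A | inverse (coef B n) (leading≢0 b)
  ... | Q , R , eq , r | u , lead*u≡1 = (0ᴷ ∷ Q) +ᴾ const c , (a ∷ R) +ᴾ -ᴾ scale c B , eq′ , deg< small
    where
    c = coef (a ∷ R) n ⊗ u
    eq′ : a ∷ A ≈ B *ᴾ ((0ᴷ ∷ Q) +ᴾ const c) +ᴾ ((a ∷ R) +ᴾ -ᴾ scale c B)
    eq′ = begin
      a ∷ A ≈⟨ ∷-cong (sym (+-identityˡ a)) eq ⟩
      (0ᴷ ∷ B *ᴾ Q) +ᴾ (a ∷ R)
        ≈⟨ +ᴾ-cong (≈-trans (∷-cong refl (*ᴾ-comm B Q)) (≈-trans (≈-sym (0∷-*ᴾ Q B)) (*ᴾ-comm (0ᴷ ∷ Q) B))) (≈-refl {a ∷ R}) ⟩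
      B *ᴾ (0ᴷ ∷ Q) +ᴾ (a ∷ R)
        ≈⟨ solve 4 (λ B q r c → B :* q :+ r := B :* (q :+ c) :+ (r :- c :* B)) ≈-refl B (0ᴷ ∷ Q) (a ∷ R) (const c) ⟩
      B *ᴾ ((0ᴷ ∷ Q) +ᴾ const c) +ᴾ ((a ∷ R) +ᴾ -ᴾ (const c *ᴾ B))
        ≈⟨ +ᴾ-cong (≈-refl {B *ᴾ ((0ᴷ ∷ Q) +ᴾ const c)}) (+ᴾ-cong (≈-refl {a ∷ R}) (-ᴾ-cong (const-*ᴾ c B))) ⟩
      B *ᴾ ((0ᴷ ∷ Q) +ᴾ const c) +ᴾ ((a ∷ R) +ᴾ -ᴾ scale c B) ∎
      where open ≈-Reasoning
            open PSolver
    small : ∀ k → n ≤ k → coef ((a ∷ R) +ᴾ -ᴾ scale c B) k ≡ 0ᴷ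
    small k n≤k with ℕₚ.m≤n⇒m<n∨m≡n n≤k
    ... | inj₁ n<k = above (Deg<-+ (Deg<-∷ r) (Deg<-neg (Deg<-scale c (bounded b)))) k n<k
    ... | inj₂ refl = begin′
      coef ((a ∷ R) +ᴾ -ᴾ scale c B) n ≡⟨ coef-+ (a ∷ R) (-ᴾ scale c B) n ⟩
      coef (a ∷ R) n ⊕ coef (-ᴾ scale c B) n
        ≡⟨ cong (coef (a ∷ R) n ⊕_) (trans (coef-neg (scale c B) n) (cong ⊖_ (coef-scale c B n))) ⟩
      coef (a ∷ R) n ⊕ ⊖ (coef (a ∷ R) n ⊗ u ⊗ coef B n)
        ≡⟨ solve 3 (λ z u l → z :- z :* u :* l := z :- z :* (l :* u)) refl (coef (a ∷ R) n) u (coef B n) ⟩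
      coef (a ∷ R) n ⊕ ⊖ (coef (a ∷ R) n ⊗ (coef B n ⊗ u))
        ≡⟨ cong (λ w → coef (a ∷ R) n ⊕ ⊖ (coef (a ∷ R) n ⊗ w)) lead*u≡1 ⟩
      coef (a ∷ R) n ⊕ ⊖ (coef (a ∷ R) n ⊗ 1ᴷ)
        ≡⟨ solve 1 (λ z → z :- z :* con (+ 1) := con (+ 0)) refl (coef (a ∷ R) n) ⟩
      0ᴷ ∎′
      where open ≡-Reasoning renaming (begin_ to begin′_; _∎ to _∎′)
            open Solver

  zero? : ∀ A → Dec (A ≈ [])
  zero? A with zero-or-degree A
  ... | inj₁ A≈0 = yes A≈0
  ... | inj₂ (_ , h) = no (HasDeg⇒≉0 h)

  constant-or-degree : ∀ A → Deg< 1 A ⊎ ∃ λ n → HasDeg (suc n) A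
  constant-or-degree A with zero-or-degree A
  ... | inj₁ A≈0 = inj₁ (Deg<-zero A≈0)
  ... | inj₂ (zero , h) = inj₁ (bounded h)
  ... | inj₂ (suc n , h) = inj₂ (n , h)

  HasDeg-suc⇒¬constant : ∀ {n A} → HasDeg (suc n) A → ¬ Deg< 1 A
  HasDeg-suc⇒¬constant h a with HasDeg-< h a
  ... | s≤s ()

  constant≈ : ∀ {A} → Deg< 1 A → A ≈ const (coef A 0)
  constant≈ a = coefwise λ { zero → refl ; (suc k) → above a (suc k) (s≤s z≤n) }

  record Irreducible (π : Pol) : Set where
    field
      nonconstant : ¬ Deg< 1 π
      split : ∀ G H → π ≈ G *ᴾ H → Deg< 1 G ⊎ Deg< 1 H
  open Irreducible

  irreducible-degree : ∀ {π} → Irreducible π → ∃ λ n → HasDeg (suc n) π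
  irreducible-degree {π} irr with constant-or-degree π
  ... | inj₁ c = contradiction c (nonconstant irr)
  ... | inj₂ h = h

  translate-irreducible : ∀ c {π} → Irreducible π → Irreducible (translate c π)
  translate-irreducible c {π} irr = record
    { nonconstant = λ a → nonconstant irr (Deg<-untranslate c a)
    ; split = λ G H eq → [ (λ a → inj₁ (Deg<-untranslate (⊖ c) a)) , (λ a → inj₂ (Deg<-untranslate (⊖ c) a)) ]′
        (split irr (translate (⊖ c) G) (translate (⊖ c) H)
          (≈-trans (≈-sym (translate-inverse c π)) (≈-trans (translate-cong (⊖ c) eq) (translate-* (⊖ c) G H)))) }

  ∣? : ∀ {π} → Irreducible π → ∀ A → Dec (π ∣ᴾ A)
  ∣? {π} irr A with irreducible-degree irr
  ... | n , h with division h A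
  ...   | Q , R , eq , r with zero? R
  ...     | yes R≈0 = yes (dividesᴾ Q (≈-sym (≈-trans eq (≈-trans (+ᴾ-cong (≈-refl {π *ᴾ Q}) R≈0) (+ᴾ-identityʳ _)))))
  ...     | no R≉0 = no λ d → R≉0 (∣-small h r (∣-cong ≈-refl
    (≈-trans (+ᴾ-cong eq ≈-refl) (solve 2 (λ u r → (u :+ r) :- u := r) ≈-refl (π *ᴾ Q) R)) (∣-- d (dividesᴾ Q ≈-refl))))
    where open PSolver

  -- Descent on the degree of R, replacing R by π mod R.
  small-prime : ∀ {π n} → Irreducible π → HasDeg n π → ∀ m R B → Deg< m R → m ≤ n → ¬ R ≈ [] → π ∣ᴾ R *ᴾ B → π ∣ᴾ B
  small-prime irr h zero R B r _ R≉0 _ = contradiction (Deg<0 r) R≉0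
  small-prime {π} {n} irr h (suc m) R B r m<n R≉0 π∣RB with zero-or-degree R
  ... | inj₁ R≈0 = contradiction R≈0 R≉0
  ... | inj₂ (k , hR) with division hR π
  ...   | Q , R′ , eq , r′ with zero? R′
  ...     | no R′≉0 = small-prime irr h m R′ B (Deg<-mono (ℕ.s≤s⁻¹ (HasDeg-< hR r)) r′) (ℕₚ.<⇒≤ m<n) R′≉0
    (∣-cong ≈-refl (≈-trans (+ᴾ-cong (≈-trans (*ᴾ-comm B π) (*ᴾ-cong eq (≈-refl {B}))) (≈-refl { -ᴾ (Q *ᴾ (R *ᴾ B))}))
        (solve 4 (λ R Q r B → (R :* Q :+ r) :* B :- Q :* (R :* B) := r :* B) ≈-refl R Q R′ B))
      (∣-- (∣-*ˡ B (dividesᴾ 1ᴾ (≈-trans (*ᴾ-comm π 1ᴾ) (*ᴾ-identityˡ π)))) (∣-*ˡ Q π∣RB)))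
    where open PSolver
  ...     | yes R′≈0 with split irr R Q (≈-trans eq (≈-trans (+ᴾ-cong (≈-refl {R *ᴾ Q}) R′≈0) (+ᴾ-identityʳ _)))
  ...       | inj₁ cR = ∣-scale⁻¹ {coef R 0} (λ eq₀ → R≉0 (≈-trans (constant≈ cR) (const-zero eq₀)))
    (∣-cong ≈-refl (≈-trans (*ᴾ-cong (constant≈ cR) (≈-refl {B})) (const-*ᴾ _ B)) π∣RB)
  ...       | inj₂ cQ = contradiction
    (HasDeg-< h (Deg<-cong (≈-sym (≈-trans eq (≈-trans (+ᴾ-cong (≈-refl {R *ᴾ Q}) R′≈0) (+ᴾ-identityʳ _)))) (Deg<-* (bounded hR) cQ)))
    (ℕₚ.≤⇒≯ (ℕₚ.≤-trans (ℕₚ.≤-reflexive (ℕₚ.+-comm k 1)) (ℕₚ.<-≤-trans (HasDeg-< hR r) m<n)))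

  euclid : ∀ {π} → Irreducible π → ∀ A B → π ∣ᴾ A *ᴾ B → π ∣ᴾ A ⊎ π ∣ᴾ B
  euclid {π} irr A B π∣AB with irreducible-degree irr
  ... | n , h with division h A
  ...   | Q , R , eq , r with zero? R
  ...     | yes R≈0 = inj₁ (dividesᴾ Q (≈-sym (≈-trans eq (≈-trans (+ᴾ-cong (≈-refl {π *ᴾ Q}) R≈0) (+ᴾ-identityʳ _)))))
  ...     | no R≉0 = inj₂ (small-prime irr h (suc n) R B r ℕₚ.≤-refl R≉0
    (∣-cong ≈-refl (≈-trans (+ᴾ-cong (*ᴾ-cong eq (≈-refl {B})) (≈-refl { -ᴾ (π *ᴾ (Q *ᴾ B))}))
        (solve 4 (λ π Q r B → (π :* Q :+ r) :* B :- π :* (Q :* B) := r :* B) ≈-refl π Q R B))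
      (∣-- π∣AB (dividesᴾ (Q *ᴾ B) ≈-refl))))
    where open PSolver

  -- Whether a polynomial splits is not decided here, hence the double negation: if F has no
  -- irreducible factor, then F itself is irreducible, because a splitting would have such a factor
  -- in its first part, of smaller degree.
  irreducible-factor : ∀ n F → Deg< (suc n) F → ¬ Deg< 1 F → ¬ ¬ Σ Pol λ π → Irreducible π × π ∣ᴾ F
  irreducible-factor zero F f nc _ = nc f
  irreducible-factor (suc n) F f nc none = none (F , record { nonconstant = nc ; split = split′ }
      , dividesᴾ 1ᴾ (≈-trans (*ᴾ-comm F 1ᴾ) (*ᴾ-identityˡ F)))
    where
    split′ : ∀ G H → F ≈ G *ᴾ H → Deg< 1 G ⊎ Deg< 1 H
    split′ G H eq with constant-or-degree G | constant-or-degree H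
    ... | inj₁ c | _ = inj₁ c
    ... | inj₂ _ | inj₁ c = inj₂ c
    ... | inj₂ (a , g) | inj₂ (b , h) = ⊥-elim (irreducible-factor n G
      (Deg<-mono (ℕₚ.≤-trans (s≤s (s≤s (ℕₚ.m≤m+n a b)))
        (ℕₚ.≤-trans (ℕₚ.≤-reflexive (cong suc (sym (ℕₚ.+-suc a b)))) (ℕ.s≤s⁻¹ (HasDeg-< (HasDeg-cong (≈-sym eq) (HasDeg-* g h)) f)))) (bounded g))
      (HasDeg-suc⇒¬constant g)
      λ { (π , irr , π∣G) → none (π , irr , ∣-cong ≈-refl (≈-sym eq) (∣-*ʳ H π∣G)) })

  elements : List K
  elements = tabulate {n = p} (λ i → fromℕ (toℕ i))

  elements-unique : Unique elements
  elements-unique = Uniqueₚ.tabulate⁺ λ {i} {j} eq → Finₚ.toℕ-injective (fromℕ-injective (Finₚ.toℕ<n i) (Finₚ.toℕ<n j) eq)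

  everywhere-zero : ∀ A → Deg< p A → (∀ x → evalᴾ A x ≡ 0ᴷ) → A ≈ []
  everywhere-zero A a v = too-many-simple-roots A elements elements-unique (Allₚ.tabulate⁺ λ _ → v _)
    (subst (λ n → Deg< n A) (sym (length-tabulate {n = p} (λ i → fromℕ (toℕ i)))) a)

  -- If ρ(X) = u ρ(X + c), then ρ is constant on the multiples of c, hence on the whole field.
  translate-∤ : ∀ {n ρ} → HasDeg (suc n) ρ → suc n < p → ∀ c → c ≢ 0ᴷ → ¬ translate c ρ ∣ᴾ ρ
  translate-∤ {n} {ρ} h n<p c c≢0 (dividesᴾ U eq) = HasDeg-suc⇒¬constant h
    (Deg<-cong (≈-sym ρ≈const) (Deg<-const (evalᴾ ρ 0ᴷ)))
    where
    open ≡-Reasoning renaming (begin_ to begin′_; _∎ to _∎′)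
    U-constant : Deg< 1 U
    U-constant with zero-or-degree U
    ... | inj₁ U≈0 = Deg<-zero U≈0
    ... | inj₂ (m , u) = Deg<-mono (ℕₚ.≤-reflexive (cong suc (ℕₚ.+-cancelˡ-≡ (suc n) m 0
      (trans (HasDeg-unique (HasDeg-cong eq (HasDeg-* (HasDeg-translate c h) u)) h) (sym (ℕₚ.+-identityʳ (suc n))))))) (bounded u)
    u = coef U 0
    step : ∀ x → evalᴾ ρ x ≡ u ⊗ evalᴾ ρ (x ⊕ c)
    step x = begin′
      evalᴾ ρ x ≡⟨ eval-cong eq x ⟨
      evalᴾ (translate c ρ *ᴾ U) x ≡⟨ eval-* (translate c ρ) U x ⟩
      evalᴾ (translate c ρ) x ⊗ evalᴾ U x
        ≡⟨ cong₂ _⊗_ (eval-translate c ρ x) (trans (eval-cong (constant≈ U-constant) x) (eval-const u x)) ⟩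
      evalᴾ ρ (x ⊕ c) ⊗ u ≡⟨ *-comm _ _ ⟩
      u ⊗ evalᴾ ρ (x ⊕ c) ∎′
    steps : ∀ i → evalᴾ ρ 0ᴷ ≡ u ^ᴷ i ⊗ evalᴾ ρ (fromℕ i ⊗ c)
    steps zero = trans (cong (evalᴾ ρ) (sym (trans (cong (_⊗ c) fromℕ-0) (zeroˡ c)))) (sym (*-identityˡ _))
    steps (suc i) = begin′
      evalᴾ ρ 0ᴷ ≡⟨ steps i ⟩
      u ^ᴷ i ⊗ evalᴾ ρ (fromℕ i ⊗ c) ≡⟨ cong (u ^ᴷ i ⊗_) (step _) ⟩
      u ^ᴷ i ⊗ (u ⊗ evalᴾ ρ (fromℕ i ⊗ c ⊕ c)) ≡⟨ solve 3 (λ a b d → a :* (b :* d) := (b :* a) :* d) refl (u ^ᴷ i) u _ ⟩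
      u ⊗ u ^ᴷ i ⊗ evalᴾ ρ (fromℕ i ⊗ c ⊕ c) ≡⟨ cong (λ x → u ⊗ u ^ᴷ i ⊗ evalᴾ ρ x) next ⟩
      u ^ᴷ suc i ⊗ evalᴾ ρ (fromℕ (suc i) ⊗ c) ∎′
      where
      open Solver
      next : fromℕ i ⊗ c ⊕ c ≡ fromℕ (suc i) ⊗ c
      next = begin′
        fromℕ i ⊗ c ⊕ c ≡⟨ solve 2 (λ i c → i :* c :+ c := (con (+ 1) :+ i) :* c) refl (fromℕ i) c ⟩
        (1ᴷ ⊕ fromℕ i) ⊗ c ≡⟨ cong (_⊗ c) (fromℕ-suc i) ⟩
        fromℕ (suc i) ⊗ c ∎′
    u≢0 : u ≢ 0ᴷ
    u≢0 u≡0 = HasDeg⇒≉0 h (≈-trans (≈-sym eq) (≈-trans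
      (*ᴾ-congˡ (translate c ρ) (≈-trans (constant≈ U-constant) (const-zero u≡0)))
      (*ᴾ-zeroʳ (translate c ρ))))
    -- After p steps of length c the argument is 0 again, and u^p = u by Fermat. So u = 1 unless
    -- ρ(0) = 0; in that case ρ vanishes at every multiple of c, because u ≠ 0.
    u^p : evalᴾ ρ 0ᴷ ≡ u ⊗ evalᴾ ρ 0ᴷ
    u^p = trans (steps p) (cong₂ _⊗_ (fermat u) (cong (evalᴾ ρ) (trans (cong (_⊗ c) fromℕ-p) (zeroˡ c))))
    c⁻¹ = proj₁ (inverse c c≢0)
    multiple : ∀ y → y ≡ fromℕ (repr (y ⊗ c⁻¹)) ⊗ c
    multiple y = begin′
      y ≡⟨ *-identityʳ y ⟨
      y ⊗ 1ᴷ ≡⟨ cong (y ⊗_) (proj₂ (inverse c c≢0)) ⟨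
      y ⊗ (c ⊗ c⁻¹) ≡⟨ solve 3 (λ y c d → y :* (c :* d) := (y :* d) :* c) refl y c c⁻¹ ⟩
      y ⊗ c⁻¹ ⊗ c ≡⟨ cong (_⊗ c) (fromℕ-toFin (y ⊗ c⁻¹)) ⟨
      fromℕ (repr (y ⊗ c⁻¹)) ⊗ c ∎′
      where open Solver
    power≡1 : evalᴾ ρ 0ᴷ ≢ 0ᴷ → ∀ i → u ^ᴷ i ≡ 1ᴷ
    power≡1 ρ₀≢0 i = trans (cong (_^ᴷ i) u≡1) (1^ i)
      where
      u≡1 : u ≡ 1ᴷ
      u≡1 = ⊗-cancelˡ ρ₀≢0 (trans (*-comm _ u) (trans (sym u^p) (sym (*-identityʳ _))))
    value-at-multiple : Dec (evalᴾ ρ 0ᴷ ≡ 0ᴷ) → ∀ i → evalᴾ ρ (fromℕ i ⊗ c) ≡ evalᴾ ρ 0ᴷ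
    value-at-multiple (no ρ₀≢0) i =
      sym (trans (steps i) (trans (cong (_⊗ evalᴾ ρ (fromℕ i ⊗ c)) (power≡1 ρ₀≢0 i)) (*-identityˡ _)))
    value-at-multiple (yes ρ₀≡0) i = [ (λ z → contradiction z (^ᴷ-≢0 i u≢0)) , (λ z → trans z (sym ρ₀≡0)) ]′
      (x⊗y≡0 (u ^ᴷ i) (evalᴾ ρ (fromℕ i ⊗ c)) (trans (sym (steps i)) ρ₀≡0))
    value : ∀ y → evalᴾ ρ y ≡ evalᴾ ρ 0ᴷ
    value y = trans (cong (evalᴾ ρ) (multiple y)) (value-at-multiple (evalᴾ ρ 0ᴷ ≟ᴷ 0ᴷ) _)
    ρ≈const : ρ ≈ const (evalᴾ ρ 0ᴷ)
    ρ≈const = A-B≈0⇒A≈B (everywhere-zero (ρ +ᴾ -ᴾ const (evalᴾ ρ 0ᴷ))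
      (Deg<-+ (Deg<-mono n<p (bounded h)) (Deg<-neg (Deg<-mono 1≤p (Deg<-const _))))
      λ x → begin′
        evalᴾ (ρ +ᴾ -ᴾ const (evalᴾ ρ 0ᴷ)) x ≡⟨ eval-+ ρ _ x ⟩
        evalᴾ ρ x ⊕ evalᴾ (-ᴾ const (evalᴾ ρ 0ᴷ)) x ≡⟨ cong (evalᴾ ρ x ⊕_) (trans (eval-neg (const (evalᴾ ρ 0ᴷ)) x) (cong ⊖_ (eval-const _ x))) ⟩
        evalᴾ ρ x ⊕ ⊖ evalᴾ ρ 0ᴷ ≡⟨ cong (_⊕ ⊖ evalᴾ ρ 0ᴷ) (value x) ⟩
        evalᴾ ρ 0ᴷ ⊕ ⊖ evalᴾ ρ 0ᴷ ≡⟨ -‿inverseʳ _ ⟩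
        0ᴷ ∎′)

  _⟨_⟩ : Pol → ℕ → Pol
  A ⟨ i ⟩ = translate (fromℕ i) A

  ⟨⟩-⟨⟩ : ∀ A i j → (A ⟨ i ⟩) ⟨ j ⟩ ≈ A ⟨ i + j ⟩
  ⟨⟩-⟨⟩ A i j = ≈-trans (translate-translate (fromℕ j) (fromℕ i) A)
    (subst (λ z → translate z A ≈ A ⟨ i + j ⟩) (fromℕ-+ i j) ≈-refl)

  ∏⟨_⟩ : List ℕ → Pol → Pol
  ∏⟨ [] ⟩ A = 1ᴾ
  ∏⟨ i ∷ is ⟩ A = A ⟨ i ⟩ *ᴾ ∏⟨ is ⟩ A

  module _ {d : ℕ} {F : Pol} (F-deg : HasDeg d F) (L : ℕ) (dL<p : suc d * L < p) (d<p : d < p) where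

    factor-deg< : ∀ {n π} → HasDeg n π → π ∣ᴾ F → n < p
    factor-deg< {n} {π} h (dividesᴾ Q eq) with zero-or-degree Q
    ... | inj₁ Q≈0 = contradiction (≈-trans (≈-sym eq) (≈-trans (*ᴾ-congˡ π Q≈0) (*ᴾ-zeroʳ π))) (HasDeg⇒≉0 F-deg)
    ... | inj₂ (m , q) = ℕₚ.≤-<-trans (ℕₚ.≤-trans (ℕₚ.m≤m+n _ m) (ℕₚ.≤-reflexive (HasDeg-unique (HasDeg-cong eq (HasDeg-* h q)) F-deg))) d<p

    record Isolated (π : Pol) : Set where
      field
        irreducible : Irreducible π
        factor : π ∣ᴾ F
        gap : ∀ k → 1 ≤ k → k ≤ L → ¬ π ⟨ k ⟩ ∣ᴾ F
    open Isolated

    private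
      next-or-gap : ∀ {π} → Irreducible π → ∀ L → (∀ k → 1 ≤ k → k ≤ L → ¬ π ⟨ k ⟩ ∣ᴾ F) ⊎ ∃ λ k → 1 ≤ k × k ≤ L × π ⟨ k ⟩ ∣ᴾ F
      next-or-gap irr zero = inj₁ λ k 1≤k k≤0 _ → contradiction (ℕₚ.≤-trans 1≤k k≤0) λ ()
      next-or-gap irr (suc L) with ∣? (translate-irreducible (fromℕ (suc L)) irr) F | next-or-gap irr L
      ... | yes d | _ = inj₂ (suc L , s≤s z≤n , ℕₚ.≤-refl , d)
      ... | no _ | inj₂ (k , 1≤k , k≤L , d) = inj₂ (k , 1≤k , ℕₚ.m≤n⇒m≤1+n k≤L , d)
      ... | no nd | inj₁ none = inj₁ λ k 1≤k k≤1+L → [ (λ { (s≤s k≤L) → none k 1≤k k≤L }) , (λ { refl → nd }) ]′ (ℕₚ.m≤n⇒m<n∨m≡n k≤1+L)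

      module Chain {π : Pol} (irr : Irreducible π) (π∣F : π ∣ᴾ F) (none : ¬ Σ Pol Isolated) where

        -- By Euclid's lemma it would divide one earlier translate, whose shift by the nonzero
        -- amount e - i it is; `translate-∤` forbids that.
        ∤-earlier : ∀ {e es} → e < p → π ⟨ e ⟩ ∣ᴾ F → All (_< e) es → ¬ π ⟨ e ⟩ ∣ᴾ ∏⟨ es ⟩ π
        ∤-earlier {e} e<p _ [] d with irreducible-degree (translate-irreducible (fromℕ e) irr)
        ... | n , h = contradiction (∣-small h (Deg<-mono (s≤s z≤n) (Deg<-const 1ᴷ)) d) (λ eq → 1≢0 (at eq 0))
        ∤-earlier {e} {i ∷ es} e<p πe∣F (i<e ∷ es<e) d
          with euclid (translate-irreducible (fromℕ e) irr) (π ⟨ i ⟩) (∏⟨ es ⟩ π) d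
        ... | inj₂ d′ = ∤-earlier e<p πe∣F es<e d′
        ... | inj₁ d′ with irreducible-degree irr
        ...   | n , h = translate-∤ (HasDeg-translate (fromℕ i) h)
          (factor-deg< (HasDeg-translate (fromℕ e) h) πe∣F) (fromℕ (e ∸ i))
          (fromℕ≢0 (ℕₚ.m<n⇒0<n∸m i<e) (ℕₚ.≤-<-trans (ℕₚ.m∸n≤m e i) e<p))
          (∣-cong (≈-sym (≈-trans (⟨⟩-⟨⟩ π i (e ∸ i)) (subst (λ z → π ⟨ i + (e ∸ i) ⟩ ≈ π ⟨ z ⟩) (ℕₚ.m+[n∸m]≡n (ℕₚ.<⇒≤ i<e)) ≈-refl))) ≈-refl d′)

        ∏-degree : ∀ es → ∃ λ n → length es ≤ n × HasDeg n (∏⟨ es ⟩ π)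
        ∏-degree [] = 0 , z≤n , hasDeg 1≢0 (Deg<-const 1ᴷ)
        ∏-degree (e ∷ es) with irreducible-degree (translate-irreducible (fromℕ e) irr) | ∏-degree es
        ... | m , h | n , len , h′ = suc m + n , s≤s (ℕₚ.≤-trans len (ℕₚ.m≤n+m n m)) , HasDeg-* h h′

        -- `es` holds the offsets already passed and `e` the current one, which is not yet in the
        -- product. Since its translate does not divide the product, it divides the cofactor and can
        -- be added; since it is not isolated, some offset at most L further on continues the chain.
        -- The bound on `e` and `dL<p` keep the offsets distinct modulo p. After d + 1 steps the
        -- product has too large a degree to divide F.
        chain : ∀ s → s ≤ suc d → Σ (List ℕ) λ es → ∃ λ e → length es ≡ s × e ≤ s * L × All (_< e) es
          × π ⟨ e ⟩ ∣ᴾ F × ∏⟨ es ⟩ π ∣ᴾ F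
        chain zero _ = [] , 0 , refl , z≤n , []
          , ∣-cong (≈-sym (subst (λ z → translate z π ≈ π) (sym fromℕ-0) (translate-0 π))) ≈-refl π∣F
          , dividesᴾ F (*ᴾ-identityˡ F)
        chain (suc s) s<d with chain s (ℕₚ.<⇒≤ s<d)
        ... | es , e , refl , e≤ , es<e , πe∣F , dividesᴾ Q eq
          with next-or-gap (translate-irreducible (fromℕ e) irr) L
        ...   | inj₁ gap′ = contradiction (π ⟨ e ⟩ , record
                  { irreducible = translate-irreducible (fromℕ e) irr ; factor = πe∣F ; gap = gap′ }) none
        ...   | inj₂ (k , 1≤k , k≤L , d′) = e ∷ es , e + k , refl
              , ℕₚ.≤-trans (ℕₚ.+-mono-≤ e≤ k≤L) (ℕₚ.≤-reflexive (ℕₚ.+-comm (length es * L) L))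
              , ℕₚ.<-≤-trans (ℕₚ.≤-reflexive (ℕₚ.+-comm 1 e)) (ℕₚ.+-monoʳ-≤ e 1≤k) ∷ All.map (λ lt → ℕₚ.<-≤-trans lt (ℕₚ.m≤m+n e k)) es<e
              , ∣-cong (⟨⟩-⟨⟩ π e k) ≈-refl d′
              , extended
          where
          e<p : e < p
          e<p = ℕₚ.≤-<-trans (ℕₚ.≤-trans e≤ (ℕₚ.*-monoˡ-≤ L (ℕₚ.<⇒≤ s<d))) dL<p
          extended : ∏⟨ e ∷ es ⟩ π ∣ᴾ F
          extended with euclid (translate-irreducible (fromℕ e) irr) (∏⟨ es ⟩ π) Q (∣-cong ≈-refl (≈-sym eq) πe∣F)
          ... | inj₁ d″ = contradiction d″ (∤-earlier e<p πe∣F es<e)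
          ... | inj₂ (dividesᴾ Q′ eq′) = dividesᴾ Q′ (begin
            π ⟨ e ⟩ *ᴾ ∏⟨ es ⟩ π *ᴾ Q′ ≈⟨ solve 3 (λ a b c → a :* b :* c := b :* (a :* c)) ≈-refl (π ⟨ e ⟩) (∏⟨ es ⟩ π) Q′ ⟩
            ∏⟨ es ⟩ π *ᴾ (π ⟨ e ⟩ *ᴾ Q′) ≈⟨ *ᴾ-congˡ (∏⟨ es ⟩ π) eq′ ⟩
            ∏⟨ es ⟩ π *ᴾ Q ≈⟨ eq ⟩
            F ∎)
            where open ≈-Reasoning
                  open PSolver

        contradictory : ⊥
        contradictory with chain (suc d) ℕₚ.≤-refl
        ... | es , e , len , _ , _ , _ , dividesᴾ Q eq with ∏-degree es | zero-or-degree Q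
        ...   | _ | inj₁ Q≈0 = HasDeg⇒≉0 F-deg (≈-trans (≈-sym eq) (≈-trans (*ᴾ-congˡ (∏⟨ es ⟩ π) Q≈0) (*ᴾ-zeroʳ (∏⟨ es ⟩ π))))
        ...   | n , len≤n , h | inj₂ (m , q) = ℕₚ.<⇒≱ (ℕₚ.n<1+n d) (ℕₚ.≤-trans (ℕₚ.≤-reflexive (sym len)) (ℕₚ.≤-trans len≤n
          (ℕₚ.≤-trans (ℕₚ.m≤m+n n m) (ℕₚ.≤-reflexive (HasDeg-unique (HasDeg-cong eq (HasDeg-* h q)) F-deg)))))

    -- Otherwise the translates met while moving forward would be more than d coprime factors of F.
    isolated-factor : 1 ≤ d → ¬ ¬ Σ Pol Isolated
    isolated-factor 1≤d none = irreducible-factor d F (bounded F-deg)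
      (λ c → contradiction (HasDeg-< F-deg c) (ℕₚ.≤⇒≯ 1≤d))
      λ { (π , irr , π∣F) → Chain.contradictory irr π∣F none }

    module _ (squareFree : ∀ G H → G *ᴾ G *ᴾ H ≈ F → Deg< 1 G) (1≤d : 1 ≤ d) where

      private
        module Descent {ϖ H : Pol} (irr : Irreducible ϖ) (ϖ∤H : ¬ ϖ ∣ᴾ H) {c : K} (c≢0 : c ≢ 0ᴷ) where
          square-divisible : ∀ A → ϖ ∣ᴾ A *ᴾ A → ϖ ∣ᴾ A
          square-divisible A d = [ (λ e → e) , (λ e → e) ]′ (euclid irr A A d)

          ϖ≉0 : ¬ ϖ ≈ []
          ϖ≉0 eq = nonconstant irr (Deg<-zero eq)

          -- Infinite descent. ϖ divides s², hence s; after cancelling one ϖ it divides r² H, hence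
          -- r because it does not divide H. Dividing r and s by ϖ reproduces the equation with r of
          -- smaller degree.
          descend : ∀ n r s → Deg< n r → r *ᴾ r *ᴾ (ϖ *ᴾ H) ≈ scale c (s *ᴾ s) → r ≈ []
          descend zero r s a _ = Deg<0 a
          descend (suc n) r s a eq = with-s (square-divisible s
              (∣-scale⁻¹ c≢0 (∣-cong (≈-refl {ϖ}) eq (∣-*ˡ (r *ᴾ r) (dividesᴾ {ϖ} H ≈-refl)))))
            where
            open ≈-Reasoning
            open PSolver
            with-s : ϖ ∣ᴾ s → r ≈ []
            with-s (dividesᴾ s₁ eqs) = with-r ([ square-divisible r , (λ d → contradiction d ϖ∤H) ]′
                (euclid irr (r *ᴾ r) H (dividesᴾ (const c *ᴾ (s₁ *ᴾ s₁)) eq₁)))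
              where
              eq₁ : ϖ *ᴾ (const c *ᴾ (s₁ *ᴾ s₁)) ≈ r *ᴾ r *ᴾ H
              eq₁ = *ᴾ-cancelˡ {ϖ} {ϖ *ᴾ (const c *ᴾ (s₁ *ᴾ s₁))} {r *ᴾ r *ᴾ H} ϖ≉0 (begin
                ϖ *ᴾ (ϖ *ᴾ (const c *ᴾ (s₁ *ᴾ s₁)))
                  ≈⟨ solve 3 (λ w c s → w :* (w :* (c :* (s :* s))) := c :* ((w :* s) :* (w :* s))) ≈-refl ϖ (const c) s₁ ⟩
                const c *ᴾ (ϖ *ᴾ s₁ *ᴾ (ϖ *ᴾ s₁)) ≈⟨ *ᴾ-congˡ (const c) (*ᴾ-cong eqs eqs) ⟩
                const c *ᴾ (s *ᴾ s) ≈⟨ const-*ᴾ c (s *ᴾ s) ⟩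
                scale c (s *ᴾ s) ≈⟨ eq ⟨
                r *ᴾ r *ᴾ (ϖ *ᴾ H) ≈⟨ solve 3 (λ r w h → r :* r :* (w :* h) := w :* (r :* r :* h)) ≈-refl r ϖ H ⟩
                ϖ *ᴾ (r *ᴾ r *ᴾ H) ∎)
              with-r : ϖ ∣ᴾ r → r ≈ []
              with-r (dividesᴾ r₁ eqr) = ≈-trans (≈-sym eqr) (≈-trans (*ᴾ-congˡ ϖ (descend n r₁ s₁ smaller eq₂)) (*ᴾ-zeroʳ ϖ))
                where
                eq₂ : r₁ *ᴾ r₁ *ᴾ (ϖ *ᴾ H) ≈ scale c (s₁ *ᴾ s₁)
                eq₂ = *ᴾ-cancelˡ {ϖ} {r₁ *ᴾ r₁ *ᴾ (ϖ *ᴾ H)} {scale c (s₁ *ᴾ s₁)} ϖ≉0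
                  (*ᴾ-cancelˡ {ϖ} {ϖ *ᴾ (r₁ *ᴾ r₁ *ᴾ (ϖ *ᴾ H))} {ϖ *ᴾ scale c (s₁ *ᴾ s₁)} ϖ≉0 (begin
                  ϖ *ᴾ (ϖ *ᴾ (r₁ *ᴾ r₁ *ᴾ (ϖ *ᴾ H)))
                    ≈⟨ solve 3 (λ w r h → w :* (w :* (r :* r :* (w :* h))) := (w :* r) :* (w :* r) :* (w :* h)) ≈-refl ϖ r₁ H ⟩
                  ϖ *ᴾ r₁ *ᴾ (ϖ *ᴾ r₁) *ᴾ (ϖ *ᴾ H) ≈⟨ *ᴾ-cong (*ᴾ-cong eqr eqr) (≈-refl {ϖ *ᴾ H}) ⟩
                  r *ᴾ r *ᴾ (ϖ *ᴾ H) ≈⟨ eq ⟩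
                  scale c (s *ᴾ s) ≈⟨ scale-cong c (*ᴾ-cong (≈-sym eqs) (≈-sym eqs)) ⟩
                  scale c (ϖ *ᴾ s₁ *ᴾ (ϖ *ᴾ s₁)) ≈⟨ const-*ᴾ c _ ⟨
                  const c *ᴾ (ϖ *ᴾ s₁ *ᴾ (ϖ *ᴾ s₁))
                    ≈⟨ solve 3 (λ w c s → c :* ((w :* s) :* (w :* s)) := w :* (w :* (c :* (s :* s)))) ≈-refl ϖ (const c) s₁ ⟩
                  ϖ *ᴾ (ϖ *ᴾ (const c *ᴾ (s₁ *ᴾ s₁))) ≈⟨ *ᴾ-congˡ ϖ (*ᴾ-congˡ ϖ (const-*ᴾ c (s₁ *ᴾ s₁))) ⟩
                  ϖ *ᴾ (ϖ *ᴾ scale c (s₁ *ᴾ s₁)) ∎))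
                smaller : Deg< n r₁
                smaller = cofactor-deg (zero-or-degree r₁) (irreducible-degree irr)
                  where
                  cofactor-deg : r₁ ≈ [] ⊎ (∃ λ m → HasDeg m r₁) → (∃ λ k → HasDeg (suc k) ϖ) → Deg< n r₁
                  cofactor-deg (inj₁ r₁≈0) _ = Deg<-zero r₁≈0
                  cofactor-deg (inj₂ (m , h)) (k , h′) = Deg<-mono
                    (ℕₚ.≤-trans (s≤s (ℕₚ.m≤n+m m k)) (ℕ.s≤s⁻¹ (HasDeg-< (HasDeg-cong eqr (HasDeg-* h′ h)) a))) (bounded h)

        -- The descent uses the translate of π by the largest shift `t`, because `gap` looks only
        -- forward. Square-freeness keeps it from dividing F⟨t⟩ twice. If it divided F⟨i⟩, undoing
        -- the shift by i would make π translated by t - i, between 1 and L, a divisor of F. The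
        -- shifts in `is` may repeat.
        isolated-nonSquare : ∀ {π} → Isolated π → ∀ t is → All (λ i → i < t × t ≤ i + L) is →
          ∀ r s c → c ≢ 0ᴷ → r *ᴾ r *ᴾ ∏⟨ t ∷ is ⟩ F ≈ scale c (s *ᴾ s) → r ≈ []
        isolated-nonSquare {π} iso t is inWindow r s c c≢0 eq =
          [ (λ r≈0 → r≈0)
          , (λ { (n , hr) → Descent.descend irrϖ ϖ∤H c≢0 (suc n) r s (bounded hr) (≈-trans (*ᴾ-congˡ (r *ᴾ r) (≈-sym f≈)) eq) }) ]′
          (zero-or-degree r)
          where
          h = cofactor (factor iso)
          π*h≈F = product≈ (factor iso)
          ϖ = π ⟨ t ⟩
          irrϖ = translate-irreducible (fromℕ t) (irreducible iso)
          H = h ⟨ t ⟩ *ᴾ ∏⟨ is ⟩ F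
          f≈ : ∏⟨ t ∷ is ⟩ F ≈ ϖ *ᴾ H
          f≈ = ≈-trans (*ᴾ-cong (≈-trans (translate-cong (fromℕ t) (≈-sym π*h≈F)) (translate-* (fromℕ t) π h)) (≈-refl {∏⟨ is ⟩ F}))
            (*ᴾ-assoc ϖ (h ⟨ t ⟩) (∏⟨ is ⟩ F))
          π∤h : ¬ π ∣ᴾ h
          π∤h (dividesᴾ h′ π*h′≈h) = nonconstant (irreducible iso) (squareFree π h′
            (≈-trans (*ᴾ-assoc π π h′) (≈-trans (*ᴾ-congˡ π π*h′≈h) π*h≈F)))
          ϖ∤h : ¬ ϖ ∣ᴾ h ⟨ t ⟩
          ϖ∤h d = π∤h (∣-cong (translate-inverse (fromℕ t) π) (translate-inverse (fromℕ t) h) (∣-translate (⊖ fromℕ t) d))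
          ϖ∤∏ : ∀ {is} → All (λ i → i < t × t ≤ i + L) is → ¬ ϖ ∣ᴾ ∏⟨ is ⟩ F
          ϖ∤∏ [] d = contradiction (∣-small (proj₂ (irreducible-degree irrϖ)) (Deg<-mono (s≤s z≤n) (Deg<-const 1ᴷ)) d)
            (λ eq → 1≢0 (at eq 0))
          ϖ∤∏ {i ∷ is} ((i<t , t≤i+L) ∷ rest) d = [ ahead , ϖ∤∏ rest ]′ (euclid irrϖ (F ⟨ i ⟩) (∏⟨ is ⟩ F) d)
            where
            ahead : ¬ ϖ ∣ᴾ F ⟨ i ⟩
            shifted : translate (⊖ fromℕ i) (π ⟨ t ⟩) ≈ π ⟨ t ∸ i ⟩
            shifted = ≈-trans (translate-cong (⊖ fromℕ i) (≈-sym (≈-trans (⟨⟩-⟨⟩ π (t ∸ i) i)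
              (subst (λ z → π ⟨ t ∸ i + i ⟩ ≈ π ⟨ z ⟩) (ℕₚ.m∸n+n≡m (ℕₚ.<⇒≤ i<t)) ≈-refl)))) (translate-inverse (fromℕ i) (π ⟨ t ∸ i ⟩))
            ahead d′ = gap iso (t ∸ i) (ℕₚ.m<n⇒0<n∸m i<t) (ℕₚ.≤-trans (ℕₚ.∸-monoˡ-≤ i t≤i+L) (ℕₚ.≤-reflexive (ℕₚ.m+n∸m≡n i L)))
              (∣-cong shifted (translate-inverse (fromℕ i) F) (∣-translate (⊖ fromℕ i) d′))
          ϖ∤H : ¬ ϖ ∣ᴾ H
          ϖ∤H d = [ ϖ∤h , ϖ∤∏ inWindow ]′ (euclid irrϖ (h ⟨ t ⟩) (∏⟨ is ⟩ F) d)

      translates-nonSquare : ∀ t is q → All (λ i → i < t × t ≤ i + L) is → Stepanov.NonSquare 𝔽 (∏⟨ t ∷ is ⟩ F) q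
      translates-nonSquare t is q inWindow r s c c≢0 eq = r≈0 , s≈0
        where
        r≈0 : r ≈ []
        -- Being zero is decidable for a polynomial, so an isolated factor under a double negation
        -- is enough.
        r≈0 = decidable-stable (zero? r) λ r≉0 →
          isolated-factor 1≤d λ { (π , iso) → r≉0 (isolated-nonSquare iso t is inWindow r s c c≢0 eq) }
        s*s≈0 : s *ᴾ s ≈ []
        s*s≈0 = *ᴾ-cancelˡ-0 {const c} (λ eq → c≢0 (at eq 0)) (≈-trans (const-*ᴾ c (s *ᴾ s)) (≈-trans (≈-sym eq)
          (*ᴾ-cong {r *ᴾ r} {[]} {∏⟨ t ∷ is ⟩ F} (*ᴾ-cong {r} {[]} {r} {r} r≈0 ≈-refl) ≈-refl)))
        s≈0 : s ≈ []
        s≈0 = [ (λ e → e) , (λ e → e) ]′ (A*B≈0 s s s*s≈0)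

if-elim : ∀ {A : Set} (P : A → Set) b {x y} → (IsTrue b → P x) → (¬ IsTrue b → P y) → P (if b then x else y)
if-elim P true t e = t _
if-elim P false t e = e λ ()

-- From the polynomials of the statement to polynomials over the field.

module Reduction {p : ℕ} (𝔽 : PrimeField p) where
  open PrimeField 𝔽
  open Polynomial 𝔽
  open FieldPigeonhole 𝔽

  modN<p : ∀ a → modN a p < p
  modN<p a = go p (ℕₚ.<-trans (ℕₚ.n<1+n 0) 1<p)
    where
    go : ∀ n → 0 < n → modN a n < n
    go (suc n) _ = m%n<n a (suc n)

  fromℕ-modN : ∀ a → fromℕ (modN a p) ≡ fromℕ a
  fromℕ-modN a = begin
    fromℕ (modN a p) ≡⟨ +-identityʳ _ ⟨
    fromℕ (modN a p) ⊕ 0ᴷ ≡⟨ cong (fromℕ (modN a p) ⊕_) (∣⇒fromℕ≡0 (proj₁ (quotient p) * p) (divides (proj₁ (quotient p)) refl)) ⟨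
    fromℕ (modN a p) ⊕ fromℕ (proj₁ (quotient p) * p) ≡⟨ fromℕ-+ _ _ ⟨
    fromℕ (modN a p + proj₁ (quotient p) * p) ≡⟨ cong fromℕ (proj₂ (quotient p)) ⟨
    fromℕ a ∎
    where
    open ≡-Reasoning
    quotient : ∀ n → ∃ λ k → a ≡ modN a n + k * n
    quotient zero = 0 , sym (ℕₚ.+-identityʳ a)
    quotient (suc n) = a div suc n , m≡m%n+[m/n]*n a (suc n)

  modN⇒fromℕ : ∀ a b → modN a p ≡ modN b p → fromℕ a ≡ fromℕ b
  modN⇒fromℕ a b eq = trans (sym (fromℕ-modN a)) (trans (cong fromℕ eq) (fromℕ-modN b))

  fromℕ⇒modN : ∀ a b → fromℕ a ≡ fromℕ b → modN a p ≡ modN b p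
  fromℕ⇒modN a b eq = fromℕ-injective (modN<p a) (modN<p b) (trans (fromℕ-modN a) (trans eq (sym (fromℕ-modN b))))

  modN-0 : modN 0 p ≡ 0
  modN-0 = fromℕ-injective (modN<p 0) (ℕₚ.<-trans (ℕₚ.n<1+n 0) 1<p) (fromℕ-modN 0)

  modN≡0⇒fromℕ≡0 : ∀ a → modN a p ≡ 0 → fromℕ a ≡ 0ᴷ
  modN≡0⇒fromℕ≡0 a eq = trans (modN⇒fromℕ a 0 (trans eq (sym modN-0))) fromℕ-0

  fromℕ≡0⇒modN≡0 : ∀ a → fromℕ a ≡ 0ᴷ → modN a p ≡ 0
  fromℕ≡0⇒modN≡0 a eq = trans (fromℕ⇒modN a 0 (trans eq (sym fromℕ-0))) modN-0

  reduce : Poly → Pol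
  reduce = map fromℕ

  coef-reduce : ∀ A k → coef (reduce A) k ≡ fromℕ (coeff A k)
  coef-reduce [] k = sym fromℕ-0
  coef-reduce (a ∷ A) zero = refl
  coef-reduce (a ∷ A) (suc k) = coef-reduce A k

  reduce-addP : ∀ A B → reduce (addP A B) ≡ reduce A +ᴾ reduce B
  reduce-addP [] B = refl
  reduce-addP (a ∷ A) [] = refl
  reduce-addP (a ∷ A) (b ∷ B) = cong₂ _∷_ (fromℕ-+ a b) (reduce-addP A B)

  reduce-scale : ∀ a B → reduce (map (a *_) B) ≡ scale (fromℕ a) (reduce B)
  reduce-scale a [] = refl
  reduce-scale a (b ∷ B) = cong₂ _∷_ (fromℕ-* a b) (reduce-scale a B)

  reduce-mulP : ∀ A B → reduce (mulP A B) ≡ reduce A *ᴾ reduce B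
  reduce-mulP [] B = refl
  reduce-mulP (a ∷ A) B = trans (reduce-addP (map (a *_) B) (0 ∷ mulP A B))
    (cong₂ _+ᴾ_ (reduce-scale a B) (cong₂ _∷_ fromℕ-0 (reduce-mulP A B)))

  lift : Pol → Poly
  lift = map repr

  reduce-lift : ∀ A → reduce (lift A) ≡ A
  reduce-lift [] = refl
  reduce-lift (a ∷ A) = cong₂ _∷_ (fromℕ-toFin a) (reduce-lift A)

  eval-reduce : ∀ A n → evalᴾ (reduce A) (fromℕ n) ≡ fromℕ (eval A n)
  eval-reduce [] n = sym fromℕ-0
  eval-reduce (a ∷ A) n = begin
    fromℕ a ⊕ fromℕ n ⊗ evalᴾ (reduce A) (fromℕ n) ≡⟨ cong (λ u → fromℕ a ⊕ fromℕ n ⊗ u) (eval-reduce A n) ⟩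
    fromℕ a ⊕ fromℕ n ⊗ fromℕ (eval A n) ≡⟨ cong (fromℕ a ⊕_) (fromℕ-* n (eval A n)) ⟨
    fromℕ a ⊕ fromℕ (n * eval A n) ≡⟨ fromℕ-+ a _ ⟨
    fromℕ (a + n * eval A n) ∎
    where open ≡-Reasoning

  HasDegree⇒HasDeg : ∀ F d → HasDegree p F d → HasDeg d (reduce F)
  HasDegree⇒HasDeg F d (lead , high) = hasDeg
    (λ eq → lead (fromℕ≡0⇒modN≡0 _ (trans (sym (coef-reduce F d)) eq)))
    (deg< λ k d<k → trans (coef-reduce F k) (modN≡0⇒fromℕ≡0 _ (high k d<k)))

  -- The hypothesis quantifies over polynomials with natural coefficients, so G and H are first
  -- replaced by their representatives.
  SquareFree⇒ : ∀ F → SquareFree p F → ∀ G H → G *ᴾ G *ᴾ H ≈ reduce F → Deg< 1 G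
  SquareFree⇒ F sf G H eq = deg< λ k 1≤k → begin
    coef G k ≡⟨ cong (λ A → coef A k) (reduce-lift G) ⟨
    coef (reduce (lift G)) k ≡⟨ coef-reduce (lift G) k ⟩
    fromℕ (coeff (lift G) k) ≡⟨ modN≡0⇒fromℕ≡0 _ (constant k 1≤k) ⟩
    0ᴷ ∎
    where
    open ≡-Reasoning
    product : reduce (mulP (mulP (lift G) (lift G)) (lift H)) ≡ G *ᴾ G *ᴾ H
    product = trans (reduce-mulP (mulP (lift G) (lift G)) (lift H))
      (cong₂ _*ᴾ_ (trans (reduce-mulP (lift G) (lift G)) (cong₂ _*ᴾ_ (reduce-lift G) (reduce-lift G))) (reduce-lift H))
    constant : IsConstant p (lift G)
    constant = sf (lift G) (lift H) λ k → fromℕ⇒modN _ _ (begin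
      fromℕ (coeff (mulP (mulP (lift G) (lift G)) (lift H)) k) ≡⟨ coef-reduce (mulP (mulP (lift G) (lift G)) (lift H)) k ⟨
      coef (reduce (mulP (mulP (lift G) (lift G)) (lift H))) k ≡⟨ cong (λ A → coef A k) product ⟩
      coef (G *ᴾ G *ᴾ H) k ≡⟨ at eq k ⟩
      coef (reduce F) k ≡⟨ coef-reduce F k ⟩
      fromℕ (coeff F k) ∎)

-- Euler's criterion.

module Euler {p : ℕ} (𝔽 : PrimeField p) (q : ℕ) (p-odd : suc (q + q) ≡ p) where
  open PrimeField 𝔽
  open Polynomial 𝔽
  open Roots 𝔽
  open FieldPigeonhole 𝔽
  open Reduction 𝔽
  open ≡-Reasoning

  ^ᴷ-+ : ∀ x m n → x ^ᴷ (m + n) ≡ x ^ᴷ m ⊗ x ^ᴷ n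
  ^ᴷ-+ x zero n = sym (*-identityˡ _)
  ^ᴷ-+ x (suc m) n = trans (cong (x ⊗_) (^ᴷ-+ x m n)) (sym (*-assoc x _ _))

  ^ᴷ-⊗ : ∀ x y n → (x ⊗ y) ^ᴷ n ≡ x ^ᴷ n ⊗ y ^ᴷ n
  ^ᴷ-⊗ x y zero = sym (*-identityˡ 1ᴷ)
  ^ᴷ-⊗ x y (suc n) = trans (cong (x ⊗ y ⊗_) (^ᴷ-⊗ x y n))
    (solve 4 (λ x y a b → x :* y :* (a :* b) := x :* a :* (y :* b)) refl x y _ _)
    where open Solver

  fermat-nonzero : ∀ {x} → x ≢ 0ᴷ → x ^ᴷ q ⊗ x ^ᴷ q ≡ 1ᴷ
  fermat-nonzero {x} x≢0 = ⊗-cancelˡ x≢0 (begin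
    x ⊗ (x ^ᴷ q ⊗ x ^ᴷ q) ≡⟨ cong (x ⊗_) (^ᴷ-+ x q q) ⟨
    x ^ᴷ suc (q + q) ≡⟨ cong (x ^ᴷ_) p-odd ⟩
    x ^ᴷ p ≡⟨ fermat x ⟩
    x ≡⟨ *-identityʳ x ⟨
    x ⊗ 1ᴷ ∎)

  square-power : ∀ {x} → x ≢ 0ᴷ → (x ⊗ x) ^ᴷ q ≡ 1ᴷ
  square-power {x} x≢0 = trans (^ᴷ-⊗ x x q) (fermat-nonzero x≢0)

  square-roots-of-1 : ∀ x → x ⊗ x ≡ 1ᴷ → x ≡ 1ᴷ ⊎ x ≡ ⊖ 1ᴷ
  square-roots-of-1 x eq = [ (λ e → inj₁ (x⊖y≡0⇒x≡y e))
    , (λ e → inj₂ (x⊖y≡0⇒x≡y (trans (solve 1 (λ x → x :- (:- con (+ 1)) := x :+ con (+ 1)) refl x) e))) ]′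
    (x⊗y≡0 (x ⊕ ⊖ 1ᴷ) (x ⊕ 1ᴷ) (begin
      (x ⊕ ⊖ 1ᴷ) ⊗ (x ⊕ 1ᴷ) ≡⟨ solve 1 (λ x → (x :- con (+ 1)) :* (x :+ con (+ 1)) := x :* x :- con (+ 1)) refl x ⟩
      x ⊗ x ⊕ ⊖ 1ᴷ ≡⟨ cong (_⊕ ⊖ 1ᴷ) eq ⟩
      1ᴷ ⊕ ⊖ 1ᴷ ≡⟨ -‿inverseʳ 1ᴷ ⟩
      0ᴷ ∎))
    where open Solver

  0<q : 0 < q
  0<q = ℕₚ.n≢0⇒n>0 λ { refl → ℕₚ.<⇒≢ 1<p p-odd }

  q+q<p : q + q < p
  q+q<p = ℕₚ.≤-reflexive p-odd

  root : Fin q → K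
  root i = fromℕ (suc (toℕ i))

  root≢0 : ∀ i → root i ≢ 0ᴷ
  root≢0 i = fromℕ≢0 (s≤s z≤n) (ℕₚ.≤-<-trans (Finₚ.toℕ<n i) (ℕₚ.≤-<-trans (ℕₚ.m≤m+n q q) q+q<p))

  -- Equal squares have equal or opposite roots, and two numbers from 1 to q have a sum strictly
  -- between 0 and p.
  root-square-injective : ∀ {i j} → root i ⊗ root i ≡ root j ⊗ root j → i ≡ j
  root-square-injective {i} {j} eq = [ (λ e → Finₚ.toℕ-injective (ℕₚ.suc-injective (fromℕ-injective (small i) (small j) (x⊖y≡0⇒x≡y e))))
    , (λ e → contradiction (trans (fromℕ-+ _ _) e)
        (fromℕ≢0 {suc (toℕ i) + suc (toℕ j)} (s≤s z≤n) (ℕₚ.≤-<-trans (ℕₚ.+-mono-≤ (Finₚ.toℕ<n i) (Finₚ.toℕ<n j)) q+q<p))) ]′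
    (x⊗y≡0 (root i ⊕ ⊖ root j) (root i ⊕ root j) (begin
      (root i ⊕ ⊖ root j) ⊗ (root i ⊕ root j) ≡⟨ solve 2 (λ x y → (x :- y) :* (x :+ y) := x :* x :- y :* y) refl (root i) (root j) ⟩
      root i ⊗ root i ⊕ ⊖ (root j ⊗ root j) ≡⟨ cong (_⊕ ⊖ (root j ⊗ root j)) eq ⟩
      root j ⊗ root j ⊕ ⊖ (root j ⊗ root j) ≡⟨ -‿inverseʳ _ ⟩
      0ᴷ ∎))
    where
    open Solver
    small : ∀ i → suc (toℕ i) < p
    small i = ℕₚ.≤-<-trans (Finₚ.toℕ<n i) (ℕₚ.≤-<-trans (ℕₚ.m≤m+n q q) q+q<p)

  X^q-1 : Pol
  X^q-1 = shift q 1ᴾ +ᴾ const (⊖ 1ᴷ)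

  eval-X^q-1 : ∀ x → x ^ᴷ q ≡ 1ᴷ → evalᴾ X^q-1 x ≡ 0ᴷ
  eval-X^q-1 x eq = begin
    evalᴾ X^q-1 x ≡⟨ eval-+ (shift q 1ᴾ) (const (⊖ 1ᴷ)) x ⟩
    evalᴾ (shift q 1ᴾ) x ⊕ evalᴾ (const (⊖ 1ᴷ)) x ≡⟨ cong₂ _⊕_ (eval-shift q 1ᴾ x) (eval-const (⊖ 1ᴷ) x) ⟩
    x ^ᴷ q ⊗ evalᴾ 1ᴾ x ⊕ ⊖ 1ᴷ ≡⟨ cong₂ (λ u v → u ⊗ v ⊕ ⊖ 1ᴷ) eq (eval-const 1ᴷ x) ⟩
    1ᴷ ⊗ 1ᴷ ⊕ ⊖ 1ᴷ ≡⟨ solve 0 (con (+ 1) :* con (+ 1) :- con (+ 1) := con (+ 0)) refl ⟩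
    0ᴷ ∎
    where open Solver

  X^q-1≉0 : ¬ X^q-1 ≈ []
  X^q-1≉0 eq = 1≢0 (begin
    1ᴷ ≡⟨ +-identityʳ 1ᴷ ⟨
    1ᴷ ⊕ 0ᴷ ≡⟨ cong₂ _⊕_ (trans (cong (coef (shift q 1ᴾ)) (sym (ℕₚ.+-identityʳ q))) (coef-shift-+ q 1ᴾ 0)) (above (Deg<-const (⊖ 1ᴷ)) q 0<q) ⟨
    coef (shift q 1ᴾ) q ⊕ coef (const (⊖ 1ᴷ)) q ≡⟨ coef-+ (shift q 1ᴾ) (const (⊖ 1ᴷ)) q ⟨
    coef X^q-1 q ≡⟨ at eq q ⟩
    0ᴷ ∎)

  Deg<-X^q-1 : Deg< (suc q) X^q-1
  Deg<-X^q-1 = Deg<-+ (Deg<-mono (ℕₚ.≤-reflexive (ℕₚ.+-comm q 1)) (Deg<-shift q (Deg<-const 1ᴷ))) (Deg<-mono (s≤s z≤n) (Deg<-const (⊖ 1ᴷ)))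

  -- Otherwise X ^ q − 1 would have a root besides the q squares 1², …, q².
  nonsquare-power : ∀ x → x ≢ 0ᴷ → (∀ i → x ≢ root i ⊗ root i) → x ^ᴷ q ≡ ⊖ 1ᴷ
  nonsquare-power x x≢0 nonsquare = [ (λ eq → contradiction (too-many-simple-roots X^q-1 (x ∷ squares)
        (Allₚ.tabulate⁺ nonsquare ∷ Uniqueₚ.tabulate⁺ root-square-injective)
        (eval-X^q-1 x eq ∷ Allₚ.tabulate⁺ (λ i → eval-X^q-1 _ (square-power (root≢0 i))))
        (subst (λ n → Deg< (suc n) X^q-1) (sym (length-tabulate (λ i → root i ⊗ root i))) Deg<-X^q-1)) X^q-1≉0)
    , (λ eq → eq) ]′ (square-roots-of-1 (x ^ᴷ q) (fermat-nonzero x≢0))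
    where
    squares = tabulate λ i → root i ⊗ root i

  -- Ties a field element to the integer value of its quadratic character through its q-th power;
  -- multiplicativity of the character then becomes multiplicativity of q-th powers.
  data Character (v : K) : ℤ → Set where
    vanishing : v ≡ 0ᴷ → Character v (+ 0)
    residue : v ^ᴷ q ≡ 1ᴷ → Character v (+ 1)
    nonresidue : v ^ᴷ q ≡ ⊖ 1ᴷ → Character v -[1+ 0 ]

  Character-1 : Character 1ᴷ (+ 1)
  Character-1 = residue (1^ q)

  Character-* : ∀ {v w y z} → Character v y → Character w z → Character (v ⊗ w) (y ℤ.* z)
  Character-* {v} {w} {y} {z} (vanishing eq) _ = subst (Character (v ⊗ w)) (sym (ℤₚ.*-zeroˡ z)) (vanishing (trans (cong (_⊗ w) eq) (zeroˡ w)))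
  Character-* {v} {w} {y} {z} _ (vanishing eq) = subst (Character (v ⊗ w)) (sym (ℤₚ.*-zeroʳ y)) (vanishing (trans (cong (v ⊗_) eq) (zeroʳ v)))
  Character-* {v} {w} (residue eq) (residue eq′) = residue (trans (^ᴷ-⊗ v w q) (trans (cong₂ _⊗_ eq eq′) (*-identityˡ 1ᴷ)))
  Character-* {v} {w} (residue eq) (nonresidue eq′) = nonresidue (trans (^ᴷ-⊗ v w q) (trans (cong₂ _⊗_ eq eq′) (*-identityˡ _)))
  Character-* {v} {w} (nonresidue eq) (residue eq′) = nonresidue (trans (^ᴷ-⊗ v w q) (trans (cong₂ _⊗_ eq eq′) (*-identityʳ _)))
  Character-* {v} {w} (nonresidue eq) (nonresidue eq′) = residue (trans (^ᴷ-⊗ v w q) (trans (cong₂ _⊗_ eq eq′)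
    (solve 0 ((:- con (+ 1)) :* (:- con (+ 1)) := con (+ 1)) refl)))
    where open Solver

  isSquareMod⇒ : ∀ a → IsTrue (isSquareMod p a) → ∃ λ x → fromℕ x ⊗ fromℕ x ≡ fromℕ a
  isSquareMod⇒ a t with find (Anyₚ.any⁻ (λ x → modN (x * x) p ≡ᵇ modN a p) (upTo p) t)
  ... | x , _ , eq = x , trans (sym (fromℕ-* x x)) (modN⇒fromℕ (x * x) a (ℕₚ.≡ᵇ⇒≡ _ _ eq))

  ⇒isSquareMod : ∀ a x → x < p → fromℕ a ≡ fromℕ x ⊗ fromℕ x → IsTrue (isSquareMod p a)
  ⇒isSquareMod a x x<p eq = Anyₚ.any⁺ (λ x → modN (x * x) p ≡ᵇ modN a p)
    (lose (∈-upTo⁺ x<p) (ℕₚ.≡⇒≡ᵇ (modN (x * x) p) (modN a p) (fromℕ⇒modN (x * x) a (trans (fromℕ-* x x) (sym eq)))))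

  legendre-character : ∀ a → Character (fromℕ a) (legendre p a)
  legendre-character a = if-elim (Character (fromℕ a)) (modN a p ≡ᵇ 0)
    (λ t → vanishing (modN≡0⇒fromℕ≡0 a (ℕₚ.≡ᵇ⇒≡ (modN a p) 0 t)))
    λ nt → nonzero λ eq → nt (ℕₚ.≡⇒≡ᵇ (modN a p) 0 (fromℕ≡0⇒modN≡0 a eq))
    where
    nonzero : fromℕ a ≢ 0ᴷ → Character (fromℕ a) (if isSquareMod p a then + 1 else -[1+ 0 ])
    nonzero a≢0 = if-elim (Character (fromℕ a)) (isSquareMod p a)
      (λ t → let x , eq = isSquareMod⇒ a t in residue (subst (λ v → v ^ᴷ q ≡ 1ᴷ) eq
        (square-power λ x≡0 → a≢0 (trans (sym eq) (trans (cong (_⊗ fromℕ x) x≡0) (zeroˡ _))))))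
      λ nt → nonresidue (nonsquare-power (fromℕ a) a≢0 λ i eq → nt (⇒isSquareMod a (suc (toℕ i))
        (ℕₚ.≤-<-trans (Finₚ.toℕ<n i) (ℕₚ.≤-<-trans (ℕₚ.m≤m+n q q) q+q<p)) eq))

-- Sums and level sets of sequences with values 0, 1 and -1.

∑ : ℕ → (ℕ → ℤ) → ℤ
∑ zero f = + 0
∑ (suc n) f = ∑ n f ℤ.+ f n

∑ⁿ : ℕ → (ℕ → ℕ) → ℕ
∑ⁿ zero f = 0
∑ⁿ (suc n) f = ∑ⁿ n f + f n

shiftProduct : (ℕ → ℤ) → List ℕ → ℕ → ℤ
shiftProduct e [] k = + 1
shiftProduct e (i ∷ is) k = e (k + i) ℤ.* shiftProduct e is k

data IsCharacterValue : ℤ → Set where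
  value0 : IsCharacterValue (+ 0)
  value1 : IsCharacterValue (+ 1)
  value-1 : IsCharacterValue -[1+ 0 ]

-- The level sets are lists of distinct points because the root-counting bounds take such lists. For
-- the three possible values, `1 ∸ ∣ z ∣` is the indicator of z = 0.
record LevelSets (φ : ℕ → ℤ) (n : ℕ) : Set where
  field
    P N Z : List ℕ
    P< : All (_< n) P
    N< : All (_< n) N
    Z< : All (_< n) Z
    P! : Unique P
    N! : Unique N
    Z! : Unique Z
    P-values : All (λ k → φ k ≡ + 1) P
    N-values : All (λ k → φ k ≡ -[1+ 0 ]) N
    Z-values : All (λ k → φ k ≡ + 0) Z
    total : length P + length N + length Z ≡ n
    sum : ∑ n φ ≡ + length P ℤ.- + length N
    zeros : ∑ⁿ n (λ k → 1 ∸ ℤ.∣ φ k ∣) ≡ length Z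

levelSets : ∀ φ → (∀ k → IsCharacterValue (φ k)) → ∀ n → LevelSets φ n
levelSets φ values zero = record
  { P = [] ; N = [] ; Z = [] ; P< = [] ; N< = [] ; Z< = [] ; P! = [] ; N! = [] ; Z! = []
  ; P-values = [] ; N-values = [] ; Z-values = [] ; total = refl ; sum = refl ; zeros = refl }
levelSets φ values (suc n) = extend (values n) refl
  where
  open LevelSets (levelSets φ values n)
  weaken : ∀ {ks} → All (_< n) ks → All (_< suc n) ks
  weaken = All.map ℕₚ.m≤n⇒m≤1+n
  fresh : ∀ {ks} → All (_< n) ks → All (n ≢_) ks
  fresh = All.map λ k<n n≡k → ℕₚ.<⇒≢ k<n (sym n≡k)
  open Data.Integer.Solver.+-*-Solver
  extend : ∀ {z} → IsCharacterValue z → φ n ≡ z → LevelSets φ (suc n)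
  extend value1 eq = record
    { P = n ∷ P ; N = N ; Z = Z ; P< = ℕₚ.≤-refl ∷ weaken P< ; N< = weaken N< ; Z< = weaken Z<
    ; P! = fresh P< ∷ P! ; N! = N! ; Z! = Z! ; P-values = eq ∷ P-values ; N-values = N-values ; Z-values = Z-values
    ; total = cong suc total
    ; sum = trans (cong₂ ℤ._+_ sum eq) (solve 2 (λ a b → (a :- b) :+ con (+ 1) := (con (+ 1) :+ a) :- b) refl (+ length P) (+ length N))
    ; zeros = trans (cong₂ (λ x z → x + (1 ∸ ℤ.∣ z ∣)) zeros eq) (ℕₚ.+-identityʳ _) }
  extend value-1 eq = record
    { P = P ; N = n ∷ N ; Z = Z ; P< = weaken P< ; N< = ℕₚ.≤-refl ∷ weaken N< ; Z< = weaken Z<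
    ; P! = P! ; N! = fresh N< ∷ N! ; Z! = Z! ; P-values = P-values ; N-values = eq ∷ N-values ; Z-values = Z-values
    ; total = trans (cong (_+ length Z) (ℕₚ.+-suc (length P) (length N))) (cong suc total)
    ; sum = trans (cong₂ ℤ._+_ sum eq) (solve 2 (λ a b → (a :- b) :+ con -[1+ 0 ] := a :- (con (+ 1) :+ b)) refl (+ length P) (+ length N))
    ; zeros = trans (cong₂ (λ x z → x + (1 ∸ ℤ.∣ z ∣)) zeros eq) (ℕₚ.+-identityʳ _) }
  extend value0 eq = record
    { P = P ; N = N ; Z = n ∷ Z ; P< = weaken P< ; N< = weaken N< ; Z< = ℕₚ.≤-refl ∷ weaken Z<
    ; P! = P! ; N! = N! ; Z! = fresh Z< ∷ Z! ; P-values = P-values ; N-values = N-values ; Z-values = eq ∷ Z-values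
    ; total = trans (ℕₚ.+-suc (length P + length N) (length Z)) (cong suc total)
    ; sum = trans (cong₂ ℤ._+_ sum eq) (ℤₚ.+-identityʳ _)
    ; zeros = trans (cong₂ (λ x z → x + (1 ∸ ℤ.∣ z ∣)) zeros eq) (ℕₚ.+-comm (length Z) 1) }

∣m-n∣≤ : ∀ {m n b} → m ≤ n + b → n ≤ m + b → ℤ.∣ + m ℤ.- + n ∣ ≤ b
∣m-n∣≤ {m} {n} {b} m≤ n≤ = subst (_≤ b) (sym (trans (cong ℤ.∣_∣ (ℤₚ.m-n≡m⊖n m n)) refl)) (bound (ℕₚ.≤-total m n))
  where
  bound : m ≤ n ⊎ n ≤ m → ℤ.∣ m ℤ.⊖ n ∣ ≤ b
  bound (inj₁ m≤n) = ℕₚ.≤-trans (ℕₚ.≤-reflexive (ℤₚ.∣⊖∣-≤ m≤n)) (ℕₚ.m≤n+o⇒m∸n≤o n m n≤)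
  bound (inj₂ n≤m) = ℕₚ.≤-trans (ℕₚ.≤-reflexive (trans (ℤₚ.∣m⊖n∣≡∣n⊖m∣ m n) (ℤₚ.∣⊖∣-≤ n≤m))) (ℕₚ.m≤n+o⇒m∸n≤o m n m≤)

-- Correlations of the character along shifts.

module Correlation {p : ℕ} (𝔽 : PrimeField p) (q : ℕ) (p-odd : suc (q + q) ≡ p) (F : Poly) where
  open PrimeField 𝔽
  open Polynomial 𝔽
  open Roots 𝔽
  open FieldPigeonhole 𝔽
  open Factorization 𝔽
  open Reduction 𝔽
  open Euler 𝔽 q p-odd

  e : ℕ → ℤ
  e k = legendre p (eval F k)

  e∏ : List ℕ → ℕ → ℤ
  e∏ = shiftProduct e

  F̄ : Pol
  F̄ = reduce F

  eval-⟨⟩ : ∀ A i x → evalᴾ (A ⟨ i ⟩) x ≡ evalᴾ A (x ⊕ fromℕ i)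
  eval-⟨⟩ A i x = eval-translate (fromℕ i) A x

  e-character : ∀ k i → Character (evalᴾ (F̄ ⟨ i ⟩) (fromℕ k)) (e (k + i))
  e-character k i = subst (λ v → Character v (e (k + i)))
    (sym (trans (eval-⟨⟩ F̄ i (fromℕ k)) (trans (cong (evalᴾ F̄) (sym (fromℕ-+ k i))) (eval-reduce F (k + i)))))
    (legendre-character (eval F (k + i)))

  e∏-character : ∀ is k → Character (evalᴾ (∏⟨ is ⟩ F̄) (fromℕ k)) (e∏ is k)
  e∏-character [] k = subst (λ v → Character v (+ 1)) (sym (eval-const 1ᴷ (fromℕ k))) Character-1
  e∏-character (i ∷ is) k = subst (λ v → Character v (e∏ (i ∷ is) k)) (sym (eval-* (F̄ ⟨ i ⟩) (∏⟨ is ⟩ F̄) (fromℕ k)))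
    (Character-* (e-character k i) (e∏-character is k))

  character-value : ∀ {v z} → Character v z → IsCharacterValue z
  character-value (vanishing _) = value0
  character-value (residue _) = value1
  character-value (nonresidue _) = value-1

  vanishing⁻¹ : ∀ {v z} → Character v z → z ≡ + 0 → v ≡ 0ᴷ
  vanishing⁻¹ (vanishing eq) _ = eq

  residue⁻¹ : ∀ {v z} → Character v z → z ≡ + 1 → v ^ᴷ q ≡ 1ᴷ
  residue⁻¹ (residue eq) _ = eq

  nonresidue⁻¹ : ∀ {v z} → Character v z → z ≡ -[1+ 0 ] → v ^ᴷ q ≡ ⊖ 1ᴷ
  nonresidue⁻¹ (nonresidue eq) _ = eq

  eval-∏-shift : ∀ j is A x → evalᴾ (∏⟨ map (_+_ j) is ⟩ A) x ≡ evalᴾ (∏⟨ is ⟩ A) (x ⊕ fromℕ j)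
  eval-∏-shift j [] A x = trans (eval-const 1ᴷ x) (sym (eval-const 1ᴷ (x ⊕ fromℕ j)))
  eval-∏-shift j (i ∷ is) A x = begin
    evalᴾ (A ⟨ j + i ⟩ *ᴾ ∏⟨ map (_+_ j) is ⟩ A) x ≡⟨ eval-* (A ⟨ j + i ⟩) (∏⟨ map (_+_ j) is ⟩ A) x ⟩
    evalᴾ (A ⟨ j + i ⟩) x ⊗ evalᴾ (∏⟨ map (_+_ j) is ⟩ A) x ≡⟨ cong₂ _⊗_ left (eval-∏-shift j is A x) ⟩
    evalᴾ (A ⟨ i ⟩) (x ⊕ fromℕ j) ⊗ evalᴾ (∏⟨ is ⟩ A) (x ⊕ fromℕ j) ≡⟨ eval-* (A ⟨ i ⟩) (∏⟨ is ⟩ A) (x ⊕ fromℕ j) ⟨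
    evalᴾ (A ⟨ i ⟩ *ᴾ ∏⟨ is ⟩ A) (x ⊕ fromℕ j) ∎
    where
    open ≡-Reasoning
    left : evalᴾ (A ⟨ j + i ⟩) x ≡ evalᴾ (A ⟨ i ⟩) (x ⊕ fromℕ j)
    left = trans (eval-⟨⟩ A (j + i) x) (trans (cong (evalᴾ A) (trans (cong (x ⊕_) (fromℕ-+ j i)) (sym (+-assoc _ _ _)))) (sym (eval-⟨⟩ A i (x ⊕ fromℕ j))))

  HasDeg-∏ : ∀ {d A} → HasDeg d A → ∀ is → HasDeg (length is * d) (∏⟨ is ⟩ A)
  HasDeg-∏ h [] = hasDeg 1≢0 (Deg<-const 1ᴷ)
  HasDeg-∏ h (i ∷ is) = HasDeg-* (HasDeg-translate (fromℕ i) h) (HasDeg-∏ h is)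

  nonroot : ∀ A → Deg< p A → ¬ A ≈ [] → ∃ λ j → evalᴾ A (fromℕ j) ≢ 0ᴷ
  nonroot A a A≉0 = let i , nz = Finₚ.¬∀⟶∃¬ p (λ i → evalᴾ A (fromℕ (toℕ i)) ≡ 0ᴷ) (λ i → evalᴾ A (fromℕ (toℕ i)) ≟ᴷ 0ᴷ)
                                  (λ all → A≉0 (everywhere-zero A a λ x → trans (cong (evalᴾ A) (sym (fromℕ-toFin x))) (all (toFin x))))
                    in toℕ i , nz

  module _ {d : ℕ} (F-deg : HasDeg d F̄) (squareFree : ∀ G H → G *ᴾ G *ᴾ H ≈ F̄ → Deg< 1 G) (1≤d : 1 ≤ d)
           (L : ℕ) (dL<p : suc d * L < p) {D μ : ℕ} (1≤μ : 1 ≤ μ)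
           (small : D + (((μ + μ) * ((μ + μ) * D + suc μ)) + ((μ + μ) * ((μ + μ) * D + suc μ))) ≤ p)
           (t : ℕ) (is : List ℕ) (inWindow : All (λ i → i < t × t ≤ i + L) is) (len : length (t ∷ is) * d ≤ D) where

    private
      -- With these values the conditions number M B + M (M D + J) = M B + B, and the unknowns J (B
      -- + B) = M B + 2 B. Taking J just above M / 2 makes the main term J p / M of Stepanov's bound
      -- close to p / 2.
      M = μ + μ
      J = suc μ
      B = M * (M * D + J)
      f = ∏⟨ t ∷ is ⟩ F̄

      1≤M : 1 ≤ M
      1≤M = ℕₚ.≤-trans 1≤μ (ℕₚ.m≤m+n μ μ)

      M≤B : M ≤ B
      M≤B = ℕₚ.≤-trans (ℕₚ.≤-reflexive (sym (ℕₚ.*-identityʳ M))) (ℕₚ.*-monoʳ-≤ M (ℕₚ.≤-trans (s≤s z≤n) (ℕₚ.m≤n+m J (M * D))))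

      B+B≤p : B + B ≤ p
      B+B≤p = ℕₚ.≤-trans (ℕₚ.m≤n+m (B + B) D) small

      M≤p : M ≤ p
      M≤p = ℕₚ.≤-trans (ℕₚ.≤-trans M≤B (ℕₚ.m≤m+n B B)) B+B≤p

      D<p : D < p
      D<p = ℕₚ.<-≤-trans (ℕₚ.m<m+n D (ℕₚ.≤-trans 1≤M (ℕₚ.≤-trans M≤B (ℕₚ.m≤m+n B B)))) small

      d<p : d < p
      d<p = ℕₚ.≤-<-trans (ℕₚ.≤-trans (ℕₚ.m≤m+n d _) len) D<p

      f-hasDeg : HasDeg (length (t ∷ is) * d) f
      f-hasDeg = HasDeg-∏ F-deg (t ∷ is)

      Deg<-f : Deg< (suc D) f
      Deg<-f = Deg<-mono (s≤s len) (bounded f-hasDeg)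

      -- Stepanov's argument needs a nonzero constant coefficient. So f is translated to a point `j`
      -- where it does not vanish, and the points of evaluation are moved back by `j`.
      j : ℕ
      j = proj₁ (nonroot f (Deg<-mono D<p Deg<-f) (HasDeg⇒≉0 f-hasDeg))

      shifts : List ℕ
      shifts = map (_+_ j) (t ∷ is)

      f′ : Pol
      f′ = ∏⟨ shifts ⟩ F̄

      f′-deg : Deg< (suc D) f′
      f′-deg = Deg<-mono (s≤s (ℕₚ.≤-trans (ℕₚ.≤-reflexive (cong (_* d) (length-map (_+_ j) (t ∷ is)))) len)) (bounded (HasDeg-∏ F-deg shifts))

      f′₀≢0 : coef f′ 0 ≢ 0ᴷ
      f′₀≢0 eq = proj₂ (nonroot f (Deg<-mono D<p Deg<-f) (HasDeg⇒≉0 f-hasDeg))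
        (trans (cong (evalᴾ f) (sym (+-identityˡ (fromℕ j)))) (trans (sym (eval-∏-shift j (t ∷ is) F̄ 0ᴷ)) (trans (eval-at-0 f′) eq)))

      f′-nonSquare : Stepanov.NonSquare 𝔽 f′ q
      f′-nonSquare = translates-nonSquare F-deg L dL<p d<p squareFree 1≤d (j + t) (map (_+_ j) is) q
        (Allₚ.map⁺ (All.map (λ { (i<t , t≤i+L) → ℕₚ.+-monoʳ-< j i<t , ℕₚ.≤-trans (ℕₚ.+-monoʳ-≤ j t≤i+L) (ℕₚ.≤-reflexive (sym (ℕₚ.+-assoc j _ L))) }) inWindow))

      enough : M * (M * D + B + J) < J * (B + B)
      enough = begin-strict
        M * (M * D + B + J) ≡⟨ solve 4 (λ M D B J → M :* (M :* D :+ B :+ J) := M :* B :+ M :* (M :* D :+ J)) refl M D B J ⟩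
        M * B + B <⟨ ℕₚ.+-monoʳ-< (M * B) (ℕₚ.m<m+n B (ℕₚ.≤-trans 1≤M M≤B)) ⟩
        M * B + (B + B) ≡⟨ solve 2 (λ μ B → (μ :+ μ) :* B :+ (B :+ B) := (con 1 :+ μ) :* (B :+ B)) refl μ B ⟩
        J * (B + B) ∎
        where
        open ℕₚ.≤-Reasoning
        open Data.Nat.Solver.+-*-Solver

      point : ℕ → K
      point k = fromℕ k ⊕ ⊖ fromℕ j

      eval-f′ : ∀ k → evalᴾ f′ (point k) ≡ evalᴾ f (fromℕ k)
      eval-f′ k = trans (eval-∏-shift j (t ∷ is) F̄ (point k))
        (cong (evalᴾ f) (solve 2 (λ x y → (x :- y) :+ y := x) refl (fromℕ k) (fromℕ j)))
        where open Solver

      points-unique : ∀ {ks} → All (_< p) ks → Unique ks → Unique (map point ks)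
      points-unique [] [] = []
      points-unique (k<p ∷ ks<p) (fresh ∷ ks!) =
        Allₚ.map⁺ (All.zipWith (λ { (l<p , k≢l) eq → k≢l (fromℕ-injective k<p l<p (cancel eq)) }) (ks<p , fresh))
        ∷ points-unique ks<p ks!
        where
        cancel : ∀ {k l} → point k ≡ point l → fromℕ k ≡ fromℕ l
        cancel {k} {l} eq = trans (solve 2 (λ x y → x := (x :- y) :+ y) refl (fromℕ k) (fromℕ j))
          (trans (cong (_⊕ fromℕ j) eq) (solve 2 (λ x y → (x :- y) :+ y := x) refl (fromℕ l) (fromℕ j)))
          where open Solver

      level-bound : ∀ a ks → All (_< p) ks → Unique ks → All (λ k → evalᴾ f (fromℕ k) ^ᴷ q ≡ a) ks →
        length ks * M ≤ M * D + (q * D + B + J * p)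
      level-bound a ks ks<p ks! values = subst (λ n → n * M ≤ M * D + (q * D + B + J * p)) (length-map point ks)
        (ℕₚ.<⇒≤ (Stepanov.stepanov-bound 𝔽 f′ q p-odd f′-deg small f′₀≢0 f′-nonSquare a (map point ks) M≤p enough
          (points-unique ks<p ks!) (Allₚ.map⁺ (All.map (λ {k} eq → trans (cong (_^ᴷ q) (eval-f′ k)) eq) values))))

      zeros-bound : ∀ ks → All (_< p) ks → Unique ks → All (λ k → evalᴾ f (fromℕ k) ≡ 0ᴷ) ks → length ks ≤ D
      zeros-bound ks ks<p ks! values = ℕₚ.≮⇒≥ λ D< → contradiction
        (at (too-many-simple-roots f′ (map point ks) (points-unique ks<p ks!)
          (Allₚ.map⁺ (All.map (λ {k} eq → trans (eval-f′ k) eq) values))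
          (Deg<-mono (ℕₚ.≤-trans D< (ℕₚ.≤-reflexive (sym (length-map point ks)))) f′-deg)) 0) f′₀≢0

      ls : LevelSets (e∏ (t ∷ is)) p
      ls = levelSets (e∏ (t ∷ is)) (λ k → character-value (e∏-character (t ∷ is) k)) p
      open LevelSets ls

      bound₁ : length P * M ≤ M * D + (q * D + B + J * p)
      bound₁ = level-bound 1ᴷ P P< P! (All.map (λ {k} → residue⁻¹ (e∏-character (t ∷ is) k)) P-values)

      bound₂ : length N * M ≤ M * D + (q * D + B + J * p)
      bound₂ = level-bound (⊖ 1ᴷ) N N< N! (All.map (λ {k} → nonresidue⁻¹ (e∏-character (t ∷ is) k)) N-values)

      bound₃ : length Z ≤ D
      bound₃ = zeros-bound Z Z< Z! (All.map (λ {k} → vanishing⁻¹ (e∏-character (t ∷ is) k)) Z-values)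

      -- 2 · (upper bound for M |P|) exceeds M (|P| + |N|) ≥ M (p − D) by at most 3 M D + p (D + 3).
      difference-bound : ∀ P N Z → P * M ≤ M * D + (q * D + B + J * p) → Z ≤ D → P + N + Z ≡ p →
        M * P ≤ M * N + (3 * (M * D) + p * (D + 3))
      difference-bound P N Z boundP boundZ total = ℕₚ.+-cancelˡ-≤ (M * P) _ _ (begin
        M * P + M * P ≡⟨ cong₂ _+_ (ℕₚ.*-comm M P) (ℕₚ.*-comm M P) ⟩
        P * M + P * M ≤⟨ ℕₚ.+-mono-≤ boundP boundP ⟩
        (M * D + (q * D + B + J * p)) + (M * D + (q * D + B + J * p))
          ≡⟨ solve 6 (λ μ M D q B p → (M :* D :+ (q :* D :+ B :+ (con 1 :+ μ) :* p)) :+ (M :* D :+ (q :* D :+ B :+ (con 1 :+ μ) :* p))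
               := con 2 :* (M :* D) :+ (q :+ q) :* D :+ (B :+ B) :+ con 2 :* p :+ (μ :+ μ) :* p) refl μ M D q B p ⟩
        2 * (M * D) + (q + q) * D + (B + B) + 2 * p + M * p
          ≤⟨ ℕₚ.+-monoˡ-≤ (M * p) (ℕₚ.+-monoˡ-≤ (2 * p) (ℕₚ.+-mono-≤ (ℕₚ.+-monoʳ-≤ (2 * (M * D)) (ℕₚ.*-monoˡ-≤ D (ℕₚ.<⇒≤ q+q<p))) B+B≤p)) ⟩
        2 * (M * D) + p * D + p + 2 * p + M * p ≡⟨ cong (λ n → 2 * (M * D) + p * D + p + 2 * p + M * n) total ⟨
        2 * (M * D) + p * D + p + 2 * p + M * (P + N + Z) ≤⟨ ℕₚ.+-monoʳ-≤ _ (ℕₚ.*-monoʳ-≤ M (ℕₚ.+-monoʳ-≤ (P + N) boundZ)) ⟩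
        2 * (M * D) + p * D + p + 2 * p + M * (P + N + D)
          ≡⟨ solve 5 (λ M D p P N → con 2 :* (M :* D) :+ p :* D :+ p :+ con 2 :* p :+ M :* (P :+ N :+ D)
               := M :* P :+ (M :* N :+ (con 3 :* (M :* D) :+ p :* (D :+ con 3)))) refl M D p P N ⟩
        M * P + (M * N + (3 * (M * D) + p * (D + 3))) ∎)
        where
        open ℕₚ.≤-Reasoning
        open Data.Nat.Solver.+-*-Solver

    -- Twice the main term is 2 J p = M p + 2 p, and M p is cancelled by the total number of points.
    -- What remains of order p comes from this 2 p, from 2 q D ≤ p D and from 2 B ≤ p. Dividing by M
    -- beats the trivial bound p by about M / (D + 3).
    correlation-bound : M * ℤ.∣ ∑ p (e∏ (t ∷ is)) ∣ ≤ 3 * (M * D) + p * (D + 3)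
    correlation-bound = subst (_≤ 3 * (M * D) + p * (D + 3)) (sym (begin
      M * ℤ.∣ ∑ p (e∏ (t ∷ is)) ∣ ≡⟨ cong (λ z → M * ℤ.∣ z ∣) sum ⟩
      M * ℤ.∣ + length P ℤ.- + length N ∣ ≡⟨ ℤₚ.abs-* (+ M) (+ length P ℤ.- + length N) ⟨
      ℤ.∣ + M ℤ.* (+ length P ℤ.- + length N) ∣ ≡⟨ cong ℤ.∣_∣ (trans (ℤₚ.*-distribˡ-+ (+ M) (+ length P) (ℤ.- + length N))
        (cong₂ ℤ._+_ (sym (ℤₚ.pos-* M (length P))) (trans (sym (ℤₚ.neg-distribʳ-* (+ M) (+ length N))) (cong ℤ.-_ (sym (ℤₚ.pos-* M (length N))))))) ⟩
      ℤ.∣ + (M * length P) ℤ.- + (M * length N) ∣ ∎))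
      (∣m-n∣≤ (difference-bound (length P) (length N) (length Z) bound₁ bound₃ total)
              (difference-bound (length N) (length P) (length Z) bound₂ bound₃
                (trans (cong (_+ length Z) (ℕₚ.+-comm (length N) (length P))) total)))
      where open ≡-Reasoning

    zero-count : ∑ⁿ p (λ k → 1 ∸ ℤ.∣ e∏ (t ∷ is) k ∣) ≤ D
    zero-count = ℕₚ.≤-trans (ℕₚ.≤-reflexive zeros) bound₃

-- Finite sums: rearrangement, estimates and Cauchy-Schwarz.

∑-cong : ∀ n {f g} → (∀ k → f k ≡ g k) → ∑ n f ≡ ∑ n g
∑-cong zero eq = refl
∑-cong (suc n) eq = cong₂ ℤ._+_ (∑-cong n eq) (eq n)

∑-+ : ∀ n f g → ∑ n (λ k → f k ℤ.+ g k) ≡ ∑ n f ℤ.+ ∑ n g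
∑-+ zero f g = refl
∑-+ (suc n) f g = trans (cong (ℤ._+ (f n ℤ.+ g n)) (∑-+ n f g))
  (solve 4 (λ a b c d → (a :+ b) :+ (c :+ d) := (a :+ c) :+ (b :+ d)) refl (∑ n f) (∑ n g) (f n) (g n))
  where open Data.Integer.Solver.+-*-Solver

∑-*ˡ : ∀ n c f → ∑ n (λ k → c ℤ.* f k) ≡ c ℤ.* ∑ n f
∑-*ˡ zero c f = sym (ℤₚ.*-zeroʳ c)
∑-*ˡ (suc n) c f = trans (cong (ℤ._+ c ℤ.* f n) (∑-*ˡ n c f)) (sym (ℤₚ.*-distribˡ-+ c _ _))

∑-zero : ∀ n → ∑ n (λ _ → + 0) ≡ + 0
∑-zero zero = refl
∑-zero (suc n) = trans (ℤₚ.+-identityʳ _) (∑-zero n)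

∑-swap : ∀ n m (f : ℕ → ℕ → ℤ) → ∑ n (λ i → ∑ m (f i)) ≡ ∑ m (λ j → ∑ n (λ i → f i j))
∑-swap zero m f = sym (∑-zero m)
∑-swap (suc n) m f = trans (cong (ℤ._+ ∑ m (f n)) (∑-swap n m f)) (sym (∑-+ m _ (f n)))

∑-const : ∀ n c → ∑ n (λ _ → c) ≡ + n ℤ.* c
∑-const zero c = refl
∑-const (suc n) c = trans (cong (ℤ._+ c) (∑-const n c)) (trans (ℤₚ.+-comm _ c) (sym (ℤₚ.suc-* (+ n) c)))

∑-mono-≤ : ∀ n {f g} → (∀ k → f k ℤ.≤ g k) → ∑ n f ℤ.≤ ∑ n g
∑-mono-≤ zero le = ℤₚ.≤-refl
∑-mono-≤ (suc n) le = ℤₚ.+-mono-≤ (∑-mono-≤ n le) (le n)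

∣∑∣≤ : ∀ n f g → (∀ k → ℤ.∣ f k ∣ ≤ g k) → ℤ.∣ ∑ n f ∣ ≤ ∑ⁿ n g
∣∑∣≤ zero f g le = z≤n
∣∑∣≤ (suc n) f g le = ℕₚ.≤-trans (ℤₚ.∣i+j∣≤∣i∣+∣j∣ (∑ n f) (f n)) (ℕₚ.+-mono-≤ (∣∑∣≤ n f g le) (le n))

∑ⁿ-*ˡ : ∀ n c f → ∑ⁿ n (λ k → c * f k) ≡ c * ∑ⁿ n f
∑ⁿ-*ˡ zero c f = sym (ℕₚ.*-zeroʳ c)
∑ⁿ-*ˡ (suc n) c f = trans (cong (_+ c * f n) (∑ⁿ-*ˡ n c f)) (sym (ℕₚ.*-distribˡ-+ c (∑ⁿ n f) (f n)))

∣∑∣≤const : ∀ n f b → (∀ k → k < n → ℤ.∣ f k ∣ ≤ b) → ℤ.∣ ∑ n f ∣ ≤ n * b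
∣∑∣≤const zero f b le = z≤n
∣∑∣≤const (suc n) f b le = ℕₚ.≤-trans (ℤₚ.∣i+j∣≤∣i∣+∣j∣ (∑ n f) (f n)) (ℕₚ.≤-trans
  (ℕₚ.+-mono-≤ (∣∑∣≤const n f b λ k k<n → le k (ℕₚ.m≤n⇒m≤1+n k<n)) (le n ℕₚ.≤-refl)) (ℕₚ.≤-reflexive (ℕₚ.+-comm (n * b) b)))

∑-suc : ∀ n f → ∑ n (λ k → f (suc k)) ℤ.+ f 0 ≡ ∑ n f ℤ.+ f n
∑-suc zero f = refl
∑-suc (suc n) f = trans (solve 3 (λ a b c → (a :+ b) :+ c := (a :+ c) :+ b) refl (∑ n (λ k → f (suc k))) (f (suc n)) (f 0))
  (cong (ℤ._+ f (suc n)) (∑-suc n f))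
  where open Data.Integer.Solver.+-*-Solver

0≤i*i : ∀ i → + 0 ℤ.≤ i ℤ.* i
0≤i*i (+ n) = subst (+ 0 ℤ.≤_) (ℤₚ.pos-* n n) (ℤ.+≤+ z≤n)
0≤i*i -[1+ n ] = ℤ.+≤+ z≤n

∑-variance : ∀ n f w → ∑ n (λ k → (f k ℤ.- w) ℤ.* (f k ℤ.- w)) ≡
  ∑ n (λ k → f k ℤ.* f k) ℤ.- + 2 ℤ.* w ℤ.* ∑ n f ℤ.+ + n ℤ.* (w ℤ.* w)
∑-variance zero f w = solve 1 (λ w → con (+ 0) := con (+ 0) :- con (+ 2) :* w :* con (+ 0) :+ con (+ 0) :* (w :* w)) refl w
  where open Data.Integer.Solver.+-*-Solver
∑-variance (suc n) f w = trans (cong (ℤ._+ (f n ℤ.- w) ℤ.* (f n ℤ.- w)) (∑-variance n f w))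
  (solve 5 (λ Q A N w x → (Q :- con (+ 2) :* w :* A :+ N :* (w :* w)) :+ (x :- w) :* (x :- w)
    := (Q :+ x :* x) :- con (+ 2) :* w :* (A :+ x) :+ (con (+ 1) :+ N) :* (w :* w)) refl (∑ n (λ k → f k ℤ.* f k)) (∑ n f) (+ n) w (f n))
  where open Data.Integer.Solver.+-*-Solver

-- When the value f n is appended, the difference of the two sides grows by the sum of (f k - f n)²,
-- which `∑-variance` expands.
cauchy-schwarz : ∀ n f → ∑ n f ℤ.* ∑ n f ℤ.≤ + n ℤ.* ∑ n (λ k → f k ℤ.* f k)
cauchy-schwarz zero f = ℤₚ.≤-refl
cauchy-schwarz (suc n) f = ℤₚ.0≤i-j⇒j≤i (subst (+ 0 ℤ.≤_)
  (trans (cong (λ z → (+ n ℤ.* Q ℤ.- A ℤ.* A) ℤ.+ z) (∑-variance n f x))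
    (solve 4 (λ Q A N x → (N :* Q :- A :* A) :+ (Q :- con (+ 2) :* x :* A :+ N :* (x :* x))
      := (con (+ 1) :+ N) :* (Q :+ x :* x) :- (A :+ x) :* (A :+ x)) refl Q A (+ n) x))
  (ℤₚ.+-mono-≤ (ℤₚ.i≤j⇒0≤j-i (cauchy-schwarz n f)) nonneg))
  where
  open Data.Integer.Solver.+-*-Solver
  A = ∑ n f
  Q = ∑ n (λ k → f k ℤ.* f k)
  x = f n
  nonneg : + 0 ℤ.≤ ∑ n (λ k → (f k ℤ.- x) ℤ.* (f k ℤ.- x))
  nonneg = ℤₚ.≤-trans (ℤₚ.≤-reflexive (sym (∑-zero n))) (∑-mono-≤ n λ k → 0≤i*i (f k ℤ.- x))

[i+j]²≤ : ∀ i j → (i ℤ.+ j) ℤ.* (i ℤ.+ j) ℤ.≤ + 2 ℤ.* (i ℤ.* i) ℤ.+ + 2 ℤ.* (j ℤ.* j)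
[i+j]²≤ i j = ℤₚ.0≤i-j⇒j≤i (subst (+ 0 ℤ.≤_)
  (solve 2 (λ i j → (i :- j) :* (i :- j) := (con (+ 2) :* (i :* i) :+ con (+ 2) :* (j :* j)) :- (i :+ j) :* (i :+ j)) refl i j)
  (0≤i*i (i ℤ.- j)))
  where open Data.Integer.Solver.+-*-Solver

i≤+∣i∣ : ∀ i → i ℤ.≤ + ℤ.∣ i ∣
i≤+∣i∣ (+ n) = ℤₚ.≤-refl
i≤+∣i∣ -[1+ n ] = ℤ.-≤+

i*i≡∣i∣*∣i∣ : ∀ i → i ℤ.* i ≡ + (ℤ.∣ i ∣ * ℤ.∣ i ∣)
i*i≡∣i∣*∣i∣ (+ n) = sym (ℤₚ.pos-* n n)
i*i≡∣i∣*∣i∣ -[1+ n ] = refl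

∣i∣≤⇒i*i≤ : ∀ i {b} → ℤ.∣ i ∣ ≤ b → i ℤ.* i ℤ.≤ + (b * b)
∣i∣≤⇒i*i≤ i le = ℤₚ.≤-trans (ℤₚ.≤-reflexive (i*i≡∣i∣*∣i∣ i)) (ℤ.+≤+ (ℕₚ.*-mono-≤ le le))

∣i*j∣≤ : ∀ i j {a b} → ℤ.∣ i ∣ ≤ a → ℤ.∣ j ∣ ≤ b → ℤ.∣ i ℤ.* j ∣ ≤ a * b
∣i*j∣≤ i j le le′ = ℕₚ.≤-trans (ℕₚ.≤-reflexive (ℤₚ.abs-* i j)) (ℕₚ.*-mono-≤ le le′)

∣i+j∣≤ : ∀ i j {a b} → ℤ.∣ i ∣ ≤ a → ℤ.∣ j ∣ ≤ b → ℤ.∣ i ℤ.+ j ∣ ≤ a + b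
∣i+j∣≤ i j le le′ = ℕₚ.≤-trans (ℤₚ.∣i+j∣≤∣i∣+∣j∣ i j) (ℕₚ.+-mono-≤ le le′)

∣i-j∣≤ : ∀ i j {a b} → ℤ.∣ i ∣ ≤ a → ℤ.∣ j ∣ ≤ b → ℤ.∣ i ℤ.- j ∣ ≤ a + b
∣i-j∣≤ i j le le′ = ∣i+j∣≤ i (ℤ.- j) le (ℕₚ.≤-trans (ℕₚ.≤-reflexive (ℤₚ.∣-i∣≡∣i∣ j)) le′)

-- Passing from x to x + 1 adds the term Q(x + 1) and drops Q(x + 1 - m), which are equal.
∑-periodic : ∀ m (Q : ℤ → ℤ) → (∀ x → Q (x ℤ.- + m) ≡ Q x) → ∀ x → ∑ m (λ a → Q (x ℤ.- + a)) ≡ ∑ m (λ a → Q (+ 0 ℤ.- + a))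
∑-periodic m Q periodic = all
  where
  open ≡-Reasoning
  open Data.Integer.Solver.+-*-Solver
  P : ℤ → ℤ
  P x = ∑ m (λ a → Q (x ℤ.- + a))
  shifted : ∀ n x → ∑ n (λ a → Q ((x ℤ.+ + 1) ℤ.- + a)) ℤ.+ Q ((x ℤ.+ + 1) ℤ.- + n) ≡ Q (x ℤ.+ + 1) ℤ.+ ∑ n (λ a → Q (x ℤ.- + a))
  shifted zero x = trans (ℤₚ.+-identityˡ _) (trans (cong Q (ℤₚ.+-identityʳ _)) (sym (ℤₚ.+-identityʳ _)))
  shifted (suc n) x = trans (cong₂ ℤ._+_ (shifted n x) (cong Q (solve 2 (λ x n → (x :+ con (+ 1)) :- (con (+ 1) :+ n) := x :- n) refl x (+ n))))
    (ℤₚ.+-assoc (Q (x ℤ.+ + 1)) (∑ n (λ a → Q (x ℤ.- + a))) (Q (x ℤ.- + n)))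
  step : ∀ x → P (x ℤ.+ + 1) ≡ P x
  step x = begin
    P (x ℤ.+ + 1) ≡⟨ solve 2 (λ a b → a := (a :+ b) :- b) refl (P (x ℤ.+ + 1)) (Q (x ℤ.+ + 1)) ⟩
    (P (x ℤ.+ + 1) ℤ.+ Q (x ℤ.+ + 1)) ℤ.- Q (x ℤ.+ + 1) ≡⟨ cong (λ z → (P (x ℤ.+ + 1) ℤ.+ z) ℤ.- Q (x ℤ.+ + 1)) (periodic (x ℤ.+ + 1)) ⟨
    (P (x ℤ.+ + 1) ℤ.+ Q ((x ℤ.+ + 1) ℤ.- + m)) ℤ.- Q (x ℤ.+ + 1) ≡⟨ cong (ℤ._- Q (x ℤ.+ + 1)) (shifted m x) ⟩
    (Q (x ℤ.+ + 1) ℤ.+ P x) ℤ.- Q (x ℤ.+ + 1) ≡⟨ solve 2 (λ a b → (a :+ b) :- a := b) refl (Q (x ℤ.+ + 1)) (P x) ⟩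
    P x ∎
  nonneg : ∀ n → P (+ n) ≡ P (+ 0)
  nonneg zero = refl
  nonneg (suc n) = trans (cong P (ℤₚ.+-comm (+ 1) (+ n))) (trans (step (+ n)) (nonneg n))
  negative : ∀ n → P (ℤ.- + n) ≡ P (+ 0)
  negative zero = refl
  negative (suc n) = trans (sym (step (ℤ.- + suc n))) (trans
    (cong P (solve 1 (λ n → :- (con (+ 1) :+ n) :+ con (+ 1) := :- n) refl (+ n))) (negative n))
  all : ∀ x → P x ≡ P (+ 0)
  all (+ n) = nonneg n
  all -[1+ n ] = negative (suc n)

-- Quadratic potential on the residues modulo m.

module Potential (n : ℕ) where
  private
    m = suc n
    open Data.Integer.Solver.+-*-Solver

  ρ : ℤ → ℕ
  ρ x = x %ℕ m

  ρ<m : ∀ x → ρ x < m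
  ρ<m x = n%ℕd<d x m

  ρ-unique : ∀ x r t → r < m → x ≡ + r ℤ.+ t ℤ.* + m → ρ x ≡ r
  ρ-unique x r t r<m eq = ℤₚ.+-injective (ℤₚ.i-j≡0⇒i≡j (+ ρ x) (+ r) difference≡0)
    where
    t₀ = x /ℕ m
    difference : + ρ x ℤ.- + r ≡ (t ℤ.- t₀) ℤ.* + m
    difference = trans (solve 4 (λ a r t₀ m → a :- r := (a :+ t₀ :* m) :- (r :+ t₀ :* m)) refl (+ ρ x) (+ r) t₀ (+ m))
      (trans (cong (ℤ._- (+ r ℤ.+ t₀ ℤ.* + m)) (trans (sym (a≡a%ℕn+[a/ℕn]*n x m)) eq))
        (solve 4 (λ r t t₀ m → (r :+ t :* m) :- (r :+ t₀ :* m) := (t :- t₀) :* m) refl (+ r) t t₀ (+ m)))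
    small : ℤ.∣ + ρ x ℤ.- + r ∣ < m
    small = s≤s (∣m-n∣≤ {ρ x} {r} {n} (ℕₚ.≤-trans (ℕ.s≤s⁻¹ (ρ<m x)) (ℕₚ.m≤n+m n r)) (ℕₚ.≤-trans (ℕ.s≤s⁻¹ r<m) (ℕₚ.m≤n+m n (ρ x))))
    multiple : ∀ k → ℤ.∣ k ℤ.* + m ∣ < m → k ≡ + 0
    multiple k lt = ℤₚ.∣i∣≡0⇒i≡0 (zero-multiple ℤ.∣ k ∣ (subst (_< m) (ℤₚ.abs-* k (+ m)) lt))
      where
      zero-multiple : ∀ k → k * m < m → k ≡ 0
      zero-multiple zero _ = refl
      zero-multiple (suc k) lt = contradiction (ℕₚ.m≤m+n m (k * m)) (ℕₚ.<⇒≱ lt)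
    difference≡0 : + ρ x ℤ.- + r ≡ + 0
    difference≡0 = trans difference (cong (ℤ._* + m) (multiple (t ℤ.- t₀) (subst (λ z → ℤ.∣ z ∣ < m) difference small)))

  ρ-split : ∀ x → x ≡ + ρ x ℤ.+ (x /ℕ m) ℤ.* + m
  ρ-split x = a≡a%ℕn+[a/ℕn]*n x m

  ρ-periodic : ∀ x → ρ (x ℤ.- + m) ≡ ρ x
  ρ-periodic x = ρ-unique (x ℤ.- + m) (ρ x) (x /ℕ m ℤ.- + 1) (ρ<m x) (trans (cong (ℤ._- + m) (ρ-split x))
    (solve 3 (λ r t m → (r :+ t :* m) :- m := r :+ (t :- con (+ 1)) :* m) refl (+ ρ x) (x /ℕ m) (+ m)))

  isZero : ℕ → ℤ
  isZero zero = + 1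
  isZero (suc _) = + 0

  -- A parabola with second difference -2 everywhere; repeated with period m it has a kink at the
  -- multiples of m, which contributes the source 2 m.
  quadratic : ℤ → ℤ
  quadratic r = r ℤ.* (+ m ℤ.- r)

  u : ℤ → ℤ
  u x = quadratic (+ ρ x)

  V : ℤ → ℤ
  V x = u (x ℤ.+ + 1) ℤ.- u (x ℤ.- + 1)

  -- No correction at the wrap-around from m - 1 to m, since the parabola vanishes at m as well as
  -- at 0.
  u-suc : ∀ x → u (x ℤ.+ + 1) ≡ quadratic (+ ρ x ℤ.+ + 1)
  u-suc x with ℕₚ.m≤n⇒m<n∨m≡n (ρ<m x)
  ... | inj₁ 1+r<m = cong quadratic (trans (cong +_ (ρ-unique (x ℤ.+ + 1) (suc (ρ x)) (x /ℕ m) 1+r<m (trans (cong (ℤ._+ + 1) (ρ-split x))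
    (solve 3 (λ r t m → (r :+ t :* m) :+ con (+ 1) := (con (+ 1) :+ r) :+ t :* m) refl (+ ρ x) (x /ℕ m) (+ m))))) (ℤₚ.+-comm (+ 1) (+ ρ x)))
  ... | inj₂ 1+r≡m = trans (cong (λ r → quadratic (+ r)) (ρ-unique (x ℤ.+ + 1) 0 (x /ℕ m ℤ.+ + 1) (s≤s z≤n) (trans (cong (ℤ._+ + 1) (ρ-split x))
      (trans (solve 3 (λ r t m → (r :+ t :* m) :+ con (+ 1) := (con (+ 1) :+ r) :+ t :* m) refl (+ ρ x) (x /ℕ m) (+ m))
        (trans (cong (λ k → + k ℤ.+ (x /ℕ m) ℤ.* + m) 1+r≡m)
          (solve 2 (λ t m → m :+ t :* m := con (+ 0) :+ (t :+ con (+ 1)) :* m) refl (x /ℕ m) (+ m)))))))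
    (trans (solve 1 (λ m → con (+ 0) :* (m :- con (+ 0)) := m :* (m :- m)) refl (+ m))
      (cong quadratic (trans (cong +_ (sym 1+r≡m)) (ℤₚ.+-comm (+ 1) (+ ρ x)))))

  -- At residue 0 the parabola gives -(m + 1) at -1, whereas the residue m - 1 has potential m - 1;
  -- the gap is 2 m.
  u-pred : ∀ x → u (x ℤ.- + 1) ≡ quadratic (+ ρ x ℤ.- + 1) ℤ.+ + 2 ℤ.* + m ℤ.* isZero (ρ x)
  u-pred x = by-cases (ρ x) refl
    where
    by-cases : ∀ r → ρ x ≡ r → u (x ℤ.- + 1) ≡ quadratic (+ r ℤ.- + 1) ℤ.+ + 2 ℤ.* + m ℤ.* isZero r
    by-cases zero eq = trans (cong (λ r → quadratic (+ r)) (ρ-unique (x ℤ.- + 1) n (x /ℕ m ℤ.- + 1) (ℕₚ.n<1+n n)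
        (trans (cong (ℤ._- + 1) (trans (ρ-split x) (cong (λ r → + r ℤ.+ (x /ℕ m) ℤ.* + m) eq)))
          (solve 2 (λ n t → (con (+ 0) :+ t :* (con (+ 1) :+ n)) :- con (+ 1) := n :+ (t :- con (+ 1)) :* (con (+ 1) :+ n)) refl (+ n) (x /ℕ m)))))
      (solve 1 (λ n → n :* ((con (+ 1) :+ n) :- n)
        := (con (+ 0) :- con (+ 1)) :* ((con (+ 1) :+ n) :- (con (+ 0) :- con (+ 1))) :+ con (+ 2) :* (con (+ 1) :+ n) :* con (+ 1)) refl (+ n))
    by-cases (suc r) eq = trans (cong (λ r → quadratic (+ r)) (ρ-unique (x ℤ.- + 1) r (x /ℕ m)
        (ℕₚ.<-trans (ℕₚ.n<1+n r) (subst (_< m) eq (ρ<m x)))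
        (trans (cong (ℤ._- + 1) (trans (ρ-split x) (cong (λ r → + r ℤ.+ (x /ℕ m) ℤ.* + m) eq)))
          (solve 3 (λ r t m → ((con (+ 1) :+ r) :+ t :* m) :- con (+ 1) := r :+ t :* m) refl (+ r) (x /ℕ m) (+ m)))))
      (solve 2 (λ r m → r :* (m :- r)
        := ((con (+ 1) :+ r) :- con (+ 1)) :* (m :- ((con (+ 1) :+ r) :- con (+ 1))) :+ con (+ 2) :* m :* con (+ 0)) refl (+ r) (+ m))

  -- The Poisson equation for the walk on ℤ/m with source at 0, multiplied by 2m.
  laplacian : ∀ x → u (x ℤ.+ + 1) ℤ.+ u (x ℤ.- + 1) ≡ + 2 ℤ.* u x ℤ.+ (+ 2 ℤ.* + m ℤ.* isZero (ρ x) ℤ.- + 2)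
  laplacian x = trans (cong₂ ℤ._+_ (u-suc x) (u-pred x))
    (solve 3 (λ r m z → (r :+ con (+ 1)) :* (m :- (r :+ con (+ 1))) :+ ((r :- con (+ 1)) :* (m :- (r :- con (+ 1))) :+ con (+ 2) :* m :* z)
      := con (+ 2) :* (r :* (m :- r)) :+ (con (+ 2) :* m :* z :- con (+ 2))) refl (+ ρ x) (+ m) (isZero (ρ x)))

  V≡ : ∀ x → V x ≡ + 2 ℤ.* + m ℤ.- + 4 ℤ.* + ρ x ℤ.- + 2 ℤ.* + m ℤ.* isZero (ρ x)
  V≡ x = trans (cong₂ ℤ._-_ (u-suc x) (u-pred x))
    (solve 3 (λ r m z → (r :+ con (+ 1)) :* (m :- (r :+ con (+ 1))) :- ((r :- con (+ 1)) :* (m :- (r :- con (+ 1))) :+ con (+ 2) :* m :* z)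
      := con (+ 2) :* m :- con (+ 4) :* r :- con (+ 2) :* m :* z) refl (+ ρ x) (+ m) (isZero (ρ x)))

  ∣V∣≤ : ∀ x → ℤ.∣ V x ∣ ≤ 2 * m
  ∣V∣≤ x = subst (λ z → ℤ.∣ z ∣ ≤ 2 * m) (sym (V≡ x)) (by-cases (ρ x) (ρ<m x))
    where
    by-cases : ∀ r → r < m → ℤ.∣ + 2 ℤ.* + m ℤ.- + 4 ℤ.* + r ℤ.- + 2 ℤ.* + m ℤ.* isZero r ∣ ≤ 2 * m
    by-cases zero _ = subst (λ z → ℤ.∣ z ∣ ≤ 2 * m)
      (solve 1 (λ m → con (+ 0) := con (+ 2) :* m :- con (+ 4) :* con (+ 0) :- con (+ 2) :* m :* con (+ 1)) refl (+ m)) z≤n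
    by-cases (suc r) r<m = subst (λ z → ℤ.∣ z ∣ ≤ 2 * m)
      (trans (cong₂ ℤ._-_ (ℤₚ.pos-* 2 m) (ℤₚ.pos-* 4 (suc r)))
        (solve 2 (λ m r → con (+ 2) :* m :- con (+ 4) :* r := con (+ 2) :* m :- con (+ 4) :* r :- con (+ 2) :* m :* con (+ 0)) refl (+ m) (+ suc r)))
      (∣m-n∣≤ {2 * m} {4 * suc r} (ℕₚ.m≤n+m (2 * m) (4 * suc r))
        (ℕₚ.≤-trans (ℕₚ.*-monoʳ-≤ 4 (ℕₚ.<⇒≤ r<m)) (ℕₚ.≤-reflexive (ℕₚ.*-distribʳ-+ m 2 2))))

  ∣u∣≤ : ∀ x → ℤ.∣ u x ∣ ≤ m * m
  ∣u∣≤ x = ∣i*j∣≤ (+ ρ x) (+ m ℤ.- + ρ x) (ℕₚ.<⇒≤ (ρ<m x))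
    (∣m-n∣≤ {m} {ρ x} (ℕₚ.m≤n+m m (ρ x)) (ℕₚ.≤-trans (ℕₚ.<⇒≤ (ρ<m x)) (ℕₚ.m≤m+n m m)))

  V-periodic : ∀ x → V (x ℤ.- + m) ≡ V x
  V-periodic x = trans (V≡ (x ℤ.- + m)) (trans
    (cong (λ r → + 2 ℤ.* + m ℤ.- + 4 ℤ.* + r ℤ.- + 2 ℤ.* + m ℤ.* isZero r) (ρ-periodic x)) (sym (V≡ x)))

  isZero-ρ : ∀ x a → a < m → isZero (ρ (x ℤ.- + a)) ≡ + (if ρ x ≡ᵇ a then 1 else 0)
  isZero-ρ x a a<m = by-cases (ρ x ≡ᵇ a) refl
    where
    hit : ρ x ≡ a → ρ (x ℤ.- + a) ≡ 0
    hit eq = ρ-unique (x ℤ.- + a) 0 (x /ℕ m) (s≤s z≤n) (trans (cong (ℤ._- + a) (trans (ρ-split x) (cong (λ r → + r ℤ.+ (x /ℕ m) ℤ.* + m) eq)))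
      (solve 3 (λ a t m → (a :+ t :* m) :- a := con (+ 0) :+ t :* m) refl (+ a) (x /ℕ m) (+ m)))
    hit⁻¹ : ρ (x ℤ.- + a) ≡ 0 → ρ x ≡ a
    hit⁻¹ eq = ρ-unique x a ((x ℤ.- + a) /ℕ m) a<m (trans (solve 2 (λ x a → x := a :+ (x :- a)) refl x (+ a))
      (cong (λ z → + a ℤ.+ z) (trans (ρ-split (x ℤ.- + a)) (trans (cong (λ r → + r ℤ.+ ((x ℤ.- + a) /ℕ m) ℤ.* + m) eq) (ℤₚ.+-identityˡ ((x ℤ.- + a) /ℕ m ℤ.* + m))))))
    by-cases : ∀ b → (ρ x ≡ᵇ a) ≡ b → isZero (ρ (x ℤ.- + a)) ≡ + (if b then 1 else 0)
    by-cases true eq = cong isZero (hit (ℕₚ.≡ᵇ⇒≡ (ρ x) a (subst IsTrue (sym eq) _)))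
    by-cases false eq = nonzero (ρ (x ℤ.- + a)) refl
      where
      nonzero : ∀ r → ρ (x ℤ.- + a) ≡ r → isZero r ≡ + 0
      nonzero zero r≡0 = ⊥-elim (subst IsTrue eq (ℕₚ.≡⇒≡ᵇ (ρ x) a (hit⁻¹ r≡0)))
      nonzero (suc r) _ = refl

-- The walk: windows, energy and the second moment of the hitting counts.

module Walk (n : ℕ) (e s : ℕ → ℤ) (e-value : ∀ k → IsCharacterValue (e k)) (s-step : ∀ k → s (suc k) ≡ s k ℤ.+ e (suc k))
            (p D E L : ℕ) (zeros : ∀ t → ∑ⁿ p (λ k → 1 ∸ ℤ.∣ e (k + t) ∣) ≤ D)
            (correlation : ∀ t is → All (λ i → i < t × t ≤ i + L) is → length is ≤ suc L → ℤ.∣ ∑ p (shiftProduct e (t ∷ is)) ∣ ≤ E) where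
  open Potential n

  private
    m = suc n
    open Data.Integer.Solver.+-*-Solver

  ζ : ℤ → ℤ
  ζ x = + (1 ∸ ℤ.∣ x ∣)

  ∣e∣≤1 : ∀ k → ℤ.∣ e k ∣ ≤ 1
  ∣e∣≤1 k = by-cases (e-value k)
    where
    by-cases : ∀ {z} → IsCharacterValue z → ℤ.∣ z ∣ ≤ 1
    by-cases value0 = z≤n
    by-cases value1 = ℕₚ.≤-refl
    by-cases value-1 = ℕₚ.≤-refl

  ∣shiftProduct∣≤1 : ∀ is k → ℤ.∣ shiftProduct e is k ∣ ≤ 1
  ∣shiftProduct∣≤1 [] k = ℕₚ.≤-refl
  ∣shiftProduct∣≤1 (i ∷ is) k = ∣i*j∣≤ (e (k + i)) (shiftProduct e is k) (∣e∣≤1 (k + i)) (∣shiftProduct∣≤1 is k)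

  -- A function of a sign ε ∈ {−1, 0, 1} is affine in ε, up to a correction at ε = 0.
  affine : (G : ℤ → ℤ) → ∀ z {ε} → IsCharacterValue ε → + 2 ℤ.* G (z ℤ.+ ε) ≡
    (G (z ℤ.+ + 1) ℤ.+ G (z ℤ.- + 1)) ℤ.+ ε ℤ.* (G (z ℤ.+ + 1) ℤ.- G (z ℤ.- + 1))
      ℤ.+ ζ ε ℤ.* (+ 2 ℤ.* G z ℤ.- (G (z ℤ.+ + 1) ℤ.+ G (z ℤ.- + 1)))
  affine G z value0 = trans (cong (λ x → + 2 ℤ.* G x) (ℤₚ.+-identityʳ z))
    (solve 3 (λ a b c → con (+ 2) :* a := (b :+ c) :+ con (+ 0) :* (b :- c) :+ con (+ 1) :* (con (+ 2) :* a :- (b :+ c)))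
      refl (G z) (G (z ℤ.+ + 1)) (G (z ℤ.- + 1)))
  affine G z value1 =
    solve 3 (λ a b c → con (+ 2) :* b := (b :+ c) :+ con (+ 1) :* (b :- c) :+ con (+ 0) :* (con (+ 2) :* a :- (b :+ c)))
      refl (G z) (G (z ℤ.+ + 1)) (G (z ℤ.- + 1))
  affine G z value-1 =
    solve 3 (λ a b c → con (+ 2) :* c := (b :+ c) :+ con -[1+ 0 ] :* (b :- c) :+ con (+ 0) :* (con (+ 2) :* a :- (b :+ c)))
      refl (G z) (G (z ℤ.+ + 1)) (G (z ℤ.- + 1))

  window : ℕ → ℕ → ℕ → ℤ
  window b h k = ∑ h (λ l → e (k + (b + l)))

  -- Removing one increment from the window doubles the number of products to be bounded; 2 D pays
  -- for the points where that increment is 0.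
  windowBound : ℕ → ℕ
  windowBound zero = E
  windowBound (suc h) = 2 * windowBound h + 2 * D

  windowBound-closed : ∀ h → windowBound h + 2 * D ≡ 2 ^ h * (E + 2 * D)
  windowBound-closed zero = sym (ℕₚ.*-identityˡ _)
  windowBound-closed (suc h) = trans (solveℕ 2 (λ w D → (conℕ 2 :*ℕ w :+ℕ conℕ 2 :*ℕ D) :+ℕ conℕ 2 :*ℕ D :=ℕ conℕ 2 :*ℕ (w :+ℕ conℕ 2 :*ℕ D)) refl (windowBound h) D)
    (trans (cong (2 *_) (windowBound-closed h)) (sym (ℕₚ.*-assoc 2 (2 ^ h) (E + 2 * D))))
    where open Data.Nat.Solver.+-*-Solver renaming (solve to solveℕ; con to conℕ; _:+_ to _:+ℕ_; _:*_ to _:*ℕ_; _:=_ to _:=ℕ_)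

  windowBound-≤ : ∀ h → h ≤ L → windowBound h ≤ 2 ^ L * (E + 2 * D)
  windowBound-≤ h h≤L = ℕₚ.≤-trans (ℕₚ.m≤m+n _ (2 * D)) (ℕₚ.≤-trans (ℕₚ.≤-reflexive (windowBound-closed h))
    (ℕₚ.*-monoˡ-≤ (E + 2 * D) (ℕₚ.^-monoʳ-≤ 2 h≤L)))

  -- By `affine` in the last increment of the window, twice the sum splits into one with `G₊` and
  -- the same product, one with `G₋` and that increment joined to the product, and a sum over its
  -- zeros. `G₊` and `G₋` are again arbitrary functions, bounded by K + K; this doubling cancels the
  -- factor 2 on the left. The top shift `t` lies beyond the window, so it stays the largest shift
  -- throughout.
  window-correlation : ∀ h (G : ℤ → ℤ) K → (∀ z → ℤ.∣ G z ∣ ≤ K) → ∀ t b is → b + h ≤ t → t ≤ b + L →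
    All (λ i → i < t × t ≤ i + L) is → length is + h ≤ suc L →
    ℤ.∣ ∑ p (λ k → shiftProduct e (t ∷ is) k ℤ.* G (window b h k)) ∣ ≤ K * windowBound h
  window-correlation zero G K G≤K t b is _ _ inWindow len = ℕₚ.≤-trans
    (ℕₚ.≤-reflexive (cong ℤ.∣_∣ (trans (∑-cong p λ k → ℤₚ.*-comm (shiftProduct e (t ∷ is) k) (G (+ 0))) (∑-*ˡ p (G (+ 0)) (shiftProduct e (t ∷ is))))))
    (∣i*j∣≤ (G (+ 0)) (∑ p (shiftProduct e (t ∷ is))) (G≤K (+ 0)) (correlation t is inWindow (subst (_≤ suc L) (ℕₚ.+-identityʳ _) len)))
  window-correlation (suc h) G K G≤K t b is b+1+h≤t t≤b+L inWindow len = ℕₚ.*-cancelˡ-≤ 2 (begin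
    2 * ℤ.∣ ∑ p (λ k → P k ℤ.* G (window b (suc h) k)) ∣ ≡⟨ ℤₚ.abs-* (+ 2) (∑ p (λ k → P k ℤ.* G (window b (suc h) k))) ⟨
    ℤ.∣ + 2 ℤ.* ∑ p (λ k → P k ℤ.* G (window b (suc h) k)) ∣ ≡⟨ cong ℤ.∣_∣ split ⟩
    ℤ.∣ (∑ p (λ k → P k ℤ.* G₊ (window b h k)) ℤ.+ ∑ p (λ k → P′ k ℤ.* G₋ (window b h k))) ℤ.+ ∑ p Zterm ∣
      ≤⟨ ∣i+j∣≤ (∑ p (λ k → P k ℤ.* G₊ (window b h k)) ℤ.+ ∑ p (λ k → P′ k ℤ.* G₋ (window b h k))) (∑ p Zterm)
           (∣i+j∣≤ (∑ p (λ k → P k ℤ.* G₊ (window b h k))) (∑ p (λ k → P′ k ℤ.* G₋ (window b h k))) bound₊ bound₋) boundZ ⟩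
    (K + K) * windowBound h + (K + K) * windowBound h + (2 * K + (K + K)) * D
      ≡⟨ solveℕ 3 (λ K w D → (K :+ℕ K) :*ℕ w :+ℕ (K :+ℕ K) :*ℕ w :+ℕ (conℕ 2 :*ℕ K :+ℕ (K :+ℕ K)) :*ℕ D
           :=ℕ conℕ 2 :*ℕ (K :*ℕ (conℕ 2 :*ℕ w :+ℕ conℕ 2 :*ℕ D))) refl K (windowBound h) D ⟩
    2 * (K * windowBound (suc h)) ∎)
    where
    open ℕₚ.≤-Reasoning
    open Data.Nat.Solver.+-*-Solver using () renaming (solve to solveℕ; con to conℕ; _:+_ to _:+ℕ_; _:*_ to _:*ℕ_; _:=_ to _:=ℕ_)
    P = shiftProduct e (t ∷ is)
    P′ = shiftProduct e (t ∷ (b + h) ∷ is)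
    G₊ G₋ G₀ : ℤ → ℤ
    G₊ z = G (z ℤ.+ + 1) ℤ.+ G (z ℤ.- + 1)
    G₋ z = G (z ℤ.+ + 1) ℤ.- G (z ℤ.- + 1)
    G₀ z = + 2 ℤ.* G z ℤ.- G₊ z
    Zterm : ℕ → ℤ
    Zterm k = P k ℤ.* (ζ (e (k + (b + h))) ℤ.* G₀ (window b h k))
    b+h<t : b + h < t
    b+h<t = ℕₚ.≤-trans (ℕₚ.≤-reflexive (sym (ℕₚ.+-suc b h))) b+1+h≤t
    split : + 2 ℤ.* ∑ p (λ k → P k ℤ.* G (window b (suc h) k)) ≡
      (∑ p (λ k → P k ℤ.* G₊ (window b h k)) ℤ.+ ∑ p (λ k → P′ k ℤ.* G₋ (window b h k))) ℤ.+ ∑ p Zterm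
    split = trans (sym (∑-*ˡ p (+ 2) _)) (trans (∑-cong p term)
      (trans (∑-+ p (λ k → P k ℤ.* G₊ (window b h k) ℤ.+ P′ k ℤ.* G₋ (window b h k)) Zterm)
        (cong (ℤ._+ ∑ p Zterm) (∑-+ p (λ k → P k ℤ.* G₊ (window b h k)) (λ k → P′ k ℤ.* G₋ (window b h k))))))
      where
      term : ∀ k → + 2 ℤ.* (P k ℤ.* G (window b (suc h) k)) ≡ (P k ℤ.* G₊ (window b h k) ℤ.+ P′ k ℤ.* G₋ (window b h k)) ℤ.+ Zterm k
      term k = trans (solve 2 (λ P g → con (+ 2) :* (P :* g) := P :* (con (+ 2) :* g)) refl (P k) (G (window b (suc h) k)))
        (trans (cong (ℤ._*_ (P k)) (affine G (window b h k) (e-value (k + (b + h)))))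
          (solve 6 (λ et P ε g₊ g₋ z → (et :* P) :* (g₊ :+ ε :* g₋ :+ z) := ((et :* P) :* g₊ :+ (et :* (ε :* P)) :* g₋) :+ (et :* P) :* z) refl
            (e (k + t)) (shiftProduct e is k) (e (k + (b + h))) (G₊ (window b h k)) (G₋ (window b h k)) (ζ (e (k + (b + h))) ℤ.* G₀ (window b h k))))
    bound₊ : ℤ.∣ ∑ p (λ k → P k ℤ.* G₊ (window b h k)) ∣ ≤ (K + K) * windowBound h
    bound₊ = window-correlation h G₊ (K + K) (λ z → ∣i+j∣≤ (G (z ℤ.+ + 1)) (G (z ℤ.- + 1)) (G≤K _) (G≤K _)) t b is (ℕₚ.<⇒≤ b+h<t) t≤b+L inWindow
      (ℕₚ.≤-trans (ℕₚ.+-monoʳ-≤ (length is) (ℕₚ.n≤1+n h)) len)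
    bound₋ : ℤ.∣ ∑ p (λ k → P′ k ℤ.* G₋ (window b h k)) ∣ ≤ (K + K) * windowBound h
    bound₋ = window-correlation h G₋ (K + K) (λ z → ∣i-j∣≤ (G (z ℤ.+ + 1)) (G (z ℤ.- + 1)) (G≤K _) (G≤K _)) t b ((b + h) ∷ is) (ℕₚ.<⇒≤ b+h<t) t≤b+L
      ((b+h<t , ℕₚ.≤-trans t≤b+L (ℕₚ.+-monoˡ-≤ L (ℕₚ.m≤m+n b h))) ∷ inWindow)
      (ℕₚ.≤-trans (ℕₚ.≤-reflexive (sym (ℕₚ.+-suc (length is) h))) len)
    boundZ : ℤ.∣ ∑ p Zterm ∣ ≤ (2 * K + (K + K)) * D
    boundZ = ℕₚ.≤-trans (∣∑∣≤ p Zterm (λ k → (2 * K + (K + K)) * (1 ∸ ℤ.∣ e (k + (b + h)) ∣)) λ k → begin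
        ℤ.∣ Zterm k ∣ ≤⟨ ∣i*j∣≤ (P k) _ (∣shiftProduct∣≤1 (t ∷ is) k) (∣i*j∣≤ (ζ (e (k + (b + h)))) (G₀ (window b h k)) ℕₚ.≤-refl
          (∣i-j∣≤ (+ 2 ℤ.* G (window b h k)) (G₊ (window b h k)) (∣i*j∣≤ (+ 2) (G (window b h k)) ℕₚ.≤-refl (G≤K _))
            (∣i+j∣≤ (G (window b h k ℤ.+ + 1)) (G (window b h k ℤ.- + 1)) (G≤K _) (G≤K _)))) ⟩
        1 * ((1 ∸ ℤ.∣ e (k + (b + h)) ∣) * (2 * K + (K + K))) ≡⟨ trans (ℕₚ.*-identityˡ _) (ℕₚ.*-comm (1 ∸ ℤ.∣ e (k + (b + h)) ∣) (2 * K + (K + K))) ⟩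
        (2 * K + (K + K)) * (1 ∸ ℤ.∣ e (k + (b + h)) ∣) ∎)
      (ℕₚ.≤-trans (ℕₚ.≤-reflexive (∑ⁿ-*ˡ p (2 * K + (K + K)) (λ k → 1 ∸ ℤ.∣ e (k + (b + h)) ∣))) (ℕₚ.*-monoʳ-≤ (2 * K + (K + K)) (zeros (b + h))))

  hit : ℕ → ℕ → ℤ
  hit a k = isZero (ρ (s k ℤ.- + a))

  deviation : ℕ → ℕ → ℤ
  deviation a k = + 2 ℤ.* + m ℤ.* hit a k ℤ.- + 2

  -- Twice m · #{1 ≤ k ≤ p : s k ≡ a} − p.
  δ : ℕ → ℤ
  δ a = ∑ p (λ k → deviation a (suc k))

  -- The positions 1, ..., p are indexed from 0, so index k stands for position k + 1, and the
  -- increment that leaves it is e (k + 2).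
  y : ℕ → ℕ → ℤ
  y a k = e (suc (suc k)) ℤ.* V (s (suc k) ℤ.- + a)

  T : ℕ → ℤ
  T a = ∑ p (y a)

  w : ℕ → ℕ → ℤ
  w a k = + 2 ℤ.* u (s k ℤ.- + a)

  ztail : ℕ → ℕ → ℤ
  ztail a k = ζ (e (suc (suc k))) ℤ.* deviation a (suc k)

  -- `affine` writes the potential at the next position as a mean over both neighbours, evaluated by
  -- `laplacian`, plus a part linear in the increment, which is `y`. Where the increment is 0 the
  -- deviation from the mean has to be undone, which is `ztail`. The differences of `w` telescope
  -- when summed.
  potential-step : ∀ a k → deviation a (suc k) ≡ ((w a (suc (suc k)) ℤ.- w a (suc k)) ℤ.- y a k) ℤ.+ ztail a k
  potential-step a k = trans
    (solve 5 (λ c u v ε z → c := (((con (+ 2) :* u :+ c :+ ε :* v :- z :* c) :- con (+ 2) :* u) :- ε :* v) :+ z :* c) refl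
      (deviation a (suc k)) (u x) (V x) ε (ζ ε))
    (cong (λ W → ((W ℤ.- w a (suc k)) ℤ.- y a k) ℤ.+ ztail a k) (sym next))
    where
    x = s (suc k) ℤ.- + a
    ε = e (suc (suc k))
    next : w a (suc (suc k)) ≡ + 2 ℤ.* u x ℤ.+ deviation a (suc k) ℤ.+ ε ℤ.* V x ℤ.- ζ ε ℤ.* deviation a (suc k)
    next = trans (cong (λ z → + 2 ℤ.* u z) (trans (cong (ℤ._- + a) (s-step (suc k)))
        (solve 3 (λ s e a → (s :+ e) :- a := (s :- a) :+ e) refl (s (suc k)) ε (+ a))))
      (trans (affine u x (e-value (suc (suc k))))
        (trans (cong (λ l → l ℤ.+ ε ℤ.* V x ℤ.+ ζ ε ℤ.* (+ 2 ℤ.* u x ℤ.- l)) (laplacian x))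
          (solve 5 (λ u c v ε z → (con (+ 2) :* u :+ c) :+ ε :* v :+ z :* (con (+ 2) :* u :- (con (+ 2) :* u :+ c))
            := con (+ 2) :* u :+ c :+ ε :* v :- z :* c) refl (u x) (deviation a (suc k)) (V x) ε (ζ ε))))

  R : ℕ → ℤ
  R a = (w a (suc p) ℤ.- w a 1) ℤ.+ ∑ p (ztail a)

  δ≡R-T : ∀ a → δ a ≡ R a ℤ.- T a
  δ≡R-T a = begin
    ∑ p (λ k → deviation a (suc k)) ≡⟨ ∑-cong p (λ k → trans (potential-step a k)
      (solve 4 (λ w₂ w₁ y z → ((w₂ :- w₁) :- y) :+ z := (w₂ :+ con -[1+ 0 ] :* w₁) :+ (con -[1+ 0 ] :* y :+ z)) refl
        (w a (suc (suc k))) (w a (suc k)) (y a k) (ztail a k))) ⟩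
    ∑ p (λ k → (w a (suc (suc k)) ℤ.+ -[1+ 0 ] ℤ.* w a (suc k)) ℤ.+ (-[1+ 0 ] ℤ.* y a k ℤ.+ ztail a k))
      ≡⟨ trans (∑-+ p _ _) (cong₂ ℤ._+_ (trans (∑-+ p _ _) (cong (ℤ._+_ (∑ p (λ k → w a (suc (suc k))))) (∑-*ˡ p -[1+ 0 ] _)))
           (trans (∑-+ p _ _) (cong (ℤ._+ ∑ p (ztail a)) (∑-*ˡ p -[1+ 0 ] _)))) ⟩
    (∑ p (λ k → w a (suc (suc k))) ℤ.+ -[1+ 0 ] ℤ.* ∑ p (λ k → w a (suc k))) ℤ.+ (-[1+ 0 ] ℤ.* T a ℤ.+ ∑ p (ztail a))
      ≡⟨ solve 5 (λ A B t z c → (A :+ con -[1+ 0 ] :* B) :+ (con -[1+ 0 ] :* t :+ z) := (((A :+ c) :- B :- c) :+ z) :- t) refl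
           (∑ p (λ k → w a (suc (suc k)))) (∑ p (λ k → w a (suc k))) (T a) (∑ p (ztail a)) (w a 1) ⟩
    ((((∑ p (λ k → w a (suc (suc k))) ℤ.+ w a 1) ℤ.- ∑ p (λ k → w a (suc k))) ℤ.- w a 1) ℤ.+ ∑ p (ztail a)) ℤ.- T a
      ≡⟨ cong (λ z → (((z ℤ.- ∑ p (λ k → w a (suc k))) ℤ.- w a 1) ℤ.+ ∑ p (ztail a)) ℤ.- T a) (∑-suc p (λ k → w a (suc k))) ⟩
    ((((∑ p (λ k → w a (suc k)) ℤ.+ w a (suc p)) ℤ.- ∑ p (λ k → w a (suc k))) ℤ.- w a 1) ℤ.+ ∑ p (ztail a)) ℤ.- T a
      ≡⟨ solve 5 (λ A W w z t → ((((A :+ W) :- A) :- w) :+ z) :- t := ((W :- w) :+ z) :- t) refl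
           (∑ p (λ k → w a (suc k))) (w a (suc p)) (w a 1) (∑ p (ztail a)) (T a) ⟩
    R a ℤ.- T a ∎
    where open ≡-Reasoning

  ∣hit∣≤1 : ∀ a k → ℤ.∣ hit a k ∣ ≤ 1
  ∣hit∣≤1 a k = by-cases (ρ (s k ℤ.- + a))
    where
    by-cases : ∀ r → ℤ.∣ isZero r ∣ ≤ 1
    by-cases zero = ℕₚ.≤-refl
    by-cases (suc r) = z≤n

  ∣deviation∣≤ : ∀ a k → ℤ.∣ deviation a k ∣ ≤ 4 * m
  ∣deviation∣≤ a k = ℕₚ.≤-trans
    (∣i-j∣≤ (+ 2 ℤ.* + m ℤ.* hit a k) (+ 2) (∣i*j∣≤ (+ 2 ℤ.* + m) (hit a k) (∣i*j∣≤ (+ 2) (+ m) ℕₚ.≤-refl ℕₚ.≤-refl) (∣hit∣≤1 a k)) ℕₚ.≤-refl)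
    (ℕₚ.≤-trans (ℕₚ.+-mono-≤ (ℕₚ.≤-reflexive (ℕₚ.*-identityʳ (2 * m))) (ℕₚ.*-monoʳ-≤ 2 (s≤s (z≤n {n}))))
      (ℕₚ.≤-reflexive (sym (ℕₚ.*-distribʳ-+ m 2 2))))

  ∣R∣≤ : ∀ a → ℤ.∣ R a ∣ ≤ 4 * (m * m) + 4 * m * D
  ∣R∣≤ a = ∣i+j∣≤ (w a (suc p) ℤ.- w a 1) (∑ p (ztail a))
    (ℕₚ.≤-trans (∣i-j∣≤ (w a (suc p)) (w a 1) (∣w∣≤ (suc p)) (∣w∣≤ 1)) (ℕₚ.≤-reflexive (sym (ℕₚ.*-distribʳ-+ (m * m) 2 2))))
    (ℕₚ.≤-trans (∣∑∣≤ p (ztail a) (λ k → 4 * m * (1 ∸ ℤ.∣ e (k + 2) ∣)) ztail≤)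
      (ℕₚ.≤-trans (ℕₚ.≤-reflexive (∑ⁿ-*ˡ p (4 * m) (λ k → 1 ∸ ℤ.∣ e (k + 2) ∣))) (ℕₚ.*-monoʳ-≤ (4 * m) (zeros 2))))
    where
    ∣w∣≤ : ∀ k → ℤ.∣ w a k ∣ ≤ 2 * (m * m)
    ∣w∣≤ k = ∣i*j∣≤ (+ 2) (u (s k ℤ.- + a)) ℕₚ.≤-refl (∣u∣≤ (s k ℤ.- + a))
    ztail≤ : ∀ k → ℤ.∣ ztail a k ∣ ≤ 4 * m * (1 ∸ ℤ.∣ e (k + 2) ∣)
    ztail≤ k = ℕₚ.≤-trans (∣i*j∣≤ (ζ (e (suc (suc k)))) (deviation a (suc k)) ℕₚ.≤-refl (∣deviation∣≤ a (suc k)))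
      (ℕₚ.≤-reflexive (trans (ℕₚ.*-comm (1 ∸ ℤ.∣ e (suc (suc k)) ∣) (4 * m)) (cong (λ i → 4 * m * (1 ∸ ℤ.∣ e i ∣)) (ℕₚ.+-comm 2 k))))

  ∣y∣≤ : ∀ a k → ℤ.∣ y a k ∣ ≤ 2 * m
  ∣y∣≤ a k = ℕₚ.≤-trans (∣i*j∣≤ (e (suc (suc k))) (V (s (suc k) ℤ.- + a)) (∣e∣≤1 (suc (suc k))) (∣V∣≤ (s (suc k) ℤ.- + a))) (ℕₚ.≤-reflexive (ℕₚ.*-identityˡ _))

  partial : ℕ → ℕ → ℕ → ℤ
  partial a l k = ∑ l (λ j → y a (k + j))

  -- Moving the range of summation by one exchanges one term at each end, and each has absolute
  -- value at most 2 m.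
  shift-error : ∀ a j → ℤ.∣ T a ℤ.- ∑ p (λ k → y a (k + j)) ∣ ≤ j * (4 * m)
  shift-error a zero = ℕₚ.≤-reflexive (cong ℤ.∣_∣ (trans
    (cong (ℤ._-_ (T a)) (∑-cong p λ k → cong (y a) (ℕₚ.+-identityʳ k))) (ℤₚ.+-inverseʳ (T a))))
  shift-error a (suc j) = subst (λ z → ℤ.∣ z ∣ ≤ suc j * (4 * m)) (sym decompose)
    (ℕₚ.≤-trans (∣i+j∣≤ (T a ℤ.- ∑ p (λ k → y a (k + j))) (y a j ℤ.- y a (p + j)) (shift-error a j)
      (ℕₚ.≤-trans (∣i-j∣≤ (y a j) (y a (p + j)) (∣y∣≤ a j) (∣y∣≤ a (p + j))) (ℕₚ.≤-reflexive (sym (ℕₚ.*-distribʳ-+ m 2 2)))))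
      (ℕₚ.≤-reflexive (ℕₚ.+-comm (j * (4 * m)) (4 * m))))
    where
    decompose : T a ℤ.- ∑ p (λ k → y a (k + suc j)) ≡ (T a ℤ.- ∑ p (λ k → y a (k + j))) ℤ.+ (y a j ℤ.- y a (p + j))
    decompose = trans (cong (ℤ._-_ (T a)) (∑-cong p λ k → cong (y a) (ℕₚ.+-suc k j)))
      (trans (solve 3 (λ t A c → t :- A := (t :- (A :+ c)) :+ c) refl (T a) (∑ p (λ k → y a (suc k + j))) (y a j))
        (trans (cong (λ z → (T a ℤ.- z) ℤ.+ y a j) (∑-suc p (λ k → y a (k + j))))
          (solve 4 (λ t A c d → (t :- (A :+ d)) :+ c := (t :- A) :+ (c :- d)) refl (T a) (∑ p (λ k → y a (k + j))) (y a j) (y a (p + j)))))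

  averaging-error : ∀ a → ℤ.∣ + L ℤ.* T a ℤ.- ∑ p (partial a L) ∣ ≤ L * (L * (4 * m))
  averaging-error a = subst (λ z → ℤ.∣ z ∣ ≤ L * (L * (4 * m))) (sym decompose)
    (∣∑∣≤const L (λ j → T a ℤ.- ∑ p (λ k → y a (k + j))) (L * (4 * m))
      λ j j<L → ℕₚ.≤-trans (shift-error a j) (ℕₚ.*-monoˡ-≤ (4 * m) (ℕₚ.<⇒≤ j<L)))
    where
    decompose : + L ℤ.* T a ℤ.- ∑ p (partial a L) ≡ ∑ L (λ j → T a ℤ.- ∑ p (λ k → y a (k + j)))
    decompose = sym (trans (∑-+ L (λ _ → T a) (λ j → ℤ.- ∑ p (λ k → y a (k + j)))) (cong₂ ℤ._+_ (∑-const L (T a))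
      (trans (∑-cong L (λ j → sym (ℤₚ.-1*i≡-i _))) (trans (∑-*ˡ L -[1+ 0 ] _) (trans (ℤₚ.-1*i≡-i _)
        (cong ℤ.-_ (∑-swap L p (λ j k → y a (k + j)))))))))

  autocorrelation : ℤ → ℤ
  autocorrelation z = ∑ m (λ a → V (+ 0 ℤ.- + a) ℤ.* V ((+ 0 ℤ.- + a) ℤ.+ z))

  ∣autocorrelation∣≤ : ∀ z → ℤ.∣ autocorrelation z ∣ ≤ m * (2 * m * (2 * m))
  ∣autocorrelation∣≤ z = ∣∑∣≤const m _ _ λ a _ → ∣i*j∣≤ (V (+ 0 ℤ.- + a)) (V ((+ 0 ℤ.- + a) ℤ.+ z)) (∣V∣≤ (+ 0 ℤ.- + a)) (∣V∣≤ ((+ 0 ℤ.- + a) ℤ.+ z))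

  s-window : ∀ i h k → s (suc (k + (i + h))) ≡ s (suc (k + i)) ℤ.+ window (suc (suc i)) h k
  s-window i zero k = trans (cong (λ j → s (suc (k + j))) (ℕₚ.+-identityʳ i)) (sym (ℤₚ.+-identityʳ _))
  s-window i (suc h) k = trans (cong (λ j → s (suc j)) (trans (cong (_+_ k) (ℕₚ.+-suc i h)) (ℕₚ.+-suc k (i + h))))
    (trans (s-step (suc (k + (i + h)))) (trans (cong₂ ℤ._+_ (s-window i h k) (cong e (position k (i + h))))
      (ℤₚ.+-assoc (s (suc (k + i))) (window (suc (suc i)) h k) (e (k + (suc (suc i) + h))))))
    where
    position : ∀ k j → suc (suc (k + j)) ≡ k + suc (suc j)
    position k j = sym (trans (ℕₚ.+-suc k (suc j)) (cong suc (ℕₚ.+-suc k j)))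

  -- The two positions differ by the increments in between, and the sum over all residues `a`
  -- removes the dependence on the starting point. The later increment is put first in the product
  -- because `correlation` expects the largest shift at the head.
  ∑-yy : ∀ i h k → ∑ m (λ a → y a (k + i) ℤ.* y a (k + (i + h))) ≡
    shiftProduct e ((suc (suc i) + h) ∷ suc (suc i) ∷ []) k ℤ.* autocorrelation (window (suc (suc i)) h k)
  ∑-yy i h k = begin
    ∑ m (λ a → y a (k + i) ℤ.* y a (k + (i + h))) ≡⟨ ∑-cong m term ⟩
    ∑ m (λ a → (e₂ ℤ.* (e₁ ℤ.* + 1)) ℤ.* (V (x ℤ.- + a) ℤ.* V ((x ℤ.- + a) ℤ.+ z))) ≡⟨ ∑-*ˡ m (e₂ ℤ.* (e₁ ℤ.* + 1)) _ ⟩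
    (e₂ ℤ.* (e₁ ℤ.* + 1)) ℤ.* ∑ m (λ a → V (x ℤ.- + a) ℤ.* V ((x ℤ.- + a) ℤ.+ z))
      ≡⟨ cong (ℤ._*_ (e₂ ℤ.* (e₁ ℤ.* + 1))) (∑-periodic m (λ t → V t ℤ.* V (t ℤ.+ z)) product-periodic x) ⟩
    (e₂ ℤ.* (e₁ ℤ.* + 1)) ℤ.* autocorrelation z ∎
    where
    open ≡-Reasoning
    e₁ = e (k + suc (suc i))
    e₂ = e (k + (suc (suc i) + h))
    x = s (suc (k + i))
    z = window (suc (suc i)) h k
    position : ∀ j → suc (suc (k + j)) ≡ k + suc (suc j)
    position j = sym (trans (ℕₚ.+-suc k (suc j)) (cong suc (ℕₚ.+-suc k j)))
    product-periodic : ∀ t → V (t ℤ.- + m) ℤ.* V ((t ℤ.- + m) ℤ.+ z) ≡ V t ℤ.* V (t ℤ.+ z)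
    product-periodic t = cong₂ ℤ._*_ (V-periodic t) (trans (cong V (solve 3 (λ t m z → (t :- m) :+ z := (t :+ z) :- m) refl t (+ m) z)) (V-periodic (t ℤ.+ z)))
    term : ∀ a → y a (k + i) ℤ.* y a (k + (i + h)) ≡ (e₂ ℤ.* (e₁ ℤ.* + 1)) ℤ.* (V (x ℤ.- + a) ℤ.* V ((x ℤ.- + a) ℤ.+ z))
    term a = trans (cong₂ ℤ._*_ (cong (λ j → e j ℤ.* V (x ℤ.- + a)) (position i))
        (cong₂ ℤ._*_ (cong e (position (i + h))) (cong V (trans (cong (ℤ._- + a) (s-window i h k))
          (solve 3 (λ x z a → (x :+ z) :- a := (x :- a) :+ z) refl x z (+ a))))))
      (solve 4 (λ p v q w → (p :* v) :* (q :* w) := (q :* (p :* con (+ 1))) :* (v :* w)) refl e₁ (V (x ℤ.- + a)) e₂ (V ((x ℤ.- + a) ℤ.+ z)))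

  yy-bound : ℕ
  yy-bound = m * (2 * m * (2 * m)) * (2 ^ L * (E + 2 * D))

  -- The shift `b` occurs in the product and also as the first shift of the window. Such repetitions
  -- do no harm, since only the top shift b + h has to exceed all others. Together with `b`, at most
  -- L shifts from the window give the length `suc L` allowed in `correlation`.
  ∣∑∑yy∣≤ : ∀ i l → i < l → l < L → ℤ.∣ ∑ p (λ k → ∑ m (λ a → y a (k + i) ℤ.* y a (k + l))) ∣ ≤ yy-bound
  ∣∑∑yy∣≤ i l i<l l<L = subst (λ j → ℤ.∣ ∑ p (λ k → ∑ m (λ a → y a (k + i) ℤ.* y a (k + j))) ∣ ≤ yy-bound) (ℕₚ.m+[n∸m]≡n (ℕₚ.<⇒≤ i<l))
    (ℕₚ.≤-trans (ℕₚ.≤-reflexive (cong ℤ.∣_∣ (∑-cong p (∑-yy i h))))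
      (ℕₚ.≤-trans (window-correlation h autocorrelation (m * (2 * m * (2 * m))) ∣autocorrelation∣≤ (b + h) b (b ∷ []) ℕₚ.≤-refl
          (ℕₚ.+-monoʳ-≤ b h≤L) ((ℕₚ.m<m+n b (ℕₚ.m<n⇒0<n∸m i<l) , ℕₚ.+-monoʳ-≤ b h≤L) ∷ []) (s≤s h≤L))
        (ℕₚ.*-monoʳ-≤ (m * (2 * m * (2 * m))) (windowBound-≤ h h≤L))))
    where
    h = l ∸ i
    b = suc (suc i)
    h≤L : h ≤ L
    h≤L = ℕₚ.≤-trans (ℕₚ.m∸n≤m l i) (ℕₚ.<⇒≤ l<L)

  energy : ℕ → ℤ
  energy l = ∑ m (λ a → ∑ p (λ k → partial a l k ℤ.* partial a l k))

  energy-step : ∀ l → energy (suc l) ≡ energy l ℤ.+ (+ 2 ℤ.* ∑ l (λ i → ∑ p (λ k → ∑ m (λ a → y a (k + i) ℤ.* y a (k + l))))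
    ℤ.+ ∑ m (λ a → ∑ p (λ k → y a (k + l) ℤ.* y a (k + l))))
  energy-step l = begin
    ∑ m (λ a → ∑ p (λ k → (partial a l k ℤ.+ y a (k + l)) ℤ.* (partial a l k ℤ.+ y a (k + l))))
      ≡⟨ ∑-cong m (λ a → trans (∑-cong p (λ k → solve 2 (λ P y → (P :+ y) :* (P :+ y) := P :* P :+ (con (+ 2) :* (P :* y) :+ y :* y)) refl (partial a l k) (y a (k + l))))
           (trans (∑-+ p _ _) (cong (ℤ._+_ (∑ p (λ k → partial a l k ℤ.* partial a l k))) (trans (∑-+ p _ _) (cong (ℤ._+ ∑ p (λ k → y a (k + l) ℤ.* y a (k + l))) (∑-*ˡ p (+ 2) _)))))) ⟩
    ∑ m (λ a → ∑ p (λ k → partial a l k ℤ.* partial a l k) ℤ.+ (+ 2 ℤ.* ∑ p (λ k → partial a l k ℤ.* y a (k + l)) ℤ.+ ∑ p (λ k → y a (k + l) ℤ.* y a (k + l))))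
      ≡⟨ trans (∑-+ m _ _) (cong (ℤ._+_ (energy l)) (trans (∑-+ m _ _) (cong (ℤ._+ ∑ m (λ a → ∑ p (λ k → y a (k + l) ℤ.* y a (k + l)))) (∑-*ˡ m (+ 2) _)))) ⟩
    energy l ℤ.+ (+ 2 ℤ.* ∑ m (λ a → ∑ p (λ k → partial a l k ℤ.* y a (k + l))) ℤ.+ ∑ m (λ a → ∑ p (λ k → y a (k + l) ℤ.* y a (k + l))))
      ≡⟨ cong (λ z → energy l ℤ.+ (+ 2 ℤ.* z ℤ.+ ∑ m (λ a → ∑ p (λ k → y a (k + l) ℤ.* y a (k + l))))) cross ⟩
    energy l ℤ.+ (+ 2 ℤ.* ∑ l (λ i → ∑ p (λ k → ∑ m (λ a → y a (k + i) ℤ.* y a (k + l)))) ℤ.+ ∑ m (λ a → ∑ p (λ k → y a (k + l) ℤ.* y a (k + l)))) ∎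
    where
    open ≡-Reasoning
    cross : ∑ m (λ a → ∑ p (λ k → partial a l k ℤ.* y a (k + l))) ≡ ∑ l (λ i → ∑ p (λ k → ∑ m (λ a → y a (k + i) ℤ.* y a (k + l))))
    cross = begin
      ∑ m (λ a → ∑ p (λ k → partial a l k ℤ.* y a (k + l))) ≡⟨ ∑-swap m p _ ⟩
      ∑ p (λ k → ∑ m (λ a → partial a l k ℤ.* y a (k + l)))
        ≡⟨ ∑-cong p (λ k → trans (∑-cong m (λ a → trans (ℤₚ.*-comm (partial a l k) _) (trans (sym (∑-*ˡ l (y a (k + l)) _))
             (∑-cong l (λ i → ℤₚ.*-comm (y a (k + l)) (y a (k + i))))))) (∑-swap m l _)) ⟩
      ∑ p (λ k → ∑ l (λ i → ∑ m (λ a → y a (k + i) ℤ.* y a (k + l)))) ≡⟨ ∑-swap p l _ ⟩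
      ∑ l (λ i → ∑ p (λ k → ∑ m (λ a → y a (k + i) ℤ.* y a (k + l)))) ∎

  energyStep : ℕ
  energyStep = 2 * (L * yy-bound) + m * (p * (2 * m * (2 * m)))

  -- Lengthening the windows by one adds a diagonal term, bounded trivially, and fewer than L
  -- correlations, each at most `yy-bound`. When the latter are small, the energy grows only
  -- linearly in the length, not quadratically.
  ∣energy∣≤ : ∀ l → l ≤ L → ℤ.∣ energy l ∣ ≤ l * energyStep
  ∣energy∣≤ zero _ = ℕₚ.≤-reflexive (cong ℤ.∣_∣ (trans (∑-cong m λ a → ∑-zero p) (∑-zero m)))
  ∣energy∣≤ (suc l) l<L = subst (λ z → ℤ.∣ z ∣ ≤ suc l * energyStep) (sym (energy-step l))
    (ℕₚ.≤-trans (∣i+j∣≤ (energy l) (+ 2 ℤ.* X ℤ.+ Y) (∣energy∣≤ l (ℕₚ.<⇒≤ l<L)) (∣i+j∣≤ (+ 2 ℤ.* X) Y (∣i*j∣≤ (+ 2) X ℕₚ.≤-refl X≤) Y≤))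
      (ℕₚ.≤-reflexive (ℕₚ.+-comm (l * energyStep) energyStep)))
    where
    X = ∑ l (λ i → ∑ p (λ k → ∑ m (λ a → y a (k + i) ℤ.* y a (k + l))))
    Y = ∑ m (λ a → ∑ p (λ k → y a (k + l) ℤ.* y a (k + l)))
    X≤ : ℤ.∣ X ∣ ≤ L * yy-bound
    X≤ = ℕₚ.≤-trans (∣∑∣≤const l _ yy-bound λ i i<l → ∣∑∑yy∣≤ i l i<l l<L) (ℕₚ.*-monoˡ-≤ yy-bound (ℕₚ.<⇒≤ l<L))
    Y≤ : ℤ.∣ Y ∣ ≤ m * (p * (2 * m * (2 * m)))
    Y≤ = ∣∑∣≤const m _ _ λ a _ → ∣∑∣≤const p _ _ λ k _ → ∣i*j∣≤ (y a (k + l)) (y a (k + l)) (∣y∣≤ a (k + l)) (∣y∣≤ a (k + l))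

  private
    r = L * (4 * (m * m) + 4 * m * D)
    b = L * (L * (4 * m))

  -- L δ is split into the boundary part L R, the sum over windows and the averaging error. Two uses
  -- of (i + j)² ≤ 2 i² + 2 j² give the coefficients 2, 4 and 4; Cauchy-Schwarz over the p windows
  -- gives the factor p.
  [Lδ]²≤ : ∀ a → (+ L ℤ.* δ a) ℤ.* (+ L ℤ.* δ a) ℤ.≤
    + (4 * p) ℤ.* ∑ p (λ k → partial a L k ℤ.* partial a L k) ℤ.+ + (2 * (r * r) + 4 * (b * b))
  [Lδ]²≤ a = begin
    (+ L ℤ.* δ a) ℤ.* (+ L ℤ.* δ a)
      ≡⟨ cong (λ z → z ℤ.* z) (trans (cong (ℤ._*_ (+ L)) (δ≡R-T a)) (solve 3 (λ L R t → L :* (R :- t) := L :* R :+ (:- (L :* t))) refl (+ L) (R a) (T a))) ⟩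
    (LR ℤ.+ ℤ.- LT) ℤ.* (LR ℤ.+ ℤ.- LT) ≤⟨ [i+j]²≤ LR (ℤ.- LT) ⟩
    + 2 ℤ.* (LR ℤ.* LR) ℤ.+ + 2 ℤ.* (ℤ.- LT ℤ.* ℤ.- LT)
      ≡⟨ cong (λ z → + 2 ℤ.* (LR ℤ.* LR) ℤ.+ + 2 ℤ.* z) (trans (solve 1 (λ t → (:- t) :* (:- t) := t :* t) refl LT)
           (cong (λ z → z ℤ.* z) (solve 2 (λ t W → t := W :+ (t :- W)) refl LT W))) ⟩
    + 2 ℤ.* (LR ℤ.* LR) ℤ.+ + 2 ℤ.* ((W ℤ.+ (LT ℤ.- W)) ℤ.* (W ℤ.+ (LT ℤ.- W)))
      ≤⟨ ℤₚ.+-mono-≤ (ℤₚ.*-monoˡ-≤-nonNeg (+ 2) (∣i∣≤⇒i*i≤ LR (∣i*j∣≤ (+ L) (R a) ℕₚ.≤-refl (∣R∣≤ a))))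
           (ℤₚ.*-monoˡ-≤-nonNeg (+ 2) (ℤₚ.≤-trans ([i+j]²≤ W (LT ℤ.- W))
             (ℤₚ.+-mono-≤ (ℤₚ.*-monoˡ-≤-nonNeg (+ 2) (cauchy-schwarz p (partial a L)))
               (ℤₚ.*-monoˡ-≤-nonNeg (+ 2) (∣i∣≤⇒i*i≤ (LT ℤ.- W) (averaging-error a)))))) ⟩
    + 2 ℤ.* + (r * r) ℤ.+ + 2 ℤ.* (+ 2 ℤ.* (+ p ℤ.* Q) ℤ.+ + 2 ℤ.* + (b * b))
      ≡⟨ solve 4 (λ rr p Q bb → con (+ 2) :* rr :+ con (+ 2) :* (con (+ 2) :* (p :* Q) :+ con (+ 2) :* bb)
           := (con (+ 4) :* p) :* Q :+ (con (+ 2) :* rr :+ con (+ 4) :* bb)) refl (+ (r * r)) (+ p) Q (+ (b * b)) ⟩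
    (+ 4 ℤ.* + p) ℤ.* Q ℤ.+ (+ 2 ℤ.* + (r * r) ℤ.+ + 4 ℤ.* + (b * b))
      ≡⟨ cong₂ (λ x z → x ℤ.* Q ℤ.+ z) (sym (ℤₚ.pos-* 4 p)) (cong₂ ℤ._+_ (sym (ℤₚ.pos-* 2 (r * r))) (sym (ℤₚ.pos-* 4 (b * b)))) ⟩
    + (4 * p) ℤ.* Q ℤ.+ + (2 * (r * r) + 4 * (b * b)) ∎
    where
    open ℤₚ.≤-Reasoning
    LR = + L ℤ.* R a
    LT = + L ℤ.* T a
    W = ∑ p (partial a L)
    Q = ∑ p (λ k → partial a L k ℤ.* partial a L k)

  ∑δ²≤ : + (L * L) ℤ.* ∑ m (λ a → δ a ℤ.* δ a) ℤ.≤ + (4 * p * (L * energyStep) + m * (2 * (r * r) + 4 * (b * b)))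
  ∑δ²≤ = begin
    + (L * L) ℤ.* ∑ m (λ a → δ a ℤ.* δ a) ≡⟨ ∑-*ˡ m (+ (L * L)) _ ⟨
    ∑ m (λ a → + (L * L) ℤ.* (δ a ℤ.* δ a))
      ≡⟨ ∑-cong m (λ a → trans (cong (ℤ._* (δ a ℤ.* δ a)) (ℤₚ.pos-* L L)) (solve 2 (λ L d → (L :* L) :* (d :* d) := (L :* d) :* (L :* d)) refl (+ L) (δ a))) ⟩
    ∑ m (λ a → (+ L ℤ.* δ a) ℤ.* (+ L ℤ.* δ a)) ≤⟨ ∑-mono-≤ m [Lδ]²≤ ⟩
    ∑ m (λ a → + (4 * p) ℤ.* ∑ p (λ k → partial a L k ℤ.* partial a L k) ℤ.+ + c)
      ≡⟨ trans (∑-+ m _ _) (cong₂ ℤ._+_ (∑-*ˡ m (+ (4 * p)) _) (trans (∑-const m (+ c)) (sym (ℤₚ.pos-* m c)))) ⟩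
    + (4 * p) ℤ.* energy L ℤ.+ + (m * c)
      ≤⟨ ℤₚ.+-monoˡ-≤ (+ (m * c)) (ℤₚ.*-monoˡ-≤-nonNeg (+ (4 * p)) (ℤₚ.≤-trans (i≤+∣i∣ (energy L)) (ℤ.+≤+ (∣energy∣≤ L ℕₚ.≤-refl)))) ⟩
    + (4 * p) ℤ.* + (L * energyStep) ℤ.+ + (m * c) ≡⟨ cong (ℤ._+ + (m * c)) (sym (ℤₚ.pos-* (4 * p) (L * energyStep))) ⟩
    + (4 * p * (L * energyStep) + m * c) ∎
    where
    open ℤₚ.≤-Reasoning
    c = 2 * (r * r) + 4 * (b * b)

-- Sizes of the parameters.

2^⌊log₂n⌋≤n : ∀ n → 1 ≤ n → 2 ^ ⌊log₂ n ⌋ ≤ n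
2^⌊log₂n⌋≤n = <-rec (λ n → 1 ≤ n → 2 ^ ⌊log₂ n ⌋ ≤ n) step
  where
  open ℕₚ.≤-Reasoning
  step : ∀ n → (∀ {k} → k < n → 1 ≤ k → 2 ^ ⌊log₂ k ⌋ ≤ k) → 1 ≤ n → 2 ^ ⌊log₂ n ⌋ ≤ n
  step 1 _ _ = ℕₚ.≤-refl
  step n@(suc (suc j)) rec _ = begin
    2 ^ ⌊log₂ n ⌋ ≤⟨ ℕₚ.^-monoʳ-≤ 2 (ℕₚ.m≤n+m∸n ⌊log₂ n ⌋ 1) ⟩
    2 * 2 ^ (⌊log₂ n ⌋ ∸ 1) ≡⟨ cong (λ l → 2 * 2 ^ l) (⌊log₂⌊n/2⌋⌋≡⌊log₂n⌋∸1 n) ⟨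
    2 * 2 ^ ⌊log₂ ⌊ n /2⌋ ⌋ ≤⟨ ℕₚ.*-monoʳ-≤ 2 (rec {⌊ n /2⌋} (ℕₚ.⌊n/2⌋<n (suc j)) (s≤s z≤n)) ⟩
    2 * ⌊ n /2⌋ ≡⟨ cong (_+_ ⌊ n /2⌋) (ℕₚ.+-identityʳ _) ⟩
    ⌊ n /2⌋ + ⌊ n /2⌋ ≤⟨ ℕₚ.+-monoʳ-≤ ⌊ n /2⌋ (ℕₚ.⌊n/2⌋≤⌈n/2⌉ n) ⟩
    ⌊ n /2⌋ + ⌈ n /2⌉ ≡⟨ ℕₚ.⌊n/2⌋+⌈n/2⌉≡n n ⟩
    n ∎

n+2≤2^n : ∀ n → 2 ≤ n → n + 2 ≤ 2 ^ n
n+2≤2^n (suc zero) (s≤s ())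
n+2≤2^n 2 _ = ℕₚ.≤-refl
n+2≤2^n (suc (suc (suc n))) _ = ℕₚ.≤-trans (ℕₚ.≤-trans (ℕₚ.≤-reflexive (ℕₚ.+-comm 1 (suc (suc n) + 2)))
    (ℕₚ.+-monoʳ-≤ (suc (suc n) + 2) (ℕₚ.m^n>0 2 (suc (suc n)))))
  (ℕₚ.≤-trans (ℕₚ.+-monoˡ-≤ (2 ^ suc (suc n)) (n+2≤2^n (suc (suc n)) (s≤s (s≤s z≤n)))) (ℕₚ.≤-reflexive (cong (_+_ (2 ^ suc (suc n))) (sym (ℕₚ.+-identityʳ _)))))

-- Sizes are recorded as exponents of Z: products add exponents, a sum costs one more since Z ≥ 2,
-- numerical constants are absorbed by powers of 4, and anything up to exponent 20 is at most p.
module Sizes (Z p : ℕ) (4≤Z : 4 ≤ Z) (Z^20≤p : Z ^ 20 ≤ p) where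
  1≤Z^ : ∀ i → 1 ≤ Z ^ i
  1≤Z^ i = ℕₚ.m^n>0 Z {{ℕ.>-nonZero (ℕₚ.≤-trans (s≤s z≤n) 4≤Z)}} i

  mul : ∀ i j {a b} → a ≤ Z ^ i → b ≤ Z ^ j → a * b ≤ Z ^ (i + j)
  mul i j a≤ b≤ = ℕₚ.≤-trans (ℕₚ.*-mono-≤ a≤ b≤) (ℕₚ.≤-reflexive (sym (ℕₚ.^-distribˡ-+-* Z i j)))

  up : ∀ k i {a} → a ≤ Z ^ i → a ≤ Z ^ (k + i)
  up k i {a} a≤ = ℕₚ.≤-trans (ℕₚ.≤-reflexive (sym (ℕₚ.*-identityˡ a))) (mul k i (1≤Z^ k) a≤)

  add : ∀ i {a b} → a ≤ Z ^ i → b ≤ Z ^ i → a + b ≤ Z ^ suc i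
  add i {a} {b} a≤ b≤ = ℕₚ.≤-trans (ℕₚ.+-mono-≤ a≤ (ℕₚ.≤-trans b≤ (ℕₚ.≤-reflexive (sym (ℕₚ.+-identityʳ (Z ^ i))))))
    (ℕₚ.*-monoˡ-≤ (Z ^ i) (ℕₚ.≤-trans (s≤s (s≤s z≤n)) 4≤Z))

  to-p : ∀ k i {a} → k + i ≡ 20 → a ≤ Z ^ i → a ≤ p
  to-p k i eq a≤ = ℕₚ.≤-trans (up k i a≤) (ℕₚ.≤-trans (ℕₚ.≤-reflexive (cong (Z ^_) eq)) Z^20≤p)

  from4 : ∀ i {a} → a ≤ 4 ^ i → a ≤ Z ^ i
  from4 i a≤ = ℕₚ.≤-trans a≤ (ℕₚ.^-monoˡ-≤ i 4≤Z)

  module Window {L d m : ℕ} (1≤L : 1 ≤ L) (L+2≤Z : L + 2 ≤ Z) (1+d≤Z : suc d ≤ Z) (m≤ : m ≤ Z ^ 5) where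
    -- `D` bounds the degree of a product of at most L + 2 translates. With M = 2 μ, the error p (D
    -- + 3) / M in the correlations is p / (4 L Z), small enough to outweigh the loss 2^L = Z and
    -- one more factor L.
    D μ : ℕ
    D = (L + 2) * d
    μ = (D + 3) * (2 * (L * Z))

    one : ∀ {a} → a ≤ Z → a ≤ Z ^ 1
    one a≤ = ℕₚ.≤-trans a≤ (ℕₚ.≤-reflexive (sym (ℕₚ.*-identityʳ Z)))

    L≤ : L ≤ Z ^ 1
    L≤ = one (ℕₚ.≤-trans (ℕₚ.m≤m+n L 2) L+2≤Z)

    D≤ : D ≤ Z ^ 2
    D≤ = mul 1 1 (one L+2≤Z) (one (ℕₚ.≤-trans (ℕₚ.n≤1+n d) 1+d≤Z))

    μ≤ : μ ≤ Z ^ 6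
    μ≤ = mul 3 3 (add 2 D≤ (up 1 1 (from4 1 (s≤s (s≤s (s≤s z≤n)))))) (mul 1 2 (from4 1 (s≤s (s≤s z≤n))) (mul 1 1 L≤ (one ℕₚ.≤-refl)))

    1≤μ : 1 ≤ μ
    1≤μ = ℕₚ.*-mono-≤ {1} {D + 3} {1} {2 * (L * Z)} (ℕₚ.≤-trans (s≤s z≤n) (ℕₚ.m≤n+m 3 D))
      (ℕₚ.*-mono-≤ {1} {2} {1} {L * Z} (s≤s z≤n) (ℕₚ.*-mono-≤ {1} {L} {1} {Z} 1≤L (ℕₚ.≤-trans (s≤s z≤n) 4≤Z)))

    -- The most demanding of the size conditions: it reaches exponent 19, and the exponent 20 is
    -- chosen to accommodate it.
    stepanov-small : D + (((μ + μ) * ((μ + μ) * D + suc μ)) + ((μ + μ) * ((μ + μ) * D + suc μ))) ≤ p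
    stepanov-small = to-p 1 19 refl (add 18 (up 16 2 D≤) (add 17 B≤ B≤))
      where
      M≤ : μ + μ ≤ Z ^ 7
      M≤ = add 6 μ≤ μ≤
      B≤ : (μ + μ) * ((μ + μ) * D + suc μ) ≤ Z ^ 17
      B≤ = mul 7 10 M≤ (add 9 (mul 7 2 M≤ D≤) (up 2 7 (add 6 (1≤Z^ 6) μ≤)))

    1+d*L<p : suc d * L < p
    1+d*L<p = to-p 17 3 refl (add 2 (1≤Z^ 2) (mul 1 1 (one 1+d≤Z) L≤))

    20LZD≤p : 20 * (L * (Z * D)) ≤ p
    20LZD≤p = to-p 13 7 refl (mul 3 4 (from4 3 (ℕₚ.m≤m+n 20 44)) (mul 1 3 L≤ (mul 1 2 (one ℕₚ.≤-refl) D≤)))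

    p≤p*p : p ≤ p * p
    p≤p*p = ℕₚ.≤-trans (ℕₚ.≤-reflexive (sym (ℕₚ.*-identityʳ p))) (ℕₚ.*-monoʳ-≤ p (ℕₚ.≤-trans (1≤Z^ 20) Z^20≤p))

    boundary-small : L * ((m + D) * (m + D)) ≤ p * p
    boundary-small = ℕₚ.≤-trans (to-p 7 13 refl (mul 1 12 L≤ (mul 6 6 m+D≤ m+D≤))) p≤p*p
      where
      m+D≤ : m + D ≤ Z ^ 6
      m+D≤ = add 5 m≤ (up 3 2 D≤)

    L*L*L≤p*p : L * L * L ≤ p * p
    L*L*L≤p*p = ℕₚ.≤-trans (to-p 17 3 refl (mul 2 1 (mul 1 1 L≤ L≤) L≤)) p≤p*p

-- After L m³ is factored out, four contributions remain: correlations, diagonal, boundary with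
-- zeros, and averaging. They are at most 16, 16, 32 and 64 times p², which makes 128.
total-bound : ∀ {m p L D W} → 2 * (L * W) ≤ p → L * ((m + D) * (m + D)) ≤ p * p → L * L * L ≤ p * p →
  let r = L * (4 * (m * m) + 4 * m * D) ; b = L * (L * (4 * m)) in
  4 * p * (L * (2 * (L * (m * (2 * m * (2 * m)) * W)) + m * (p * (2 * m * (2 * m))))) + m * (2 * (r * r) + 4 * (b * b))
    ≤ L * (128 * (m * m * m) * (p * p))
total-bound {m} {p} {L} {D} {W} h₁ h₂ h₃ = begin
  4 * p * (L * (2 * (L * (m * (2 * m * (2 * m)) * W)) + m * (p * (2 * m * (2 * m))))) + m * (2 * (r * r) + 4 * (b * b))
    ≡⟨ solve 5 (λ m p L D W →
         con 4 :* p :* (L :* (con 2 :* (L :* (m :* (con 2 :* m :* (con 2 :* m)) :* W)) :+ m :* (p :* (con 2 :* m :* (con 2 :* m)))))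
           :+ m :* (con 2 :* ((L :* (con 4 :* (m :* m) :+ con 4 :* m :* D)) :* (L :* (con 4 :* (m :* m) :+ con 4 :* m :* D)))
             :+ con 4 :* ((L :* (L :* (con 4 :* m))) :* (L :* (L :* (con 4 :* m)))))
         := L :* (m :* m :* m) :* (con 16 :* p :* (con 2 :* (L :* W)) :+ con 16 :* p :* p :+ con 32 :* (L :* ((m :+ D) :* (m :+ D))) :+ con 64 :* (L :* L :* L)))
         refl m p L D W ⟩
  L * (m * m * m) * (16 * p * (2 * (L * W)) + 16 * p * p + 32 * (L * ((m + D) * (m + D))) + 64 * (L * L * L))
    ≤⟨ ℕₚ.*-monoʳ-≤ (L * (m * m * m)) (ℕₚ.+-mono-≤ (ℕₚ.+-mono-≤ (ℕₚ.+-monoˡ-≤ (16 * p * p) (ℕₚ.*-monoʳ-≤ (16 * p) h₁)) (ℕₚ.*-monoʳ-≤ 32 h₂)) (ℕₚ.*-monoʳ-≤ 64 h₃)) ⟩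
  L * (m * m * m) * (16 * p * p + 16 * p * p + 32 * (p * p) + 64 * (p * p))
    ≡⟨ solve 3 (λ m p L → L :* (m :* m :* m) :* (con 16 :* p :* p :+ con 16 :* p :* p :+ con 32 :* (p :* p) :+ con 64 :* (p :* p))
         := L :* (con 128 :* (m :* m :* m) :* (p :* p))) refl m p L ⟩
  L * (128 * (m * m * m) * (p * p)) ∎
  where
  open ℕₚ.≤-Reasoning
  open Data.Nat.Solver.+-*-Solver
  r = L * (4 * (m * m) + 4 * m * D)
  b = L * (L * (4 * m))

-- From hitting counts to the rational sum of squares.

module Deviations (p : ℕ) (F : Poly) (n : ℕ) where
  open Potential n
  private m = suc n

  -- The integer numerator of `Phi` - 1 / m over the denominator p m.
  ε : ℕ → ℤ
  ε a = + (m * countHits p F m a p) ℤ.- + p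

  ∑ε² : ℕ → ℤ
  ∑ε² k = ∑ k (λ a → ε a ℤ.* ε a)

  countHits-∑ : ∀ a → a < m → ∀ N → + countHits p F m a N ≡ ∑ N (λ k → isZero (ρ (S p F (suc k) ℤ.- + a)))
  countHits-∑ a a<m zero = refl
  countHits-∑ a a<m (suc N) = trans (ℤₚ.+-comm (+ (if ρ (S p F (suc N)) ≡ᵇ a then 1 else 0)) (+ countHits p F m a N))
    (cong₂ ℤ._+_ (countHits-∑ a a<m N) (sym (isZero-ρ (S p F (suc N)) a a<m)))

  ∑-deviation : ∀ a → a < m → ∑ p (λ k → + 2 ℤ.* + m ℤ.* isZero (ρ (S p F (suc k) ℤ.- + a)) ℤ.- + 2) ≡ + 2 ℤ.* ε a
  ∑-deviation a a<m = begin
    ∑ p (λ k → + 2 ℤ.* + m ℤ.* h k ℤ.- + 2) ≡⟨ ∑-+ p (λ k → + 2 ℤ.* + m ℤ.* h k) (λ _ → ℤ.- + 2) ⟩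
    ∑ p (λ k → + 2 ℤ.* + m ℤ.* h k) ℤ.+ ∑ p (λ _ → ℤ.- + 2) ≡⟨ cong₂ ℤ._+_ (∑-*ˡ p (+ 2 ℤ.* + m) h) (∑-const p (ℤ.- + 2)) ⟩
    + 2 ℤ.* + m ℤ.* ∑ p h ℤ.+ + p ℤ.* (ℤ.- + 2) ≡⟨ cong (λ z → + 2 ℤ.* + m ℤ.* z ℤ.+ + p ℤ.* (ℤ.- + 2)) (sym (countHits-∑ a a<m p)) ⟩
    + 2 ℤ.* + m ℤ.* + H ℤ.+ + p ℤ.* (ℤ.- + 2)
      ≡⟨ solve 3 (λ m H p → con (+ 2) :* m :* H :+ p :* (:- con (+ 2)) := con (+ 2) :* (m :* H :- p)) refl (+ m) (+ H) (+ p) ⟩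
    + 2 ℤ.* (+ m ℤ.* + H ℤ.- + p) ≡⟨ cong (λ z → + 2 ℤ.* (z ℤ.- + p)) (sym (ℤₚ.pos-* m H)) ⟩
    + 2 ℤ.* ε a ∎
    where
    open ≡-Reasoning
    open Data.Integer.Solver.+-*-Solver
    h = λ k → isZero (ρ (S p F (suc k) ℤ.- + a))
    H = countHits p F m a p

summand : ℕ → Poly → ℕ → ℕ → ℚ
summand p F m a = (Phi p F m a ℚ.- frac 1 m) ℚ.* (Phi p F m a ℚ.- frac 1 m)

-- The partial sums of sqDev are local to its definition; abstracting m, the summands and _+_ from
-- an unfolded sqDev makes them available by unification.
mutual
  partialSqDev : ℕ → Poly → ℕ → ℕ → ℚ
  partialSqDev = λ p F n k → _

  sqDev-unfold : ∀ p F n → sqDev p F (suc (suc n)) ≡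
    partialSqDev p F (suc n) n ℚ.+ summand p F (suc (suc n)) n ℚ.+ summand p F (suc (suc n)) (suc n)
  sqDev-unfold p F n with summand p F (suc (suc n)) n | summand p F (suc (suc n)) (suc n)
  ... | _ | _ with suc n
  ... | _ with ℚ._+_
  ... | _ = refl

module _ (p′ : ℕ) (F : Poly) (n : ℕ) where
  private
    p = suc p′
    m = suc n
  open Deviations p F n

  toℚᵘ-/ : ∀ i k → toℚᵘ (i ℚ./ suc k) ≃ mkℚᵘ i k
  toℚᵘ-/ i k = ℚₚ.toℚᵘ-fromℚᵘ (mkℚᵘ i k)

  private
    N = ℕ.pred (p * m)

  difference≃ : ∀ a → toℚᵘ (Phi p F m a ℚ.- frac 1 m) ≃ mkℚᵘ (ε a) N
  difference≃ a = ℚᵘₚ.≃-trans (ℚₚ.toℚᵘ-homo-+ (Phi p F m a) (ℚ.- frac 1 m))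
    (ℚᵘₚ.≃-trans (ℚᵘₚ.+-cong (toℚᵘ-/ (+ H) p′) (ℚᵘₚ.≃-trans (ℚₚ.toℚᵘ-homo‿- (frac 1 m)) (ℚᵘₚ.-‿cong (toℚᵘ-/ (+ 1) n))))
      (*≡* (cong (ℤ._* + (p * m)) (trans (solve 3 (λ H m p → H :* m :+ (con -[1+ 0 ]) :* p := m :* H :- p) refl (+ H) (+ m) (+ p))
        (cong (ℤ._- + p) (sym (ℤₚ.pos-* m H)))))))
    where
    open Data.Integer.Solver.+-*-Solver
    H = countHits p F m a p

  summand≃ : ∀ a → toℚᵘ (summand p F m a) ≃ mkℚᵘ (ε a ℤ.* ε a) (ℕ.pred (p * m * (p * m)))
  summand≃ a = ℚᵘₚ.≃-trans (ℚₚ.toℚᵘ-homo-* (Phi p F m a ℚ.- frac 1 m) (Phi p F m a ℚ.- frac 1 m)) (ℚᵘₚ.*-cong (difference≃ a) (difference≃ a))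

  mkℚᵘ-+ : ∀ i j k → mkℚᵘ i k ℚᵘ.+ mkℚᵘ j k ≃ mkℚᵘ (i ℤ.+ j) k
  mkℚᵘ-+ i j k = *≡* (trans (solve 3 (λ i j k → (i :* k :+ j :* k) :* k := (i :+ j) :* (k :* k)) refl i j (+ suc k))
    (cong (ℤ._*_ (i ℤ.+ j)) (sym (ℤₚ.pos-* (suc k) (suc k)))))
    where open Data.Integer.Solver.+-*-Solver

  partialSqDev≃ : ∀ k → toℚᵘ (partialSqDev p F n k) ≃ mkℚᵘ (∑ε² k) (ℕ.pred (p * m * (p * m)))
  partialSqDev≃ zero = *≡* refl
  partialSqDev≃ (suc k) = ℚᵘₚ.≃-trans (ℚₚ.toℚᵘ-homo-+ (partialSqDev p F n k) (summand p F m k))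
    (ℚᵘₚ.≃-trans (ℚᵘₚ.+-cong (partialSqDev≃ k) (summand≃ k)) (mkℚᵘ-+ (∑ε² k) (ε k ℤ.* ε k) (ℕ.pred (p * m * (p * m)))))

sqDev-≤ : ∀ p′ F n ℓ C → let p = suc p′ ; m = suc (suc n) in
  + ℓ ℤ.* Deviations.∑ε² p F (suc n) m ℤ.≤ + (C * (p * m * (p * m))) →
  sqDev p F m ℚ.* ((+ ℓ) ℚ./ 1) ℚ.≤ (+ C) ℚ./ 1
sqDev-≤ p′ F n ℓ C le = ℚₚ.toℚᵘ-cancel-≤ (ℚᵘₚ.≤-respˡ-≃ (ℚᵘₚ.≃-sym lhs) (ℚᵘₚ.≤-respʳ-≃ (ℚᵘₚ.≃-sym (toℚᵘ-/ p′ F (suc n) (+ C) 0))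
    (*≤* (subst₂ ℤ._≤_ left right le))))
  where
  p = suc p′
  m = suc (suc n)
  A = Deviations.∑ε² p F (suc n) m
  N = ℕ.pred (p * m * (p * m))
  lhs : toℚᵘ (sqDev p F m ℚ.* ((+ ℓ) ℚ./ 1)) ≃ mkℚᵘ A N ℚᵘ.* mkℚᵘ (+ ℓ) 0
  lhs = ℚᵘₚ.≃-trans (ℚₚ.toℚᵘ-homo-* (sqDev p F m) ((+ ℓ) ℚ./ 1)) (ℚᵘₚ.*-cong (partialSqDev≃ p′ F (suc n) m) (toℚᵘ-/ p′ F (suc n) (+ ℓ) 0))
  left : + ℓ ℤ.* A ≡ (A ℤ.* + ℓ) ℤ.* + 1
  left = trans (ℤₚ.*-comm (+ ℓ) A) (sym (ℤₚ.*-identityʳ _))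
  right : + (C * (p * m * (p * m))) ≡ + C ℤ.* + (p * m * (p * m) * 1)
  right = trans (ℤₚ.pos-* C (p * m * (p * m))) (cong (λ k → + C ℤ.* + k) (sym (ℕₚ.*-identityʳ (p * m * (p * m)))))

-- Choice of the parameters and conclusion.

∑-cong-< : ∀ n {f g} → (∀ k → k < n → f k ≡ g k) → ∑ n f ≡ ∑ n g
∑-cong-< zero eq = refl
∑-cong-< (suc n) eq = cong₂ ℤ._+_ (∑-cong-< n λ k k<n → eq k (ℕₚ.m≤n⇒m≤1+n k<n)) (eq n ℕₚ.≤-refl)

∑ⁿ-cong : ∀ n {f g} → (∀ k → f k ≡ g k) → ∑ⁿ n f ≡ ∑ⁿ n g
∑ⁿ-cong zero eq = refl
∑ⁿ-cong (suc n) eq = cong₂ _+_ (∑ⁿ-cong n eq) (eq n)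

divide-bound : ∀ c a Y D p .{{_ : NonZero Y}} → suc D * Y * c ≤ a * (suc D * Y) + p * suc D → c ≤ a + p div Y
divide-bound c a Y D p h = ℕₚ.≤-trans (ℕₚ.m≤n+m∸n c a) (ℕₚ.+-monoʳ-≤ a (begin
  c ∸ a ≡⟨ m*n/n≡m (c ∸ a) Y ⟨
  (c ∸ a) * Y div Y ≤⟨ /-monoˡ-≤ Y (ℕₚ.*-cancelˡ-≤ (suc D) (begin
    suc D * ((c ∸ a) * Y) ≡⟨ solve 3 (λ d x Y → d :* (x :* Y) := x :* (d :* Y)) refl (suc D) (c ∸ a) Y ⟩
    (c ∸ a) * (suc D * Y) ≡⟨ ℕₚ.*-distribʳ-∸ (suc D * Y) c a ⟩
    c * (suc D * Y) ∸ a * (suc D * Y) ≤⟨ ℕₚ.m≤n+o⇒m∸n≤o (c * (suc D * Y)) (a * (suc D * Y)) (ℕₚ.≤-trans (ℕₚ.≤-reflexive (ℕₚ.*-comm c _)) h) ⟩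
    p * suc D ≡⟨ ℕₚ.*-comm p (suc D) ⟩
    suc D * p ∎)) ⟩
  p div Y ∎))
  where
  open ℕₚ.≤-Reasoning
  open Data.Nat.Solver.+-*-Solver

odd-prime : ∀ {p} → Prime p → 2 < p → ∃ λ q → suc (q + q) ≡ p
odd-prime {p} p-prime 2<p = by-remainder (p % 2) refl (m%n<n p 2)
  where
  by-remainder : ∀ r → p % 2 ≡ r → r < 2 → ∃ λ q → suc (q + q) ≡ p
  by-remainder zero eq _ = ⊥-elim ([ (λ ()) , (λ 2≡p → ℕₚ.<⇒≢ 2<p 2≡p) ]′ (prime⇒irreducible p-prime (m%n≡0⇒n∣m p 2 eq)))
  by-remainder (suc zero) eq _ = p div 2 , sym (trans (m≡m%n+[m/n]*n p 2) (trans (cong (_+ p div 2 * 2) eq)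
    (cong suc (trans (ℕₚ.*-comm (p div 2) 2) (cong (_+_ (p div 2)) (ℕₚ.+-identityʳ (p div 2)))))))
  by-remainder (suc (suc r)) _ (s≤s (s≤s ()))

module Main (d c : ℕ) (1≤d : 1 ≤ d) (p′ : ℕ) (large : 2 ^ ((d + c + 2) * 20) ≤ suc p′) (p-prime : Prime (suc p′))
            (F : Poly) (F-degree : HasDegree (suc p′) F d) (F-squareFree : SquareFree (suc p′) F)
            (n : ℕ) (m⁴≤ : suc (suc n) ^ 4 ≤ c * ⌊log₂ suc p′ ⌋) where
  private
    p = suc p′
    m = suc (suc n)
    ℓ = ⌊log₂ p ⌋
    -- The divisor 20 makes Z^20 = 2^(20 L) ≤ 2^ℓ ≤ p.
    L = ℓ div 20
    Z = 2 ^ L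

    d+c+2≤L : d + c + 2 ≤ L
    d+c+2≤L = ℕₚ.≤-trans (ℕₚ.≤-reflexive (sym (m*n/n≡m (d + c + 2) 20)))
      (/-monoˡ-≤ 20 (ℕₚ.≤-trans (ℕₚ.≤-reflexive (sym (⌊log₂[2^n]⌋≡n ((d + c + 2) * 20)))) (⌊log₂⌋-mono-≤ large)))

    2≤L : 2 ≤ L
    2≤L = ℕₚ.≤-trans (ℕₚ.m≤n+m 2 (d + c)) d+c+2≤L

    1≤L : 1 ≤ L
    1≤L = ℕₚ.≤-trans (s≤s z≤n) 2≤L

    -- Rounding ℓ / 20 down loses at most a factor 2, because L ≥ 1.
    ℓ≤40L : ℓ ≤ 40 * L
    ℓ≤40L = begin
      ℓ ≡⟨ m≡m%n+[m/n]*n ℓ 20 ⟩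
      ℓ % 20 + L * 20 ≤⟨ ℕₚ.+-monoˡ-≤ (L * 20) (ℕₚ.<⇒≤ (m%n<n ℓ 20)) ⟩
      20 + L * 20 ≤⟨ ℕₚ.+-monoˡ-≤ (L * 20) (ℕₚ.*-monoˡ-≤ 20 1≤L) ⟩
      L * 20 + L * 20 ≡⟨ ℕₚ.*-distribˡ-+ L 20 20 ⟨
      L * 40 ≡⟨ ℕₚ.*-comm L 40 ⟩
      40 * L ∎
      where open ℕₚ.≤-Reasoning

    4≤Z : 4 ≤ Z
    4≤Z = ℕₚ.^-monoʳ-≤ 2 2≤L

    Z^20≤p : Z ^ 20 ≤ p
    Z^20≤p = begin
      Z ^ 20 ≡⟨ ℕₚ.^-*-assoc 2 L 20 ⟩
      2 ^ (L * 20) ≤⟨ ℕₚ.^-monoʳ-≤ 2 (m/n*n≤m ℓ 20) ⟩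
      2 ^ ℓ ≤⟨ 2^⌊log₂n⌋≤n p (s≤s z≤n) ⟩
      p ∎
      where open ℕₚ.≤-Reasoning

    L+2≤Z : L + 2 ≤ Z
    L+2≤Z = n+2≤2^n L 2≤L

    ≤L⇒≤Z : ∀ {k} → k ≤ L → k ≤ Z
    ≤L⇒≤Z k≤L = ℕₚ.≤-trans k≤L (ℕₚ.≤-trans (ℕₚ.m≤m+n L 2) L+2≤Z)

    1+d≤Z : suc d ≤ Z
    1+d≤Z = ≤L⇒≤Z (ℕₚ.≤-trans (ℕₚ.≤-reflexive (ℕₚ.+-comm 1 d)) (ℕₚ.≤-trans (ℕₚ.+-mono-≤ (ℕₚ.m≤m+n d c) (s≤s (z≤n {1}))) d+c+2≤L))

    c≤Z : c ≤ Z
    c≤Z = ≤L⇒≤Z (ℕₚ.≤-trans (ℕₚ.≤-trans (ℕₚ.m≤n+m c d) (ℕₚ.m≤m+n (d + c) 2)) d+c+2≤L)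

  open Sizes Z p 4≤Z Z^20≤p using (mul; from4; to-p)

  private
    ≤Z^1 : ∀ {a} → a ≤ Z → a ≤ Z ^ 1
    ≤Z^1 a≤ = ℕₚ.≤-trans a≤ (ℕₚ.≤-reflexive (sym (ℕₚ.*-identityʳ Z)))

    -- Serves to make the boundary terms, of size L (m + D)², small against p².
    m≤Z^5 : m ≤ Z ^ 5
    m≤Z^5 = begin
      m ≡⟨ ℕₚ.*-identityʳ m ⟨
      m * 1 ≤⟨ ℕₚ.*-monoʳ-≤ m (ℕₚ.m^n>0 m 3) ⟩
      m ^ 4 ≤⟨ m⁴≤ ⟩
      c * ℓ ≤⟨ mul 1 4 (≤Z^1 c≤Z) (ℕₚ.≤-trans ℓ≤40L (mul 3 1 (from4 3 (ℕₚ.m≤m+n 40 24)) (≤Z^1 (≤L⇒≤Z ℕₚ.≤-refl)))) ⟩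
      Z ^ 5 ∎
      where open ℕₚ.≤-Reasoning

  open Sizes.Window Z p 4≤Z Z^20≤p {L} {d} {m} 1≤L L+2≤Z 1+d≤Z m≤Z^5

  private
    Y : ℕ
    Y = 4 * (L * Z)

    2<p : 2 < p
    2<p = to-p 19 1 refl (≤Z^1 (ℕₚ.≤-trans (s≤s (s≤s (s≤s z≤n))) 4≤Z))

    q : ℕ
    q = proj₁ (odd-prime p-prime 2<p)

    p-odd : suc (q + q) ≡ p
    p-odd = proj₂ (odd-prime p-prime 2<p)

    𝔽 : PrimeField p
    𝔽 = residueField p p-prime

    Y≢0 : NonZero Y
    Y≢0 = ℕ.>-nonZero (ℕₚ.*-mono-≤ {1} {4} {1} {L * Z} (s≤s z≤n) (ℕₚ.*-mono-≤ {1} {L} {1} {Z} 1≤L (ℕₚ.≤-trans (s≤s z≤n) 4≤Z)))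

    E : ℕ
    E = 3 * D + _div_ p Y {{Y≢0}}

    e : ℕ → ℤ
    e k = legendre p (eval F k)

    module C = Correlation 𝔽 q p-odd F
    module R = Reduction 𝔽

    len≤ : ∀ (t : ℕ) (is : List ℕ) → length is ≤ suc L → length (t ∷ is) * d ≤ D
    len≤ t is len = ℕₚ.*-monoˡ-≤ d (ℕₚ.≤-trans (s≤s len) (ℕₚ.≤-reflexive (ℕₚ.+-comm 2 L)))

    correlation : ∀ t is → All (λ i → i < t × t ≤ i + L) is → length is ≤ suc L → ℤ.∣ ∑ p (shiftProduct e (t ∷ is)) ∣ ≤ E
    correlation t is inWindow len = divide-bound _ (3 * D) Y (2 + D) p {{Y≢0}} (begin
      (3 + D) * Y * ∣corr∣ ≡⟨ cong (_* ∣corr∣) (solve 3 (λ D L Z → (con 3 :+ D) :* (con 4 :* (L :* Z)) := (D :+ con 3) :* (con 2 :* (L :* Z)) :+ (D :+ con 3) :* (con 2 :* (L :* Z))) refl D L Z) ⟩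
      (μ + μ) * ∣corr∣ ≤⟨ C.correlation-bound (R.HasDegree⇒HasDeg F d F-degree) (R.SquareFree⇒ F F-squareFree) 1≤d L
        1+d*L<p 1≤μ stepanov-small t is inWindow (len≤ t is len) ⟩
      3 * ((μ + μ) * D) + p * (D + 3)
        ≡⟨ solve 4 (λ D L Z p → con 3 :* (((D :+ con 3) :* (con 2 :* (L :* Z)) :+ (D :+ con 3) :* (con 2 :* (L :* Z))) :* D) :+ p :* (D :+ con 3)
             := con 3 :* D :* ((con 3 :+ D) :* (con 4 :* (L :* Z))) :+ p :* (con 3 :+ D)) refl D L Z p ⟩
      3 * D * ((3 + D) * Y) + p * (3 + D) ∎)
      where
      open ℕₚ.≤-Reasoning
      open Data.Nat.Solver.+-*-Solver
      ∣corr∣ = ℤ.∣ ∑ p (shiftProduct e (t ∷ is)) ∣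

    zeros : ∀ t → ∑ⁿ p (λ k → 1 ∸ ℤ.∣ e (k + t) ∣) ≤ D
    zeros t = ℕₚ.≤-trans (ℕₚ.≤-reflexive (∑ⁿ-cong p λ k → cong (λ z → 1 ∸ ℤ.∣ z ∣) (sym (ℤₚ.*-identityʳ (e (k + t))))))
      (C.zero-count (R.HasDegree⇒HasDeg F d F-degree) (R.SquareFree⇒ F F-squareFree) 1≤d L
        1+d*L<p 1≤μ stepanov-small t [] [] (len≤ t [] z≤n))

    -- E + 2 D is 5 D plus the quotient of p by 4 L Z. The quotient accounts for at most half of p,
    -- and `20LZD≤p` puts the remaining term below the other half.
    windows-small : 2 * (L * (2 ^ L * (E + 2 * D))) ≤ p
    windows-small = ℕₚ.*-cancelˡ-≤ 2 (begin
      2 * (2 * (L * (Z * (3 * D + P + 2 * D))))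
        ≡⟨ solve 4 (λ L Z D P → con 2 :* (con 2 :* (L :* (Z :* (con 3 :* D :+ P :+ con 2 :* D)))) := con 20 :* (L :* (Z :* D)) :+ P :* (con 4 :* (L :* Z))) refl L Z D P ⟩
      20 * (L * (Z * D)) + P * Y ≤⟨ ℕₚ.+-mono-≤ 20LZD≤p (m/n*n≤m p Y {{Y≢0}}) ⟩
      p + p ≡⟨ cong (_+_ p) (sym (ℕₚ.+-identityʳ p)) ⟩
      2 * p ∎)
      where
      open ℕₚ.≤-Reasoning
      open Data.Nat.Solver.+-*-Solver
      P = _div_ p Y {{Y≢0}}

    open Deviations p F (suc n) using (∑ε²; ε; ∑-deviation)

    module W = Walk (suc n) e (S p F) (λ k → C.character-value (Euler.legendre-character 𝔽 q p-odd (eval F k))) (λ _ → refl) p D E L zeros correlation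

    A : ℤ
    A = ∑ε² m

    ∑δ²≡4A : ∑ m (λ a → W.δ a ℤ.* W.δ a) ≡ + 4 ℤ.* A
    ∑δ²≡4A = trans (∑-cong-< m λ a a<m → trans (cong (λ z → z ℤ.* z) (∑-deviation a a<m))
        (solve 1 (λ x → (con (+ 2) :* x) :* (con (+ 2) :* x) := con (+ 4) :* (x :* x)) refl (ε a))) (∑-*ˡ m (+ 4) (λ a → ε a ℤ.* ε a))
      where open Data.Integer.Solver.+-*-Solver

    0≤A : + 0 ℤ.≤ A
    0≤A = ℤₚ.≤-trans (ℤₚ.≤-reflexive (sym (∑-zero m))) (∑-mono-≤ m λ a → 0≤i*i (ε a))

    B : ℕ
    B = 32 * (m * m * m) * (p * p)

    -- One factor L of L² cancels against the energy bound, which is the saving from the windows. As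
    -- δ is twice ε, the constant 128 becomes 32.
    LA≤ : + L ℤ.* A ℤ.≤ + B
    LA≤ = ℤₚ.*-cancelˡ-≤-pos (+ L ℤ.* A) (+ B) (+ (4 * L)) {{4L-positive}} (begin
      + (4 * L) ℤ.* (+ L ℤ.* A) ≡⟨ trans (cong (ℤ._* (+ L ℤ.* A)) (ℤₚ.pos-* 4 L))
        (trans (solve 2 (λ L A → con (+ 4) :* L :* (L :* A) := L :* L :* (con (+ 4) :* A)) refl (+ L) A) (cong (ℤ._* (+ 4 ℤ.* A)) (sym (ℤₚ.pos-* L L)))) ⟩
      + (L * L) ℤ.* (+ 4 ℤ.* A) ≡⟨ cong (ℤ._*_ (+ (L * L))) ∑δ²≡4A ⟨
      + (L * L) ℤ.* ∑ m (λ a → W.δ a ℤ.* W.δ a) ≤⟨ W.∑δ²≤ ⟩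
      + _ ≤⟨ ℤ.+≤+ (total-bound {m} {p} {L} {D} windows-small boundary-small L*L*L≤p*p) ⟩
      + (L * (128 * (m * m * m) * (p * p))) ≡⟨ cong +_ (solveℕ 3 (λ L M P → L :*ℕ (conℕ 128 :*ℕ M :*ℕ P) :=ℕ conℕ 4 :*ℕ L :*ℕ (conℕ 32 :*ℕ M :*ℕ P)) refl L (m * m * m) (p * p)) ⟩
      + (4 * L * B) ≡⟨ ℤₚ.pos-* (4 * L) B ⟩
      + (4 * L) ℤ.* + B ∎)
      where
      open ℤₚ.≤-Reasoning
      open Data.Integer.Solver.+-*-Solver
      open Data.Nat.Solver.+-*-Solver using () renaming (solve to solveℕ; con to conℕ; _:*_ to _:*ℕ_; _:=_ to _:=ℕ_)
      4L-positive : ℤ.Positive (+ (4 * L))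
      4L-positive = ℤ.positive (ℤ.+<+ (ℕₚ.≤-trans 1≤L (ℕₚ.m≤m+n L (3 * L))))

  -- The constant is 40 · 32. Up to the last inequality the bound is 1280 m³ p², which corresponds
  -- to 1280 m / ℓ for the sum of squares; multiplying by m brings it to the form with m².
  deviation-bound : + ℓ ℤ.* A ℤ.≤ + (1280 * m ^ 2 * (p * m * (p * m)))
  deviation-bound = begin
    + ℓ ℤ.* A ≤⟨ ℤₚ.*-monoʳ-≤-nonNeg A {{ℤ.nonNegative 0≤A}} (ℤ.+≤+ ℓ≤40L) ⟩
    + (40 * L) ℤ.* A ≡⟨ trans (cong (ℤ._* A) (ℤₚ.pos-* 40 L)) (ℤₚ.*-assoc (+ 40) (+ L) A) ⟩
    + 40 ℤ.* (+ L ℤ.* A) ≤⟨ ℤₚ.*-monoˡ-≤-nonNeg (+ 40) LA≤ ⟩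
    + 40 ℤ.* + B ≡⟨ ℤₚ.pos-* 40 B ⟨
    + (40 * B) ≤⟨ ℤ.+≤+ (ℕₚ.m≤m*n (40 * B) m) ⟩
    + (40 * B * m) ≡⟨ cong +_ (solve 2 (λ m p → con 40 :* (con 32 :* (m :* m :* m) :* (p :* p)) :* m := con 1280 :* (m :* (m :* con 1)) :* (p :* m :* (p :* m))) refl m p) ⟩
    + (1280 * m ^ 2 * (p * m * (p * m))) ∎
    where
    open ℤₚ.≤-Reasoning
    open Data.Nat.Solver.+-*-Solver

  sqDev-bound : sqDev p F m ℚ.* ((+ ℓ) ℚ./ 1) ℚ.≤ (+ (1280 * m ^ 2)) ℚ./ 1
  sqDev-bound = sqDev-≤ p′ F n ℓ (1280 * m ^ 2) deviation-bound

theorem1 : (d : ℕ) → 1 ≤ d → (c : ℕ) →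
    Σ ℕ λ C → Σ ℕ λ P₀ →
    (p : ℕ) → P₀ ≤ p → Prime p →
    (F : Poly) → HasDegree p F d → SquareFree p F →
    (m : ℕ) → 2 ≤ m → m ^ 4 ≤ c * ⌊log₂ p ⌋ →
    sqDev p F m ℚ.* ((+ ⌊log₂ p ⌋) / 1) ℚ.≤ (+ (C * m ^ 2)) / 1
-- The threshold gives L ≥ d + c + 2, so that L ≥ 2 and both d + 1 and c are at most Z.
theorem1 d 1≤d c = 1280 , 2 ^ ((d + c + 2) * 20) , proof
  where
  proof : (p : ℕ) → 2 ^ ((d + c + 2) * 20) ≤ p → Prime p → (F : Poly) → HasDegree p F d → SquareFree p F →
    (m : ℕ) → 2 ≤ m → m ^ 4 ≤ c * ⌊log₂ p ⌋ → sqDev p F m ℚ.* ((+ ⌊log₂ p ⌋) / 1) ℚ.≤ (+ (1280 * m ^ 2)) / 1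
  proof zero large _ _ _ _ _ _ _ = contradiction large (ℕₚ.<⇒≱ (ℕₚ.m^n>0 2 ((d + c + 2) * 20)))
  proof (suc p′) large p-prime F F-degree F-squareFree (suc (suc n)) _ m⁴≤ =
    Main.sqDev-bound d c 1≤d p′ large p-prime F F-degree F-squareFree n m⁴≤
  proof (suc p′) _ _ _ _ _ (suc zero) (s≤s ())
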